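{- Let $n=p_1^{\alpha_1}\cdots p_k^{\alpha_k}$, where $k\geq 1$, $\alpha_i\geq 1$ and the $p_i$ are distinct primes satisfying $p_i\equiv 1\pmod 4$ for all $i=1,\ldots,k$. For each $i\in\{1,\ldots,k\}$ let $p_i=a_i^2+b_i^2$, where $a_i,b_i$ are integers and $a_i$ is even. Then the number $\mathcal{K}_4(G_n)$ of cliques of order four in the Paley-type graph $G_n$ is $$\mathcal{K}_4(G_n)=\frac{1}{3\times 8^{2k+1}}\prod_{i=1}^k\left[p_i^{4\alpha_i-3}(p_i-1)\{(p_i-9)^2-4a_i^2\}\right].$$
   Context: For $n=p_1^{\alpha_1}\cdots p_k^{\alpha_k}$ with distinct primes $p_i\equiv 1\pmod 4$ and $\alpha_i\ge 1$, let $\mathbb{Z}_n^\ast$ be the group of units of the ring $\mathbb{Z}_n=\mathbb{Z}/n\mathbb{Z}$. The Paley-type graph $G_n$ is the simple undirected graph with vertex set $\mathbb{Z}_n$ in which $xy$ is an edge if and only if $x-y\equiv a^2\pmod n$ for some $a\in\mathbb{Z}_n^\ast$ (this is symmetric since $-1$ is a square in $\mathbb{Z}_n^\ast$). For a graph $G$, $\mathcal{K}_m(G)$ denotes the number of cliques of order $m$ in $G$, i.e. the number of $m$-element sets of pairwise adjacent vertices. Every prime $p\equiv 1\pmod 4$ can be written as $p=a^2+b^2$ with $a$ even, and then $a^2$ and $b^2$ are uniquely determined. -}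

module Defs where

open import Data.Fin using (Fin; toℕ; _≟_)
open import Data.Fin.Properties using (all?; any?)
open import Data.Fin.Subset using (Subset; inside; outside; _∈_; ∣_∣)
open import Data.Fin.Subset.Properties using (_∈?_)
open import Data.Integer using (ℤ; +_; 1ℤ; _-_; _*_)
open import Data.Integer.Divisibility using (_∣_)
import Data.Integer.Properties as ℤ
open import Data.List using (List; []; _∷_; _++_; map; filter; length)
open import Data.Nat as ℕ using (ℕ; zero; suc)
import Data.Nat.Divisibility as ℕ
import Data.Nat.Properties as ℕ
open import Data.Product using (∃; _×_)
open import Data.Vec using ([]; _∷_)
open import Level using (0ℓ)
open import Relation.Binary using (Rel; Decidable)
open import Relation.Binary.PropositionalEquality using (_≡_; _≢_)
open import Relation.Nullary using (Dec; ¬?)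
open import Relation.Nullary.Decidable using (_×-dec_; _→-dec_)
import Relation.Unary as Unary

open import Algebra.Properties.Monoid.Sum ℕ.*-1-monoid public
  using () renaming (sum to ∏ℕ)
open import Algebra.Properties.Monoid.Sum ℤ.*-1-monoid public
  using () renaming (sum to ∏ℤ)

infix 4 _≡_[mod_] _≡?_[mod_]

_≡_[mod_] : ℤ → ℤ → ℕ → Set
x ≡ y [mod n ] = + n ∣ x - y

_≡?_[mod_] : ∀ x y n → Dec (x ≡ y [mod n ])
x ≡? y [mod n ] = n ℕ.∣? Data.Integer.∣ x - y ∣

-- ℤₙ is represented by its least non-negative residues Fin n; the ring
-- operations are those of ℤ, taken up to congruence.
⟦_⟧ : ∀ {n} → Fin n → ℤ
⟦ x ⟧ = + toℕ x

IsUnit : ∀ {n} → Fin n → Set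
IsUnit {n} a = ∃ λ (u : Fin n) → ⟦ a ⟧ * ⟦ u ⟧ ≡ 1ℤ [mod n ]

isUnit? : ∀ {n} → Unary.Decidable (IsUnit {n})
isUnit? {n} a = any? λ u → ⟦ a ⟧ * ⟦ u ⟧ ≡? 1ℤ [mod n ]

-- Symmetry and irreflexivity are not part of the record: IsClique asks for
-- adjacency in both orders, and only between distinct vertices, so loops are
-- irrelevant and every clique is one of the undirected simple graph.
record Graph (n : ℕ) : Set₁ where
  field
    Adj  : Rel (Fin n) 0ℓ
    adj? : Decidable Adj

module _ {n : ℕ} (G : Graph n) where
  open Graph G

  IsClique : Subset n → Set
  IsClique S = ∀ x y → x ∈ S → y ∈ S → x ≢ y → Adj x y

  isClique? : Unary.Decidable IsClique
  isClique? S = all? λ x → all? λ y →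
    (x ∈? S) →-dec ((y ∈? S) →-dec (¬? (x ≟ y) →-dec adj? x y))

subsets : ∀ n → List (Subset n)
subsets zero    = [] ∷ []
subsets (suc n) = map (inside ∷_) (subsets n) ++ map (outside ∷_) (subsets n)

𝒦 : ℕ → ∀ {n} → Graph n → ℕ
𝒦 m {n} G =
  length (filter (λ S → (∣ S ∣ ℕ.≟ m) ×-dec isClique? G S) (subsets n))

-- For n a product of powers of primes ≡ 1 (mod 4), -1 is the square of a unit,
-- so adjacency is symmetric; n > 1 then makes it irreflexive.
paleyGraph : ∀ n → Graph n
paleyGraph n = record
  { Adj  = λ x y → ∃ λ (a : Fin n) →
             IsUnit a × ⟦ x ⟧ - ⟦ y ⟧ ≡ ⟦ a ⟧ * ⟦ a ⟧ [mod n ]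
  ; adj? = λ x y → any? λ a →
             isUnit? a ×-dec (⟦ x ⟧ - ⟦ y ⟧ ≡? ⟦ a ⟧ * ⟦ a ⟧ [mod n ])
  }

3*8^n≢0 : ∀ n → ℕ.NonZero (3 ℕ.* 8 ℕ.^ n)
3*8^n≢0 n = ℕ.m*n≢0 3 (8 ℕ.^ n) {{_}} {{ℕ.m^n≢0 8 n}}

{-# OPTIONS --safe #-}

-- Counting ordered 4-cliques (24 for each clique) turns the clique number into
-- a sum over ℤ/n of products of indicators of unit squares.  By the Chinese
-- remainder theorem and Newton's iteration that indicator at z mod n is the
-- product over p ∣ n of the indicators at z mod p, so the sum is multiplicative
-- in n and a power p ^ α contributes p ^ (4 (α - 1)) times what p does.
--
-- For a prime p, translating one vertex to 0 and scaling another to 1 leaves a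
-- sum over two variables in which the indicator of the non-zero squares is
-- (χ² + χ) / 2 for the quadratic character χ.  All resulting character sums are
-- elementary except
--   E = Σ_{x,y} χ (x (1 - x) y (1 - y) (x - y)).
-- Since 1 + χ (u² - 4) is the number of x with x + 1/x = u, E is the sum of
-- χ (u + v) over u = x + 1/x and v = t + 1/t; and squaring
-- φ = Σ_x χ (x (x² + 1)) after the substitution y = t x gives φ² = E + 2 p.
-- Jacobsthal's identity φ² + ψ² = 4 p, where φ / 2 is odd, together with the
-- uniqueness of p = a² + b² gives φ² = 4 b².

module Submission where

open import Defs
import Algebra.Properties.AbelianGroup as AbelianGroupProperties
import Algebra.Properties.Monoid.Sum as MonoidSum
import Algebra.Properties.Semiring.Sum as SemiringSum
open import Algebra.Bundles using (CommutativeRing)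
import Algebra.Solver.Ring as RingSolver
import Algebra.Solver.Ring.AlmostCommutativeRing as ACR
open import Algebra.Structures using (IsCommutativeRing)
open import Data.Bool using (if_then_else_)
open import Data.Fin using (Fin)
open import Data.Fin as Fin using (toℕ; fromℕ<; _↑ˡ_; _↑ʳ_)
open import Data.Fin.Permutation using (permutation)
import Data.Fin.Properties as Fin
open import Data.Fin.Subset using (Subset; inside; outside; _∈_; ∣_∣)
open import Data.Integer as ℤ using (ℤ; +_)
open import Data.Integer using (-[1+_]; _+_; _*_; _-_; -_; 0ℤ; 1ℤ; -1ℤ)
import Data.Integer.DivMod as ℤ
open import Data.Integer.Divisibility as ℤ using ()
open import Data.Integer.Divisibility.Signed using (divides; ∣⇒∣ᵤ; ∣ᵤ⇒∣) renaming (_∣_ to _∣ₛ_)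
import Data.Integer.Properties as ℤ
open import Data.Integer.Solver using (module +-*-Solver)
open import Data.Integer.Tactic.RingSolver using (solve-∀)
open import Data.List as List using (List; []; _∷_; _++_; length; filter)
import Data.List.Properties as List
open import Data.Maybe using (Maybe; just; nothing)
open import Data.Nat as ℕ using (ℕ; _≥_; _%_; _∸_)
open import Data.Nat using (zero; suc; _!)
open import Data.Nat.Coprimality using (Coprime; coprime-Bézout; prime⇒coprime)
import Data.Nat.Divisibility as ℕ
import Data.Nat.DivMod as ℕ
open import Data.Nat.GCD using (module Bézout)
open import Data.Nat.Primality using (Prime; euclidsLemma; prime⇒nonZero; ¬prime[1])
import Data.Nat.Properties as ℕ
open import Data.Product using (_×_; _,_; proj₁; proj₂; ∃; ∃₂)
open import Data.Rational using (_/_)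
import Data.Rational.Properties as ℚ
open import Data.Rational.Unnormalised using (mkℚᵘ; *≡*)
open import Data.Sum as Sum using (_⊎_; inj₁; inj₂)
open import Data.Unit using (⊤; tt)
open import Data.Vec using ([]; _∷_; here; there)
open import Function using (_∘_)
open import Function.Definitions using (Injective)
open import Relation.Binary.Definitions using (tri<; tri≈; tri>)
open import Relation.Binary.PropositionalEquality
open import Relation.Nullary using (Dec; yes; no; does; ¬_; contradiction)
open import Relation.Nullary.Decidable using (¬?; _×-dec_)
open import Relation.Unary using (Decidable)

open SemiringSum ℤ.+-*-semiring using (sum; sum-cong-≗; ∑-distrib-+; ∑-comm; sum-permute; *-distribˡ-sum; *-distribʳ-sum)
open MonoidSum ℤ.*-1-monoid using () renaming (sum-cong-≗ to ∏ℤ-cong)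

-- Squaring φ leads back to E as follows. With y = t x the monomial factors of χ (x (x² + 1)) χ (y
-- (y² + 1)) combine to χ t χ (x²), so the product depends on x only through u = x², and each u is
-- weighted by its number 1 + χ u of square roots. In the part of weight 1, x = t u turns the
-- summand into χ (t x (x + t) (t x + 1)) = χ (x + 1/x + t + 1/t), which is the sum behind E. The
-- part of weight χ u is an elementary correlation, large only for t² = 1; since χ 1 = χ (-1) = 1 it
-- supplies the 2 p.
--
-- Everything stays in ℤ, so each indicator of non-zero squares is carried doubled. The 64 per prime
-- is 2 for the second vertex, 2 · 2 for each of the other two vertices (adjacency to 0 and to 1)
-- and 2 for the edge between those two. Because χ vanishes at 0, there are corrections at 0, at 1
-- and on the diagonal, and most of the elementary work consists of tracking them.

private module ℤ+ = AbelianGroupProperties ℤ.+-0-abelianGroup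

module ℤSolver where
  open +-*-Solver public using (solve; _:=_; _:+_; _:*_; _:-_; :-_; con)

-- Finite sums, indicators and deltas

Σ-const : ∀ n c → sum {n} (λ _ → c) ≡ + n * c
Σ-const zero    c = sym (ℤ.*-zeroˡ c)
Σ-const (suc n) c = begin
  c + sum {n} (λ _ → c)  ≡⟨ cong (_+_ c) (Σ-const n c) ⟩
  c + + n * c            ≡⟨ ℤ.suc-* (+ n) c ⟨
  + suc n * c            ∎
  where open ≡-Reasoning

Σ-zero : ∀ n → sum {n} (λ _ → 0ℤ) ≡ 0ℤ
Σ-zero n = trans (Σ-const n 0ℤ) (ℤ.*-zeroʳ (+ n))

Σ-distrib-- : ∀ {n} (f g : Fin n → ℤ) → sum (λ i → f i - g i) ≡ sum f - sum g
Σ-distrib-- f g = begin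
  sum (λ i → f i - g i)                ≡⟨ ∑-distrib-+ f (-_ ∘ g) ⟩
  sum f + sum (-_ ∘ g)                 ≡⟨ cong (_+_ (sum f)) (sum-cong-≗ (sym ∘ ℤ.-1*i≡-i ∘ g)) ⟩
  sum f + sum (λ i → -1ℤ * g i)        ≡⟨ cong (_+_ (sum f)) (*-distribˡ-sum -1ℤ g) ⟨
  sum f + -1ℤ * sum g                  ≡⟨ cong (_+_ (sum f)) (ℤ.-1*i≡-i (sum g)) ⟩
  sum f - sum g                        ∎
  where open ≡-Reasoning

Σ-bijection : ∀ {m n} (f : Fin n → ℤ) (σ : Fin m → Fin n) (τ : Fin n → Fin m) →
              (∀ x → σ (τ x) ≡ x) → (∀ x → τ (σ x) ≡ x) → sum (f ∘ σ) ≡ sum f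
Σ-bijection f σ τ στ τσ = sym (sum-permute f (permutation σ τ στ τσ))

ι : ∀ {a} {A : Set a} → Dec A → ℤ
ι d = if does d then 1ℤ else 0ℤ

ι-yes : ∀ {a} {A : Set a} (d : Dec A) → A → ι d ≡ 1ℤ
ι-yes (yes _) _ = refl
ι-yes (no ¬a) a = contradiction a ¬a

ι-no : ∀ {a} {A : Set a} (d : Dec A) → ¬ A → ι d ≡ 0ℤ
ι-no (yes a) ¬a = contradiction a ¬a
ι-no (no _)  _  = refl

ι-cong : ∀ {a b} {A : Set a} {B : Set b} (d : Dec A) (e : Dec B) → (A → B) → (B → A) → ι d ≡ ι e
ι-cong (yes a) e f g = sym (ι-yes e (f a))
ι-cong (no ¬a) e f g = sym (ι-no e (¬a ∘ g))

ι-idem : ∀ {a} {A : Set a} (d : Dec A) → ι d * ι d ≡ ι d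
ι-idem (yes _) = refl
ι-idem (no _)  = refl

ι-× : ∀ {a b c} {A : Set a} {B : Set b} {C : Set c} (d : Dec A) (e : Dec B) (f : Dec C) →
      (C → A × B) → (A → B → C) → ι f ≡ ι d * ι e
ι-× (yes a) (yes b) f to from = ι-yes f (from a b)
ι-× (yes a) (no ¬b) f to from = ι-no f (¬b ∘ proj₂ ∘ to)
ι-× (no ¬a) e       f to from = trans (ι-no f (¬a ∘ proj₁ ∘ to)) (sym (ℤ.*-zeroˡ (ι e)))

δ : ∀ {n} → Fin n → Fin n → ℤ
δ i j = ι (i Fin.≟ j)

δ-refl : ∀ {n} (i : Fin n) → δ i i ≡ 1ℤ
δ-refl i = ι-yes (i Fin.≟ i) refl

δ-≢ : ∀ {n} {i j : Fin n} → i ≢ j → δ i j ≡ 0ℤ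
δ-≢ = ι-no (_ Fin.≟ _)

δ-sym : ∀ {n} (i j : Fin n) → δ i j ≡ δ j i
δ-sym i j = ι-cong (i Fin.≟ j) (j Fin.≟ i) sym sym

δ-subst : ∀ {n} (i j : Fin n) {f : Fin n → ℤ} → δ i j * f j ≡ δ i j * f i
δ-subst i j {f} with i Fin.≟ j
... | yes refl = refl
... | no _     = trans (ℤ.*-zeroˡ (f j)) (sym (ℤ.*-zeroˡ (f i)))

Σ-δ : ∀ {n} (i : Fin n) (f : Fin n → ℤ) → sum (λ j → δ i j * f j) ≡ f i
Σ-δ {suc n} Fin.zero f = begin
  1ℤ * f Fin.zero + sum (λ j → 0ℤ * f (Fin.suc j))  ≡⟨ cong₂ _+_ (ℤ.*-identityˡ (f Fin.zero)) (trans (sum-cong-≗ {n} λ j → ℤ.*-zeroˡ (f (Fin.suc j))) (Σ-zero n)) ⟩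
  f Fin.zero + 0ℤ                                   ≡⟨ ℤ.+-identityʳ (f Fin.zero) ⟩
  f Fin.zero                                        ∎
  where open ≡-Reasoning
Σ-δ {suc n} (Fin.suc i) f = begin
  0ℤ * f Fin.zero + sum (λ j → δ (Fin.suc i) (Fin.suc j) * f (Fin.suc j))
    ≡⟨ cong₂ _+_ (ℤ.*-zeroˡ (f Fin.zero)) (sum-cong-≗ {n} λ j → cong (_* f (Fin.suc j)) (ι-cong (Fin.suc i Fin.≟ Fin.suc j) (i Fin.≟ j) Fin.suc-injective (cong Fin.suc))) ⟩
  0ℤ + sum (λ j → δ i j * f (Fin.suc j))  ≡⟨ ℤ.+-identityˡ (sum (λ j → δ i j * f (Fin.suc j))) ⟩
  sum (λ j → δ i j * f (Fin.suc j))       ≡⟨ Σ-δ i (f ∘ Fin.suc) ⟩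
  f (Fin.suc i)                           ∎
  where open ≡-Reasoning

Σ-δ₁ : ∀ {n} (i : Fin n) → sum (δ i) ≡ 1ℤ
Σ-δ₁ i = trans (sum-cong-≗ λ j → sym (ℤ.*-identityʳ (δ i j))) (Σ-δ i (λ _ → 1ℤ))

Σ-*-Σ : ∀ {m n} (f : Fin m → ℤ) (g : Fin n → ℤ) → sum f * sum g ≡ sum (λ i → sum (λ j → f i * g j))
Σ-*-Σ f g = trans (*-distribʳ-sum (sum g) f) (sum-cong-≗ λ i → *-distribˡ-sum (f i) g)

-- The ring ℤ/n

-- Two representatives below n differ by less than n in absolute value, and 0 is the only multiple
-- of n that small.
⟦⟧-injective-mod : ∀ {n} {i j : Fin n} → + n ∣ₛ ⟦ i ⟧ - ⟦ j ⟧ → i ≡ j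
⟦⟧-injective-mod {n} {i} {j} n∣i-j = Fin.toℕ-injective (ℤ.+-injective (ℤ.i-j≡0⇒i≡j ⟦ i ⟧ ⟦ j ⟧ (ℤ.∣i∣≡0⇒i≡0 ∣i-j∣≡0)))
  where
  small : ℤ.∣ ⟦ i ⟧ - ⟦ j ⟧ ∣ ℕ.< n
  small = ℕ.≤-<-trans (ℕ.≤-trans (ℕ.≤-reflexive (cong ℤ.∣_∣ (ℤ.m-n≡m⊖n (toℕ i) (toℕ j)))) (ℤ.∣m⊝n∣≤m⊔n (toℕ i) (toℕ j)))
                      (ℕ.⊔-lub (Fin.toℕ<n i) (Fin.toℕ<n j))
  ∣i-j∣≡0 : ℤ.∣ ⟦ i ⟧ - ⟦ j ⟧ ∣ ≡ 0
  ∣i-j∣≡0 with ℤ.∣ ⟦ i ⟧ - ⟦ j ⟧ ∣ | small | ∣⇒∣ᵤ n∣i-j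
  ... | zero  | _   | _ = refl
  ... | suc _ | s<n | d = contradiction d (ℕ.>⇒∤ s<n)

opaque
  -- Opaque, so that later proofs see residues only through `red-∣` and never unfold the division by
  -- n.
  red : ∀ n .{{_ : ℕ.NonZero n}} → ℤ → Fin n
  red n x = fromℕ< (ℤ.n%ℕd<d x n)

  red-∣ : ∀ n .{{_ : ℕ.NonZero n}} x → + n ∣ₛ x - ⟦ red n x ⟧
  red-∣ n x = divides (x ℤ./ℕ n) (begin
    x - ⟦ red n x ⟧                                 ≡⟨ cong (λ r → x - + r) (Fin.toℕ-fromℕ< (ℤ.n%ℕd<d x n)) ⟩
    x - + (x ℤ.%ℕ n)                                ≡⟨ cong (_- + (x ℤ.%ℕ n)) (ℤ.a≡a%ℕn+[a/ℕn]*n x n) ⟩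
    + (x ℤ.%ℕ n) + x ℤ./ℕ n * + n - + (x ℤ.%ℕ n)    ≡⟨ solve 2 (λ r q → r :+ q :- r := q) refl (+ (x ℤ.%ℕ n)) (x ℤ./ℕ n * + n) ⟩
    x ℤ./ℕ n * + n                                  ∎)
    where
    open ≡-Reasoning
    open ℤSolver

∣ₛ-resp : ∀ {k x y} → x ≡ y → k ∣ₛ x → k ∣ₛ y
∣ₛ-resp refl k∣x = k∣x

∣ₛ-+ : ∀ {k x y} → k ∣ₛ x → k ∣ₛ y → k ∣ₛ x + y
∣ₛ-+ {k} (divides q refl) (divides r refl) = divides (q + r) (sym (ℤ.*-distribʳ-+ k q r))

∣ₛ-* : ∀ {k x} c → k ∣ₛ x → k ∣ₛ c * x
∣ₛ-* {k} c (divides q refl) = divides (c * q) (sym (ℤ.*-assoc c q k))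

module Residue (n : ℕ) .{{_ : ℕ.NonZero n}} where

  # : ℤ → Fin n
  # = red n

  #-cong : ∀ {x y} → + n ∣ₛ x - y → # x ≡ # y
  #-cong {x} {y} n∣x-y = ⟦⟧-injective-mod (∣ₛ-resp eq (∣ₛ-+ (∣ₛ-+ (∣ₛ-* -1ℤ (red-∣ n x)) n∣x-y) (red-∣ n y)))
    where
    open ℤSolver
    eq : -1ℤ * (x - ⟦ # x ⟧) + (x - y) + (y - ⟦ # y ⟧) ≡ ⟦ # x ⟧ - ⟦ # y ⟧
    eq = solve 4 (λ x y a b → con -1ℤ :* (x :- a) :+ (x :- y) :+ (y :- b) := a :- b) refl x y ⟦ # x ⟧ ⟦ # y ⟧

  #-injective : ∀ {x y} → # x ≡ # y → + n ∣ₛ x - y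
  #-injective {x} {y} eq = ∣ₛ-resp eq′ (∣ₛ-+ (red-∣ n x) (∣ₛ-* -1ℤ (red-∣ n y)))
    where
    open ℤSolver
    eq′ : x - ⟦ # x ⟧ + -1ℤ * (y - ⟦ # y ⟧) ≡ x - y
    eq′ = trans (cong (λ r → x - ⟦ r ⟧ + -1ℤ * (y - ⟦ # y ⟧)) eq)
                (solve 3 (λ x y a → (x :- a) :+ con -1ℤ :* (y :- a) := x :- y) refl x y ⟦ # y ⟧)

  #-⟦⟧ : ∀ i → # ⟦ i ⟧ ≡ i
  #-⟦⟧ i = sym (⟦⟧-injective-mod (red-∣ n ⟦ i ⟧))

  infixl 6 _⊕_ _⊖_
  infixl 7 _⊗_
  infix  8 ⊝_

  opaque
    _⊕_ _⊗_ : Fin n → Fin n → Fin n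
    i ⊕ j = # (⟦ i ⟧ + ⟦ j ⟧)
    i ⊗ j = # (⟦ i ⟧ * ⟦ j ⟧)

    ⊝_ : Fin n → Fin n
    ⊝ i = # (- ⟦ i ⟧)

    #-+ : ∀ x y → # (x + y) ≡ # x ⊕ # y
    #-+ x y = #-cong (∣ₛ-resp eq (∣ₛ-+ (red-∣ n x) (red-∣ n y)))
      where
      open ℤSolver
      eq : x - ⟦ # x ⟧ + (y - ⟦ # y ⟧) ≡ x + y - (⟦ # x ⟧ + ⟦ # y ⟧)
      eq = solve 4 (λ x y a b → x :- a :+ (y :- b) := x :+ y :- (a :+ b)) refl x y ⟦ # x ⟧ ⟦ # y ⟧

    #-* : ∀ x y → # (x * y) ≡ # x ⊗ # y
    #-* x y = #-cong (∣ₛ-resp eq (∣ₛ-+ (∣ₛ-* y (red-∣ n x)) (∣ₛ-* ⟦ # x ⟧ (red-∣ n y))))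
      where
      open ℤSolver
      eq : y * (x - ⟦ # x ⟧) + ⟦ # x ⟧ * (y - ⟦ # y ⟧) ≡ x * y - ⟦ # x ⟧ * ⟦ # y ⟧
      eq = solve 4 (λ x y a b → y :* (x :- a) :+ a :* (y :- b) := x :* y :- a :* b) refl x y ⟦ # x ⟧ ⟦ # y ⟧

    #-neg : ∀ x → # (- x) ≡ ⊝ # x
    #-neg x = #-cong (∣ₛ-resp eq (∣ₛ-* -1ℤ (red-∣ n x)))
      where
      open ℤSolver
      eq : -1ℤ * (x - ⟦ # x ⟧) ≡ - x - - ⟦ # x ⟧
      eq = solve 2 (λ x a → con -1ℤ :* (x :- a) := :- x :- :- a) refl x ⟦ # x ⟧

  _⊖_ : Fin n → Fin n → Fin n
  i ⊖ j = i ⊕ ⊝ j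

  𝟘 𝟙 : Fin n
  𝟘 = # 0ℤ
  𝟙 = # 1ℤ

  -- Every residue is the image of an integer, so the ring laws below are inherited from ℤ along the
  -- homomorphism `#`.
  #-surjective : (P : Fin n → Set) → (∀ x → P (# x)) → ∀ i → P i
  #-surjective P p i = subst P (#-⟦⟧ i) (p ⟦ i ⟧)

  ⊕-assoc : ∀ i j k → (i ⊕ j) ⊕ k ≡ i ⊕ (j ⊕ k)
  ⊕-assoc = #-surjective _ λ x → #-surjective _ λ y → #-surjective _ λ z → begin
    (# x ⊕ # y) ⊕ # z   ≡⟨ cong (_⊕ # z) (#-+ x y) ⟨
    # (x + y) ⊕ # z     ≡⟨ #-+ (x + y) z ⟨
    # (x + y + z)       ≡⟨ cong # (ℤ.+-assoc x y z) ⟩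
    # (x + (y + z))     ≡⟨ #-+ x (y + z) ⟩
    # x ⊕ # (y + z)     ≡⟨ cong (# x ⊕_) (#-+ y z) ⟩
    # x ⊕ (# y ⊕ # z)   ∎
    where open ≡-Reasoning

  ⊗-assoc : ∀ i j k → (i ⊗ j) ⊗ k ≡ i ⊗ (j ⊗ k)
  ⊗-assoc = #-surjective _ λ x → #-surjective _ λ y → #-surjective _ λ z → begin
    (# x ⊗ # y) ⊗ # z   ≡⟨ cong (_⊗ # z) (#-* x y) ⟨
    # (x * y) ⊗ # z     ≡⟨ #-* (x * y) z ⟨
    # (x * y * z)       ≡⟨ cong # (ℤ.*-assoc x y z) ⟩
    # (x * (y * z))     ≡⟨ #-* x (y * z) ⟩
    # x ⊗ # (y * z)     ≡⟨ cong (# x ⊗_) (#-* y z) ⟩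
    # x ⊗ (# y ⊗ # z)   ∎
    where open ≡-Reasoning

  ⊗-distribˡ-⊕ : ∀ i j k → i ⊗ (j ⊕ k) ≡ i ⊗ j ⊕ i ⊗ k
  ⊗-distribˡ-⊕ = #-surjective _ λ x → #-surjective _ λ y → #-surjective _ λ z → begin
    # x ⊗ (# y ⊕ # z)       ≡⟨ cong (# x ⊗_) (#-+ y z) ⟨
    # x ⊗ # (y + z)         ≡⟨ #-* x (y + z) ⟨
    # (x * (y + z))         ≡⟨ cong # (ℤ.*-distribˡ-+ x y z) ⟩
    # (x * y + x * z)       ≡⟨ #-+ (x * y) (x * z) ⟩
    # (x * y) ⊕ # (x * z)   ≡⟨ cong₂ _⊕_ (#-* x y) (#-* x z) ⟩
    # x ⊗ # y ⊕ # x ⊗ # z   ∎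
    where open ≡-Reasoning

  ⊕-comm : ∀ i j → i ⊕ j ≡ j ⊕ i
  ⊕-comm = #-surjective _ λ x → #-surjective _ λ y →
    trans (sym (#-+ x y)) (trans (cong # (ℤ.+-comm x y)) (#-+ y x))

  ⊗-comm : ∀ i j → i ⊗ j ≡ j ⊗ i
  ⊗-comm = #-surjective _ λ x → #-surjective _ λ y →
    trans (sym (#-* x y)) (trans (cong # (ℤ.*-comm x y)) (#-* y x))

  ⊕-identityˡ : ∀ i → 𝟘 ⊕ i ≡ i
  ⊕-identityˡ = #-surjective _ λ x → trans (sym (#-+ 0ℤ x)) (cong # (ℤ.+-identityˡ x))

  ⊗-identityˡ : ∀ i → 𝟙 ⊗ i ≡ i
  ⊗-identityˡ = #-surjective _ λ x → trans (sym (#-* 1ℤ x)) (cong # (ℤ.*-identityˡ x))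

  ⊕-inverseˡ : ∀ i → ⊝ i ⊕ i ≡ 𝟘
  ⊕-inverseˡ = #-surjective _ λ x →
    trans (cong (_⊕ # x) (sym (#-neg x))) (trans (sym (#-+ (- x) x)) (cong # (ℤ.+-inverseˡ x)))

  isCommutativeRing : IsCommutativeRing _≡_ _⊕_ _⊗_ ⊝_ 𝟘 𝟙
  isCommutativeRing = record
    { isRing = record
      { +-isAbelianGroup = record
        { isGroup = record
          { isMonoid = record
            { isSemigroup = record
              { isMagma = record { isEquivalence = isEquivalence ; ∙-cong = cong₂ _⊕_ }
              ; assoc = ⊕-assoc
              }
            ; identity = ⊕-identityˡ , λ i → trans (⊕-comm i 𝟘) (⊕-identityˡ i)
            }
          ; inverse = ⊕-inverseˡ , λ i → trans (⊕-comm i (⊝ i)) (⊕-inverseˡ i)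
          ; ⁻¹-cong = cong ⊝_
          }
        ; comm = ⊕-comm
        }
      ; *-cong = cong₂ _⊗_
      ; *-assoc = ⊗-assoc
      ; *-identity = ⊗-identityˡ , λ i → trans (⊗-comm i 𝟙) (⊗-identityˡ i)
      ; distrib = ⊗-distribˡ-⊕ , λ i j k → trans (⊗-comm (j ⊕ k) i) (trans (⊗-distribˡ-⊕ i j k) (cong₂ _⊕_ (⊗-comm i j) (⊗-comm i k)))
      }
    ; *-comm = ⊗-comm
    }

  ring : CommutativeRing _ _
  ring = record { isCommutativeRing = isCommutativeRing }

  private
    R : ACR.AlmostCommutativeRing _ _
    R = ACR.fromCommutativeRing ring

    #-morphism : CommutativeRing.rawRing ℤ.+-*-commutativeRing ACR.-Raw-AlmostCommutative⟶ R
    #-morphism = record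
      { ⟦_⟧    = #
      ; +-homo = #-+
      ; *-homo = #-*
      ; -‿homo = #-neg
      ; 0-homo = refl
      ; 1-homo = refl
      }

    -- Comparing the integers themselves suffices: the solver asks for a sound test, and `nothing`
    -- makes no claim that the residues differ.
    coeff≟ : ∀ x y → Maybe (# x ≡ # y)
    coeff≟ x y with x ℤ.≟ y
    ... | yes eq = just (cong # eq)
    ... | no  _  = nothing

  -- Numerals in this solver are the residues # k of integers k.
  module Solver where
    open RingSolver (CommutativeRing.rawRing ℤ.+-*-commutativeRing) R #-morphism coeff≟ public
      using (solve; _:=_; _:+_; _:*_; _:-_; :-_; con)

  #-∸ : ∀ x y → # (x - y) ≡ # x ⊖ # y
  #-∸ x y = trans (#-+ x (- y)) (cong (# x ⊕_) (#-neg y))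

-- Ordered cliques and clique counts

-- For an irreflexive relation with indicator A, the sum over all k-tuples of
-- pairwise related vertices of the product of their weights.
orderedCliques : ∀ {n} → ℕ → (Fin n → ℤ) → (Fin n → Fin n → ℤ) → ℤ
orderedCliques zero    w A = 1ℤ
orderedCliques (suc k) w A = sum (λ x → w x * orderedCliques k (λ y → w y * A x y) A)

orderedCliques-cong : ∀ {n} k {w w′ : Fin n → ℤ} {A A′ : Fin n → Fin n → ℤ} →
  (∀ x → w x ≡ w′ x) → (∀ x y → A x y ≡ A′ x y) → orderedCliques k w A ≡ orderedCliques k w′ A′
orderedCliques-cong zero    w≗w′ A≗A′ = refl
orderedCliques-cong (suc k) w≗w′ A≗A′ = sum-cong-≗ λ x →
  cong₂ _*_ (w≗w′ x) (orderedCliques-cong k (λ y → cong₂ _*_ (w≗w′ y) (A≗A′ x y)) A≗A′)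

-- The hypothesis on σ is stated as invariance of sums because translations and scalings of ℤ/p
-- provide exactly that.
orderedCliques-bijection : ∀ {m n} k (w : Fin n → ℤ) (A : Fin n → Fin n → ℤ) (σ : Fin m → Fin n) →
  (∀ f → sum (f ∘ σ) ≡ sum f) → orderedCliques k w A ≡ orderedCliques k (w ∘ σ) (λ x y → A (σ x) (σ y))
orderedCliques-bijection zero    w A σ reindex = refl
orderedCliques-bijection (suc k) w A σ reindex = begin
  sum (λ x → w x * orderedCliques k (λ y → w y * A x y) A)
    ≡⟨ reindex (λ x → w x * orderedCliques k (λ y → w y * A x y) A) ⟨
  sum (λ x → w (σ x) * orderedCliques k (λ y → w y * A (σ x) y) A)
    ≡⟨ sum-cong-≗ (λ x → cong (w (σ x) *_) (orderedCliques-bijection k (λ y → w y * A (σ x) y) A σ reindex)) ⟩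
  sum (λ x → w (σ x) * orderedCliques k (λ y → w (σ y) * A (σ x) (σ y)) (λ x y → A (σ x) (σ y)))  ∎
  where open ≡-Reasoning

-- A tuple meets vertex zero in at most one of its k + 1 positions.
orderedCliques-suc : ∀ {n} k (w : Fin (suc n) → ℤ) (A : Fin (suc n) → Fin (suc n) → ℤ) →
  (∀ x y → A x y ≡ A y x) → A Fin.zero Fin.zero ≡ 0ℤ →
  orderedCliques (suc k) w A ≡
    orderedCliques (suc k) (w ∘ Fin.suc) (λ x y → A (Fin.suc x) (Fin.suc y)) +
    + suc k * (w Fin.zero * orderedCliques k (λ y → w (Fin.suc y) * A Fin.zero (Fin.suc y)) (λ x y → A (Fin.suc x) (Fin.suc y)))
orderedCliques-suc zero w A A-sym A00 = swap (w Fin.zero * 1ℤ) (sum (λ x → w (Fin.suc x) * 1ℤ))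
  where
  swap : ∀ a b → a + b ≡ b + 1ℤ * a
  swap = solve-∀
orderedCliques-suc {n} (suc k) w A A-sym A00 = begin
  w Fin.zero * orderedCliques (suc k) (λ y → w y * A Fin.zero y) A + sum (λ x → w (Fin.suc x) * orderedCliques (suc k) (λ y → w y * A (Fin.suc x) y) A)
    ≡⟨ cong₂ _+_ head tail ⟩
  w Fin.zero * O + (orderedCliques (suc (suc k)) w′ A′ + + suc k * (w Fin.zero * O))
    ≡⟨ regroup (w Fin.zero) O (orderedCliques (suc (suc k)) w′ A′) (+ suc k) ⟩
  orderedCliques (suc (suc k)) w′ A′ + (1ℤ + + suc k) * (w Fin.zero * O)  ∎
  where
  open ≡-Reasoning
  w′ w₀ : Fin n → ℤ
  w′ = w ∘ Fin.suc
  w₀ y = w (Fin.suc y) * A Fin.zero (Fin.suc y)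
  A′ : Fin n → Fin n → ℤ
  A′ x y = A (Fin.suc x) (Fin.suc y)
  O = orderedCliques (suc k) w₀ A′
  regroup : ∀ a o b k → a * o + (b + k * (a * o)) ≡ b + (1ℤ + k) * (a * o)
  regroup = solve-∀
  head : w Fin.zero * orderedCliques (suc k) (λ y → w y * A Fin.zero y) A ≡ w Fin.zero * O
  head = cong (w Fin.zero *_) (begin
    orderedCliques (suc k) (λ y → w y * A Fin.zero y) A
      ≡⟨ orderedCliques-suc k (λ y → w y * A Fin.zero y) A A-sym A00 ⟩
    O + + suc k * (w Fin.zero * A Fin.zero Fin.zero * rest)
      -- Vertex zero already stands first; `A00` excludes a second occurrence.
      ≡⟨ cong (λ a → O + + suc k * (w Fin.zero * a * rest)) A00 ⟩
    O + + suc k * (w Fin.zero * 0ℤ * rest)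
      ≡⟨ vanish O (+ suc k) (w Fin.zero) rest ⟩
    O ∎)
    where
    rest = orderedCliques k (λ y → w (Fin.suc y) * A Fin.zero (Fin.suc y) * A Fin.zero (Fin.suc y)) A′
    vanish : ∀ o k w r → o + k * (w * 0ℤ * r) ≡ o
    vanish = solve-∀
  tail : sum (λ x → w′ x * orderedCliques (suc k) (λ y → w y * A (Fin.suc x) y) A) ≡
         orderedCliques (suc (suc k)) w′ A′ + + suc k * (w Fin.zero * O)
  tail = begin
    sum (λ x → w′ x * orderedCliques (suc k) (λ y → w y * A (Fin.suc x) y) A)
      ≡⟨ sum-cong-≗ term ⟩
    sum (λ x → w′ x * orderedCliques (suc k) (λ y → w′ y * A′ x y) A′ + + suc k * w Fin.zero * (w₀ x * orderedCliques k (λ y → w₀ y * A′ x y) A′))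
      ≡⟨ ∑-distrib-+ (λ x → w′ x * orderedCliques (suc k) (λ y → w′ y * A′ x y) A′) (λ x → + suc k * w Fin.zero * (w₀ x * orderedCliques k (λ y → w₀ y * A′ x y) A′)) ⟩
    orderedCliques (suc (suc k)) w′ A′ + sum (λ x → + suc k * w Fin.zero * (w₀ x * orderedCliques k (λ y → w₀ y * A′ x y) A′))
      ≡⟨ cong (_+_ (orderedCliques (suc (suc k)) w′ A′)) (*-distribˡ-sum (+ suc k * w Fin.zero) (λ x → w₀ x * orderedCliques k (λ y → w₀ y * A′ x y) A′)) ⟨
    orderedCliques (suc (suc k)) w′ A′ + + suc k * w Fin.zero * O
      ≡⟨ cong (_+_ (orderedCliques (suc (suc k)) w′ A′)) (ℤ.*-assoc (+ suc k) (w Fin.zero) O) ⟩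
    orderedCliques (suc (suc k)) w′ A′ + + suc k * (w Fin.zero * O)  ∎
    where
    distrib : ∀ a o k b c r → a * (o + k * (b * c * r)) ≡ a * o + k * b * (a * c * r)
    distrib = solve-∀
    swap₂₃ : ∀ a b c → a * b * c ≡ a * c * b
    swap₂₃ = solve-∀
    term : ∀ x → w′ x * orderedCliques (suc k) (λ y → w y * A (Fin.suc x) y) A ≡
                 w′ x * orderedCliques (suc k) (λ y → w′ y * A′ x y) A′ + + suc k * w Fin.zero * (w₀ x * orderedCliques k (λ y → w₀ y * A′ x y) A′)
    term x = begin
      w′ x * orderedCliques (suc k) (λ y → w y * A (Fin.suc x) y) A
        ≡⟨ cong (w′ x *_) (orderedCliques-suc k (λ y → w y * A (Fin.suc x) y) A A-sym A00) ⟩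
      w′ x * (Oₓ + + suc k * (w Fin.zero * A (Fin.suc x) Fin.zero * orderedCliques k (λ y → w′ y * A′ x y * A Fin.zero (Fin.suc y)) A′))
        -- Symmetry moves vertex zero to the front: the factor between x and zero becomes part of
        -- the weight `w₀ x`.
        ≡⟨ cong₂ (λ a r → w′ x * (Oₓ + + suc k * (w Fin.zero * a * r))) (A-sym (Fin.suc x) Fin.zero)
             (orderedCliques-cong k (λ y → swap₂₃ (w′ y) (A′ x y) (A Fin.zero (Fin.suc y))) (λ _ _ → refl)) ⟩
      w′ x * (Oₓ + + suc k * (w Fin.zero * A Fin.zero (Fin.suc x) * orderedCliques k (λ y → w₀ y * A′ x y) A′))
        ≡⟨ distrib (w′ x) Oₓ (+ suc k) (w Fin.zero) (A Fin.zero (Fin.suc x)) (orderedCliques k (λ y → w₀ y * A′ x y) A′) ⟩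
      w′ x * Oₓ + + suc k * w Fin.zero * (w₀ x * orderedCliques k (λ y → w₀ y * A′ x y) A′)  ∎
      where Oₓ = orderedCliques (suc k) (λ y → w′ y * A′ x y) A′

count : ∀ {a p} {A : Set a} {P : A → Set p} → Decidable P → List A → ℤ
count P? xs = + length (filter P? xs)

count-∷ : ∀ {a p} {A : Set a} {P : A → Set p} (P? : Decidable P) x xs → count P? (x ∷ xs) ≡ ι (P? x) + count P? xs
count-∷ P? x xs with P? x
... | yes _ = refl
... | no  _ = refl

count-cong : ∀ {a p q} {A : Set a} {P : A → Set p} {Q : A → Set q} (P? : Decidable P) (Q? : Decidable Q) →
             (∀ x → P x → Q x) → (∀ x → Q x → P x) → ∀ xs → count P? xs ≡ count Q? xs
count-cong P? Q? P⊆Q Q⊆P []       = refl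
count-cong P? Q? P⊆Q Q⊆P (x ∷ xs) = begin
  count P? (x ∷ xs)         ≡⟨ count-∷ P? x xs ⟩
  ι (P? x) + count P? xs    ≡⟨ cong₂ _+_ (ι-cong (P? x) (Q? x) (P⊆Q x) (Q⊆P x)) (count-cong P? Q? P⊆Q Q⊆P xs) ⟩
  ι (Q? x) + count Q? xs    ≡⟨ count-∷ Q? x xs ⟨
  count Q? (x ∷ xs)         ∎
  where open ≡-Reasoning

count-none : ∀ {a p} {A : Set a} {P : A → Set p} (P? : Decidable P) → (∀ x → ¬ P x) → ∀ xs → count P? xs ≡ 0ℤ
count-none P? ¬P []       = refl
count-none P? ¬P (x ∷ xs) = trans (count-∷ P? x xs) (cong₂ _+_ (ι-no (P? x) (¬P x)) (count-none P? ¬P xs))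

count-++ : ∀ {a p} {A : Set a} {P : A → Set p} (P? : Decidable P) xs ys → count P? (xs ++ ys) ≡ count P? xs + count P? ys
count-++ P? xs ys = cong +_ (trans (cong length (List.filter-++ P? xs ys)) (List.length-++ (filter P? xs)))

count-map : ∀ {a b p} {A : Set a} {B : Set b} {P : B → Set p} (P? : Decidable P) (f : A → B) xs →
            count P? (List.map f xs) ≡ count (P? ∘ f) xs
count-map P? f []       = refl
count-map P? f (x ∷ xs) = begin
  count P? (f x ∷ List.map f xs)            ≡⟨ count-∷ P? (f x) (List.map f xs) ⟩
  ι (P? (f x)) + count P? (List.map f xs)   ≡⟨ cong (_+_ (ι (P? (f x)))) (count-map P? f xs) ⟩
  ι (P? (f x)) + count (P? ∘ f) xs          ≡⟨ count-∷ (P? ∘ f) x xs ⟨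
  count (P? ∘ f) (x ∷ xs)                   ∎
  where open ≡-Reasoning

-- `W` is the set of admissible vertices. Once vertex zero has been chosen it shrinks to the
-- neighbours of zero, which lets the recursion on the vertex set close up.
IsCliqueIn : ∀ {n} → (Fin n → Fin n → Set) → (Fin n → Set) → ℕ → Subset n → Set
IsCliqueIn R W k S = ∣ S ∣ ≡ k × (∀ x y → x ∈ S → y ∈ S → x ≢ y → R x y) × (∀ x → x ∈ S → W x)

module _ {n} {R : Fin (suc n) → Fin (suc n) → Set} {W : Fin (suc n) → Set} where

  private
    R′ : Fin n → Fin n → Set
    R′ x y = R (Fin.suc x) (Fin.suc y)

  outside⁻ : ∀ {k S} → IsCliqueIn R W k (outside ∷ S) → IsCliqueIn R′ (W ∘ Fin.suc) k S
  outside⁻ (∣S∣≡k , clique , S⊆W) =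
    ∣S∣≡k , (λ x y x∈S y∈S x≢y → clique _ _ (there x∈S) (there y∈S) (x≢y ∘ Fin.suc-injective)) , λ x x∈S → S⊆W _ (there x∈S)

  outside⁺ : ∀ {k S} → IsCliqueIn R′ (W ∘ Fin.suc) k S → IsCliqueIn R W k (outside ∷ S)
  outside⁺ (∣S∣≡k , clique , S⊆W) =
    ∣S∣≡k , (λ { _ _ (there x∈S) (there y∈S) x≢y → clique _ _ x∈S y∈S (x≢y ∘ cong Fin.suc) }) , λ { _ (there x∈S) → S⊆W _ x∈S }

  inside⁻ : ∀ {k S} → IsCliqueIn R W (suc k) (inside ∷ S) →
            W Fin.zero × IsCliqueIn R′ (λ x → W (Fin.suc x) × R Fin.zero (Fin.suc x)) k S
  inside⁻ (∣S∣≡k , clique , S⊆W) =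
    S⊆W _ here , ℕ.suc-injective ∣S∣≡k , (λ x y x∈S y∈S x≢y → clique _ _ (there x∈S) (there y∈S) (x≢y ∘ Fin.suc-injective)) ,
    λ x x∈S → S⊆W _ (there x∈S) , clique _ _ here (there x∈S) (λ ())

  inside⁺ : (∀ x y → R x y → R y x) → ∀ {k S} → W Fin.zero →
            IsCliqueIn R′ (λ x → W (Fin.suc x) × R Fin.zero (Fin.suc x)) k S → IsCliqueIn R W (suc k) (inside ∷ S)
  inside⁺ R-sym {S = S} w₀ (∣S∣≡k , clique , S⊆W) = cong suc ∣S∣≡k , clique′ , λ { _ here → w₀ ; _ (there x∈S) → proj₁ (S⊆W _ x∈S) }
    where
    clique′ : ∀ x y → x ∈ (inside ∷ S) → y ∈ (inside ∷ S) → x ≢ y → R x y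
    clique′ _ _ here        here        x≢y = contradiction refl x≢y
    clique′ _ _ here        (there y∈S) x≢y = proj₂ (S⊆W _ y∈S)
    clique′ _ _ (there x∈S) here        x≢y = R-sym _ _ (proj₂ (S⊆W _ x∈S))
    clique′ _ _ (there x∈S) (there y∈S) x≢y = clique _ _ x∈S y∈S (x≢y ∘ cong Fin.suc)

-- Induction on n, separating the subsets that contain vertex zero from the others. The former are
-- cliques of order k - 1 among its neighbours, and the factor k in k! = k (k - 1)! matches the k
-- positions of vertex zero counted by `orderedCliques-suc`. `Q` is any decidable predicate
-- equivalent to the clique property, so that the recursion can precompose it with `inside ∷_` and
-- `outside ∷_`.
!*count-cliques : ∀ n k {R : Fin n → Fin n → Set} (R? : ∀ x y → Dec (R x y)) →
  (∀ x y → R x y → R y x) → (∀ x → ¬ R x x) →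
  ∀ {W : Fin n → Set} (W? : Decidable W) {Q : Subset n → Set} (Q? : Decidable Q) →
  (∀ S → Q S → IsCliqueIn R W k S) → (∀ S → IsCliqueIn R W k S → Q S) →
  + (k !) * count Q? (subsets n) ≡ orderedCliques k (ι ∘ W?) (λ x y → ι (R? x y))
!*count-cliques zero zero    R? R-sym R-irr W? Q? Q⇒ ⇒Q = begin
  1ℤ * count Q? ([] ∷ [])   ≡⟨ cong (1ℤ *_) (count-∷ Q? [] []) ⟩
  1ℤ * (ι (Q? []) + 0ℤ)     ≡⟨ cong (λ i → 1ℤ * (i + 0ℤ)) (ι-yes (Q? []) (⇒Q [] (refl , (λ ()) , λ ()))) ⟩
  1ℤ                        ∎
  where open ≡-Reasoning
!*count-cliques zero (suc k) R? R-sym R-irr W? Q? Q⇒ ⇒Q =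
  trans (cong (+ (suc k !) *_) (count-none Q? (λ { [] q → contradiction (proj₁ (Q⇒ [] q)) λ () }) (subsets 0))) (ℤ.*-zeroʳ (+ (suc k !)))
!*count-cliques (suc n) k {R} R? R-sym R-irr {W} W? {Q} Q? Q⇒ ⇒Q = begin
  + (k !) * count Q? (subsets (suc n))
    ≡⟨ cong (+ (k !) *_) (trans (count-++ Q? (List.map (inside ∷_) (subsets n)) _) (cong₂ _+_ (count-map Q? (inside ∷_) (subsets n)) (count-map Q? (outside ∷_) (subsets n)))) ⟩
  + (k !) * (count (Q? ∘ (inside ∷_)) (subsets n) + count (Q? ∘ (outside ∷_)) (subsets n))
    ≡⟨ ℤ.*-distribˡ-+ (+ (k !)) (count (Q? ∘ (inside ∷_)) (subsets n)) (count (Q? ∘ (outside ∷_)) (subsets n)) ⟩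
  + (k !) * count (Q? ∘ (inside ∷_)) (subsets n) + + (k !) * count (Q? ∘ (outside ∷_)) (subsets n)
    ≡⟨ cong (_+_ (+ (k !) * count (Q? ∘ (inside ∷_)) (subsets n)))
         (!*count-cliques n k (λ x y → R? (Fin.suc x) (Fin.suc y)) (λ x y → R-sym _ _) (λ x → R-irr _) (W? ∘ Fin.suc) (Q? ∘ (outside ∷_))
            (λ S q → outside⁻ {R = R} {W = W} (Q⇒ _ q)) (λ S c → ⇒Q _ (outside⁺ {R = R} {W = W} c))) ⟩
  + (k !) * count (Q? ∘ (inside ∷_)) (subsets n) + orderedCliques k w′ A′
    ≡⟨ with-zero k Q⇒ ⇒Q ⟩
  orderedCliques k w A  ∎
  where
  open ≡-Reasoning
  w : Fin (suc n) → ℤ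
  w x = ι (W? x)
  w′ : Fin n → ℤ
  w′ x = ι (W? (Fin.suc x))
  A : Fin (suc n) → Fin (suc n) → ℤ
  A x y = ι (R? x y)
  A′ : Fin n → Fin n → ℤ
  A′ x y = A (Fin.suc x) (Fin.suc y)
  A-sym : ∀ x y → A x y ≡ A y x
  A-sym x y = ι-cong (R? x y) (R? y x) (R-sym x y) (R-sym y x)
  with-zero : ∀ k → (∀ S → Q S → IsCliqueIn R W k S) → (∀ S → IsCliqueIn R W k S → Q S) →
              + (k !) * count (Q? ∘ (inside ∷_)) (subsets n) + orderedCliques k w′ A′ ≡ orderedCliques k w A
  with-zero zero    Q⇒ ⇒Q = cong (λ c → 1ℤ * c + 1ℤ) (count-none (Q? ∘ (inside ∷_)) (λ S q → contradiction (proj₁ (Q⇒ _ q)) λ ()) (subsets n))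
  with-zero (suc k) Q⇒ ⇒Q = begin
    + (suc k !) * count (Q? ∘ (inside ∷_)) (subsets n) + orderedCliques (suc k) w′ A′
      ≡⟨ cong (λ f → f * count (Q? ∘ (inside ∷_)) (subsets n) + orderedCliques (suc k) w′ A′) (ℤ.pos-* (suc k) (k !)) ⟩
    + suc k * + (k !) * count (Q? ∘ (inside ∷_)) (subsets n) + orderedCliques (suc k) w′ A′
      ≡⟨ regroup (+ suc k) (+ (k !)) (count (Q? ∘ (inside ∷_)) (subsets n)) (orderedCliques (suc k) w′ A′) ⟩
    orderedCliques (suc k) w′ A′ + + suc k * (+ (k !) * count (Q? ∘ (inside ∷_)) (subsets n))
      ≡⟨ cong (λ c → orderedCliques (suc k) w′ A′ + + suc k * c) (containing-zero (W? Fin.zero)) ⟩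
    orderedCliques (suc k) w′ A′ + + suc k * (w Fin.zero * orderedCliques k (λ y → w (Fin.suc y) * A Fin.zero (Fin.suc y)) A′)
      ≡⟨ orderedCliques-suc k w A A-sym (ι-no (R? Fin.zero Fin.zero) (R-irr Fin.zero)) ⟨
    orderedCliques (suc k) w A  ∎
    where
    regroup : ∀ a b c d → a * b * c + d ≡ d + a * (b * c)
    regroup = solve-∀
    containing-zero : (d : Dec (W Fin.zero)) → + (k !) * count (Q? ∘ (inside ∷_)) (subsets n) ≡ ι d * orderedCliques k (λ y → w (Fin.suc y) * A Fin.zero (Fin.suc y)) A′
    containing-zero (no ¬w₀) = begin
      + (k !) * count (Q? ∘ (inside ∷_)) (subsets n)
        ≡⟨ cong (+ (k !) *_) (count-none (Q? ∘ (inside ∷_)) (λ S q → ¬w₀ (proj₁ (inside⁻ {R = R} {W = W} (Q⇒ _ q)))) (subsets n)) ⟩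
      + (k !) * 0ℤ
        ≡⟨ ℤ.*-zeroʳ (+ (k !)) ⟩
      0ℤ
        ≡⟨ ℤ.*-zeroˡ (orderedCliques k (λ y → w (Fin.suc y) * A Fin.zero (Fin.suc y)) A′) ⟨
      0ℤ * orderedCliques k (λ y → w (Fin.suc y) * A Fin.zero (Fin.suc y)) A′ ∎
    containing-zero (yes w₀) = begin
      + (k !) * count (Q? ∘ (inside ∷_)) (subsets n)
        ≡⟨ !*count-cliques n k (λ x y → R? (Fin.suc x) (Fin.suc y)) (λ x y → R-sym _ _) (λ x → R-irr _)
             (λ x → W? (Fin.suc x) ×-dec R? Fin.zero (Fin.suc x)) (Q? ∘ (inside ∷_))
             (λ S q → proj₂ (inside⁻ {R = R} {W = W} (Q⇒ _ q))) (λ S c → ⇒Q _ (inside⁺ {R = R} {W = W} R-sym w₀ c)) ⟩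
      orderedCliques k (λ x → ι (W? (Fin.suc x) ×-dec R? Fin.zero (Fin.suc x))) A′
        ≡⟨ orderedCliques-cong k (λ x → ι-× (W? (Fin.suc x)) (R? Fin.zero (Fin.suc x)) (W? (Fin.suc x) ×-dec R? Fin.zero (Fin.suc x)) (λ c → c) _,_) (λ _ _ → refl) ⟩
      orderedCliques k (λ y → w (Fin.suc y) * A Fin.zero (Fin.suc y)) A′
        ≡⟨ ℤ.*-identityˡ (orderedCliques k (λ y → w (Fin.suc y) * A Fin.zero (Fin.suc y)) A′) ⟨
      1ℤ * orderedCliques k (λ y → w (Fin.suc y) * A Fin.zero (Fin.suc y)) A′ ∎

-- Chinese remaindering and unit squares

∣ₛ-*-* : ∀ {m n x y} → + m ∣ₛ x → + n ∣ₛ y → + (m ℕ.* n) ∣ₛ x * y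
∣ₛ-*-* {m} {n} (divides q refl) (divides r refl) = divides (q * r) (trans (regroup q (+ m) r (+ n)) (cong (q * r *_) (sym (ℤ.pos-* m n))))
  where
  regroup : ∀ q m r n → q * m * (r * n) ≡ q * r * (m * n)
  regroup = solve-∀

∣ₛ-trans-ℕ : ∀ {m} n {x} → + (m ℕ.* n) ∣ₛ x → + m ∣ₛ x
∣ₛ-trans-ℕ {m} n (divides q refl) = divides (q * + n) (trans (cong (q *_) (ℤ.pos-* m n)) (regroup q (+ m) (+ n)))
  where
  regroup : ∀ q m n → q * (m * n) ≡ q * n * m
  regroup = solve-∀

-- Coprimality in Bézout form: u m and v n are then the idempotents used in `Interpolation`.
Comaximal : ℕ → ℕ → Set
Comaximal m n = ∃₂ λ u v → u * + m + v * + n ≡ 1ℤ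

coprime⇒comaximal : ∀ {m n} → Coprime m n → Comaximal m n
coprime⇒comaximal {m} {n} c with coprime-Bézout c
... | Bézout.+- x y eq = + x , - + y , (begin
  + x * + m + - + y * + n            ≡⟨ cong (_+ - + y * + n) (trans (sym (ℤ.pos-* x m)) (trans (cong +_ (sym eq)) (cong (_+_ 1ℤ) (ℤ.pos-* y n)))) ⟩
  1ℤ + + y * + n + - + y * + n       ≡⟨ cancel (+ y) (+ n) ⟩
  1ℤ                                 ∎)
  where
  open ≡-Reasoning
  cancel : ∀ y n → 1ℤ + y * n + - y * n ≡ 1ℤ
  cancel = solve-∀
... | Bézout.-+ x y eq = - + x , + y , (begin
  - + x * + m + + y * + n            ≡⟨ cong (_+_ (- + x * + m)) (trans (sym (ℤ.pos-* y n)) (trans (cong +_ (sym eq)) (cong (_+_ 1ℤ) (ℤ.pos-* x m)))) ⟩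
  - + x * + m + (1ℤ + + x * + m)     ≡⟨ cancel (+ x) (+ m) ⟩
  1ℤ                                 ∎)
  where
  open ≡-Reasoning
  cancel : ∀ x m → - x * m + (1ℤ + x * m) ≡ 1ℤ
  cancel = solve-∀

comaximal-1 : ∀ m → Comaximal m 1
comaximal-1 m = 0ℤ , 1ℤ , identity (+ m)
  where
  identity : ∀ m → 0ℤ * m + 1ℤ * 1ℤ ≡ 1ℤ
  identity = solve-∀

comaximal-sym : ∀ {m n} → Comaximal m n → Comaximal n m
comaximal-sym {m} {n} (u , v , eq) = v , u , trans (ℤ.+-comm (v * + n) (u * + m)) eq

-- Multiply the two Bézout identities: every term except the one in n o is a multiple of m.
comaximal-* : ∀ {m n o} → Comaximal m n → Comaximal m o → Comaximal m (n ℕ.* o)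
comaximal-* {m} {n} {o} (u , v , eq) (u′ , v′ , eq′) = u * + m * u′ + u * v′ * + o + v * + n * u′ , v * v′ , (begin
  (u * + m * u′ + u * v′ * + o + v * + n * u′) * + m + v * v′ * + (n ℕ.* o)
    ≡⟨ cong (λ z → (u * + m * u′ + u * v′ * + o + v * + n * u′) * + m + v * v′ * z) (ℤ.pos-* n o) ⟩
  (u * + m * u′ + u * v′ * + o + v * + n * u′) * + m + v * v′ * (+ n * + o)
    ≡⟨ factor u v u′ v′ (+ m) (+ n) (+ o) ⟩
  (u * + m + v * + n) * (u′ * + m + v′ * + o)
    ≡⟨ cong₂ _*_ eq eq′ ⟩
  1ℤ  ∎)
  where
  open ≡-Reasoning
  factor : ∀ u v u′ v′ m n o → (u * m * u′ + u * v′ * o + v * n * u′) * m + v * v′ * (n * o) ≡ (u * m + v * n) * (u′ * m + v′ * o)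
  factor = solve-∀

comaximal-^ : ∀ {m n} → Comaximal m n → ∀ k → Comaximal m (n ℕ.^ k)
comaximal-^ {m} c zero    = comaximal-1 m
comaximal-^ {m} c (suc k) = comaximal-* c (comaximal-^ c k)

-- In x = x (u m) + x (v n) both summands are multiples of m n, x contributing the factor n to the
-- first and m to the second.
comaximal-∣ : ∀ {m n x} → Comaximal m n → + m ∣ₛ x → + n ∣ₛ x → + (m ℕ.* n) ∣ₛ x
comaximal-∣ {m} {n} {x} (u , v , eq) (divides q x≡qm) (divides r x≡rn) = divides (r * u + q * v) (begin
  x                                ≡⟨ ℤ.*-identityʳ x ⟨
  x * 1ℤ                           ≡⟨ cong (x *_) eq ⟨
  x * (u * + m + v * + n)          ≡⟨ ℤ.*-distribˡ-+ x (u * + m) (v * + n) ⟩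
  x * (u * + m) + x * (v * + n)    ≡⟨ cong₂ (λ a b → a * (u * + m) + b * (v * + n)) x≡rn x≡qm ⟩
  r * + n * (u * + m) + q * + m * (v * + n)  ≡⟨ collect r u q v (+ m) (+ n) ⟩
  (r * u + q * v) * (+ m * + n)    ≡⟨ cong ((r * u + q * v) *_) (ℤ.pos-* m n) ⟨
  (r * u + q * v) * + (m ℕ.* n)    ∎)
  where
  open ≡-Reasoning
  collect : ∀ r u q v m n → r * n * (u * m) + q * m * (v * n) ≡ (r * u + q * v) * (m * n)
  collect = solve-∀

module Interpolation {m n} (c : Comaximal m n) where

  private
    u v : ℤ
    u = proj₁ c
    v = proj₁ (proj₂ c)
    eq : u * + m + v * + n ≡ 1ℤ
    eq = proj₂ (proj₂ c)

  interpolate : ℤ → ℤ → ℤ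
  interpolate x y = x * (v * + n) + y * (u * + m)

  interpolate-ˡ : ∀ x y → + m ∣ₛ interpolate x y - x
  interpolate-ˡ x y = divides ((y - x) * u) (begin
    x * (v * + n) + y * (u * + m) - x                              ≡⟨ cong (λ o → x * (v * + n) + y * (u * + m) - o) (sym (trans (cong (x *_) eq) (ℤ.*-identityʳ x))) ⟩
    x * (v * + n) + y * (u * + m) - x * (u * + m + v * + n)        ≡⟨ collect x y u v (+ m) (+ n) ⟩
    (y - x) * u * + m                                              ∎)
    where
    open ≡-Reasoning
    collect : ∀ x y u v m n → x * (v * n) + y * (u * m) - x * (u * m + v * n) ≡ (y - x) * u * m
    collect = solve-∀

  interpolate-ʳ : ∀ x y → + n ∣ₛ interpolate x y - y
  interpolate-ʳ x y = divides ((x - y) * v) (begin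
    x * (v * + n) + y * (u * + m) - y                              ≡⟨ cong (λ o → x * (v * + n) + y * (u * + m) - o) (sym (trans (cong (y *_) eq) (ℤ.*-identityʳ y))) ⟩
    x * (v * + n) + y * (u * + m) - y * (u * + m + v * + n)        ≡⟨ collect x y u v (+ m) (+ n) ⟩
    (x - y) * v * + n                                              ∎)
    where
    open ≡-Reasoning
    collect : ∀ x y u v m n → x * (v * n) + y * (u * m) - y * (u * m + v * n) ≡ (x - y) * v * n
    collect = solve-∀

IsUnitSquare : ℕ → ℤ → Set
IsUnitSquare n z = ∃ λ (a : Fin n) → IsUnit a × z ≡ ⟦ a ⟧ * ⟦ a ⟧ [mod n ]

isUnitSquare? : ∀ n z → Dec (IsUnitSquare n z)
isUnitSquare? n z = Fin.any? λ a → isUnit? a ×-dec (z ≡? ⟦ a ⟧ * ⟦ a ⟧ [mod n ])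

-- Arbitrary integers as witnesses, so that interpolations and Newton steps serve as roots without
-- being reduced modulo n.
record IsUnitSquareℤ (n : ℕ) (z : ℤ) : Set where
  constructor unitSquare
  field
    root inverse : ℤ
    isUnit       : + n ∣ₛ root * inverse - 1ℤ
    isSquare     : + n ∣ₛ z - root * root

toℤ : ∀ {n} z → IsUnitSquare n z → IsUnitSquareℤ n z
toℤ z (a , (u , n∣au-1) , n∣z-aa) = unitSquare ⟦ a ⟧ ⟦ u ⟧ (∣ᵤ⇒∣ n∣au-1) (∣ᵤ⇒∣ n∣z-aa)

fromℤ : ∀ {n} .{{_ : ℕ.NonZero n}} z → IsUnitSquareℤ n z → IsUnitSquare n z
fromℤ {n} z (unitSquare a u n∣au-1 n∣z-aa) =
  red n a , (red n u , ∣⇒∣ᵤ (∣ₛ-resp (unit a u ⟦ red n a ⟧ ⟦ red n u ⟧)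
    (∣ₛ-+ (∣ₛ-+ n∣au-1 (∣ₛ-* (- u) (red-∣ n a))) (∣ₛ-* (- ⟦ red n a ⟧) (red-∣ n u))))) ,
  ∣⇒∣ᵤ (∣ₛ-resp (square z a ⟦ red n a ⟧) (∣ₛ-+ n∣z-aa (∣ₛ-* (a + ⟦ red n a ⟧) (red-∣ n a))))
  where
  unit : ∀ a u b v → a * u - 1ℤ + - u * (a - b) + - b * (u - v) ≡ b * v - 1ℤ
  unit = solve-∀
  square : ∀ z a b → z - a * a + (a + b) * (a - b) ≡ z - b * b
  square = solve-∀

IsUnitSquareℤ-resp : ∀ {n y z} → + n ∣ₛ y - z → IsUnitSquareℤ n z → IsUnitSquareℤ n y
IsUnitSquareℤ-resp {n} {y} {z} n∣y-z (unitSquare a u unit square) = unitSquare a u unit (∣ₛ-resp (telescope y z (a * a)) (∣ₛ-+ n∣y-z square))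
  where
  telescope : ∀ y z w → y - z + (z - w) ≡ y - w
  telescope = solve-∀

IsUnitSquareℤ-∣ : ∀ {m} n {z} → IsUnitSquareℤ (m ℕ.* n) z → IsUnitSquareℤ m z
IsUnitSquareℤ-∣ n (unitSquare a u unit square) = unitSquare a u (∣ₛ-trans-ℕ n unit) (∣ₛ-trans-ℕ n square)

IsUnitSquareℤ-* : ∀ {m n z} → Comaximal m n → IsUnitSquareℤ m z → IsUnitSquareℤ n z → IsUnitSquareℤ (m ℕ.* n) z
IsUnitSquareℤ-* {m} {n} {z} c (unitSquare a u unit-a square-a) (unitSquare b v unit-b square-b) = unitSquare a′ u′
  (comaximal-∣ c (unit a u a′ u′ unit-a (interpolate-ˡ a b) (interpolate-ˡ u v)) (unit b v a′ u′ unit-b (interpolate-ʳ a b) (interpolate-ʳ u v)))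
  (comaximal-∣ c (square a a′ square-a (interpolate-ˡ a b)) (square b a′ square-b (interpolate-ʳ a b)))
  where
  open Interpolation c
  a′ = interpolate a b
  u′ = interpolate u v
  unit : ∀ {k} x y x′ y′ → + k ∣ₛ x * y - 1ℤ → + k ∣ₛ x′ - x → + k ∣ₛ y′ - y → + k ∣ₛ x′ * y′ - 1ℤ
  unit x y x′ y′ d e f = ∣ₛ-resp (identity x y x′ y′) (∣ₛ-+ (∣ₛ-+ d (∣ₛ-* y e)) (∣ₛ-* x′ f))
    where
    identity : ∀ x y x′ y′ → x * y - 1ℤ + y * (x′ - x) + x′ * (y′ - y) ≡ x′ * y′ - 1ℤ
    identity = solve-∀
  square : ∀ {k} x x′ → + k ∣ₛ z - x * x → + k ∣ₛ x′ - x → + k ∣ₛ z - x′ * x′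
  square x x′ d e = ∣ₛ-resp (identity z x x′) (∣ₛ-+ d (∣ₛ-* (- (x′ + x)) e))
    where
    identity : ∀ z x x′ → z - x * x + - (x′ + x) * (x′ - x) ≡ z - x′ * x′
    identity = solve-∀

-- One Newton step a ↦ a + (z - a²)/(2a), with 1/(2a) = h u.
IsUnitSquareℤ-newton : ∀ {m z} h → + m ∣ₛ + 2 * h - 1ℤ → IsUnitSquareℤ m z → IsUnitSquareℤ (m ℕ.* m) z
IsUnitSquareℤ-newton {m} {z} h m∣2h-1 (unitSquare a u m∣au-1 m∣z-aa) = unitSquare a′ (u * (+ 2 - a′ * u))
  -- The inverse takes a Newton step of its own: 1 - a′ u (2 - a′ u) = (1 - a′ u)².
  (∣ₛ-resp (unit a′ u) (∣ₛ-* -1ℤ (∣ₛ-*-* m∣a′u-1 m∣a′u-1)))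
  (∣ₛ-resp (square z a u h)
    (∣ₛ-+ (∣ₛ-+ (∣ₛ-* (- (+ 2 * h - 1ℤ) - 1ℤ) (∣ₛ-*-* m∣z-aa m∣au-1)) (∣ₛ-* -1ℤ (∣ₛ-*-* m∣z-aa m∣2h-1)))
          (∣ₛ-* (- (h * u * (h * u))) (∣ₛ-*-* m∣z-aa m∣z-aa))))
  where
  a′ = a + (z - a * a) * (h * u)
  m∣a′u-1 : + m ∣ₛ a′ * u - 1ℤ
  m∣a′u-1 = ∣ₛ-resp (identity z a u h) (∣ₛ-+ m∣au-1 (∣ₛ-* (h * u * u) m∣z-aa))
    where
    identity : ∀ z a u h → a * u - 1ℤ + h * u * u * (z - a * a) ≡ (a + (z - a * a) * (h * u)) * u - 1ℤ
    identity = solve-∀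
  unit : ∀ a u → -1ℤ * ((a * u - 1ℤ) * (a * u - 1ℤ)) ≡ a * (u * (+ 2 - a * u)) - 1ℤ
  unit = solve-∀
  square : ∀ z a u h → (- (+ 2 * h - 1ℤ) - 1ℤ) * ((z - a * a) * (a * u - 1ℤ)) + -1ℤ * ((z - a * a) * (+ 2 * h - 1ℤ)) + - (h * u * (h * u)) * ((z - a * a) * (z - a * a))
             ≡ z - (a + (z - a * a) * (h * u)) * (a + (z - a * a) * (h * u))
  square = solve-∀

Odd : ℕ → Set
Odd m = ∃ λ j → + m ≡ + 2 * j + 1ℤ

odd-* : ∀ {m n} → Odd m → Odd n → Odd (m ℕ.* n)
odd-* {m} {n} (i , m≡) (j , n≡) = + 2 * i * j + i + j , trans (ℤ.pos-* m n) (trans (cong₂ _*_ m≡ n≡) (expand i j))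
  where
  expand : ∀ i j → (+ 2 * i + 1ℤ) * (+ 2 * j + 1ℤ) ≡ + 2 * (+ 2 * i * j + i + j) + 1ℤ
  expand = solve-∀

odd-^ : ∀ {m} → Odd m → ∀ k → Odd (m ℕ.^ k)
odd-^ odd zero    = 0ℤ , refl
odd-^ odd (suc k) = odd-* odd (odd-^ odd k)

-- For m = 2 j + 1 the inverse of 2 is j + 1, because 2 (j + 1) - 1 = m.
IsUnitSquareℤ-double : ∀ {m z} → Odd m → IsUnitSquareℤ m z → IsUnitSquareℤ (m ℕ.* m) z
IsUnitSquareℤ-double {m} (j , m≡2j+1) = IsUnitSquareℤ-newton (j + 1ℤ) (divides 1ℤ (trans (half j) (sym (trans (ℤ.*-identityˡ (+ m)) m≡2j+1))))
  where
  half : ∀ j → + 2 * (j + 1ℤ) - 1ℤ ≡ + 2 * j + 1ℤ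
  half = solve-∀

-- A Newton step doubles the exponent and so overshoots, from k + 1 to 2 k + 2; the surplus factor p
-- ^ k is then dropped.
IsUnitSquareℤ-^ : ∀ {p z} → Odd p → ∀ k → IsUnitSquareℤ p z → IsUnitSquareℤ (p ℕ.^ suc k) z
IsUnitSquareℤ-^ {p} {z} odd zero    sq = subst (λ n → IsUnitSquareℤ n z) (sym (ℕ.^-identityʳ p)) sq
IsUnitSquareℤ-^ {p} {z} odd (suc k) sq =
  IsUnitSquareℤ-∣ (p ℕ.^ k) (subst (λ n → IsUnitSquareℤ n z) regroup (IsUnitSquareℤ-double (odd-^ odd (suc k)) (IsUnitSquareℤ-^ odd k sq)))
  where
  regroup : p ℕ.^ suc k ℕ.* p ℕ.^ suc k ≡ p ℕ.^ suc (suc k) ℕ.* p ℕ.^ k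
  regroup = trans (sym (ℕ.^-distribˡ-+-* p (suc k) (suc k))) (trans (cong (p ℕ.^_) (cong suc (ℕ.+-suc k k))) (ℕ.^-distribˡ-+-* p (suc (suc k)) k))

sq : ℕ → ℤ → ℤ
sq n z = ι (isUnitSquare? n z)

sq-cong : ∀ {n} .{{_ : ℕ.NonZero n}} y z → + n ∣ₛ y - z → sq n y ≡ sq n z
sq-cong {n} y z n∣y-z = ι-cong (isUnitSquare? n y) (isUnitSquare? n z)
  (fromℤ z ∘ IsUnitSquareℤ-resp (∣ₛ-resp (flip y z) (∣ₛ-* -1ℤ n∣y-z)) ∘ toℤ y) (fromℤ y ∘ IsUnitSquareℤ-resp n∣y-z ∘ toℤ z)
  where
  flip : ∀ y z → -1ℤ * (y - z) ≡ z - y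
  flip = solve-∀

sq-* : ∀ {m n} .{{_ : ℕ.NonZero m}} .{{_ : ℕ.NonZero n}} .{{_ : ℕ.NonZero (m ℕ.* n)}} → Comaximal m n → ∀ z → sq (m ℕ.* n) z ≡ sq m z * sq n z
sq-* {m} {n} c z = ι-× (isUnitSquare? m z) (isUnitSquare? n z) (isUnitSquare? (m ℕ.* n) z)
  (λ s → fromℤ z (IsUnitSquareℤ-∣ n (toℤ z s)) , fromℤ z (IsUnitSquareℤ-∣ m (subst (λ k → IsUnitSquareℤ k z) (ℕ.*-comm m n) (toℤ z s))))
  (λ s t → fromℤ z (IsUnitSquareℤ-* c (toℤ z s) (toℤ z t)))

sq-^ : ∀ {p} .{{_ : ℕ.NonZero p}} → Odd p → ∀ k .{{_ : ℕ.NonZero (p ℕ.^ k ℕ.* p)}} z → sq (p ℕ.^ k ℕ.* p) z ≡ sq p z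
sq-^ {p} odd k z = ι-cong (isUnitSquare? (p ℕ.^ k ℕ.* p) z) (isUnitSquare? p z)
  (λ s → fromℤ z (IsUnitSquareℤ-∣ (p ℕ.^ k) (subst (λ n → IsUnitSquareℤ n z) (ℕ.*-comm (p ℕ.^ k) p) (toℤ z s))))
  (λ s → fromℤ z (subst (λ n → IsUnitSquareℤ n z) (ℕ.*-comm p (p ℕ.^ k)) (IsUnitSquareℤ-^ odd k (toℤ z s))))

-- Multiplicativity of the ordered clique count in the modulus

sum-split : ∀ m {n} (f : Fin (m ℕ.+ n) → ℤ) → sum f ≡ sum (λ i → f (i ↑ˡ n)) + sum (λ j → f (m ↑ʳ j))
sum-split zero    f = sym (ℤ.+-identityˡ (sum f))
sum-split (suc m) {n} f = trans (cong (_+_ (f Fin.zero)) (sum-split m (f ∘ Fin.suc))) (sym (ℤ.+-assoc (f Fin.zero) (sum (λ i → f (Fin.suc i ↑ˡ n))) (sum (λ j → f (suc m ↑ʳ j)))))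

sum-periodic : ∀ q p .{{_ : ℕ.NonZero p}} (f : Fin p → ℤ) → sum {q ℕ.* p} (λ x → f (red p ⟦ x ⟧)) ≡ + q * sum f
sum-periodic zero    p f = sym (ℤ.*-zeroˡ (sum f))
sum-periodic (suc q) p f = begin
  sum {suc q ℕ.* p} (λ x → f (red p ⟦ x ⟧))
    ≡⟨ sum-split p {q ℕ.* p} (λ x → f (red p ⟦ x ⟧)) ⟩
  sum {p} (λ i → f (red p ⟦ i ↑ˡ (q ℕ.* p) ⟧)) + sum {q ℕ.* p} (λ j → f (red p ⟦ p ↑ʳ j ⟧))
    ≡⟨ cong₂ _+_ (sum-cong-≗ {p} λ i → cong f (trans (cong (red p ∘ +_) (Fin.toℕ-↑ˡ i (q ℕ.* p))) (#-⟦⟧ i)))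
                 (trans (sum-cong-≗ {q ℕ.* p} λ j → cong f (shift j)) (sum-periodic q p f)) ⟩
  sum f + + q * sum f
    ≡⟨ ℤ.suc-* (+ q) (sum f) ⟨
  + suc q * sum f  ∎
  where
  open ≡-Reasoning
  open Residue p
  cancel : ∀ p j → p + j - j ≡ 1ℤ * p
  cancel = solve-∀
  shift : ∀ (j : Fin (q ℕ.* p)) → red p ⟦ p ↑ʳ j ⟧ ≡ red p ⟦ j ⟧
  shift j = #-cong (divides 1ℤ (trans (cong (λ t → + t - ⟦ j ⟧) (Fin.toℕ-↑ʳ p j)) (cancel (+ p) ⟦ j ⟧)))

orderedCliques-periodic : ∀ k q p .{{_ : ℕ.NonZero p}} (w : Fin p → ℤ) (A : Fin p → Fin p → ℤ) →
  orderedCliques {q ℕ.* p} k (λ x → w (red p ⟦ x ⟧)) (λ x y → A (red p ⟦ x ⟧) (red p ⟦ y ⟧)) ≡ (+ q) ℤ.^ k * orderedCliques k w A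
orderedCliques-periodic zero    q p w A = refl
orderedCliques-periodic (suc k) q p w A = begin
  sum {q ℕ.* p} (λ x → w (red p ⟦ x ⟧) * orderedCliques {q ℕ.* p} k (λ y → w (red p ⟦ y ⟧) * A (red p ⟦ x ⟧) (red p ⟦ y ⟧)) (λ x y → A (red p ⟦ x ⟧) (red p ⟦ y ⟧)))
    ≡⟨ sum-cong-≗ {q ℕ.* p} (λ x → cong (w (red p ⟦ x ⟧) *_) (orderedCliques-periodic k q p (λ y → w y * A (red p ⟦ x ⟧) y) A)) ⟩
  sum {q ℕ.* p} (λ x → w (red p ⟦ x ⟧) * ((+ q) ℤ.^ k * orderedCliques k (λ y → w y * A (red p ⟦ x ⟧) y) A))
    ≡⟨ sum-periodic q p (λ x → w x * ((+ q) ℤ.^ k * orderedCliques k (λ y → w y * A x y) A)) ⟩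
  + q * sum (λ x → w x * ((+ q) ℤ.^ k * orderedCliques k (λ y → w y * A x y) A))
    ≡⟨ cong (+ q *_) (sum-cong-≗ λ x → left-comm (w x) ((+ q) ℤ.^ k) (orderedCliques k (λ y → w y * A x y) A)) ⟩
  + q * sum (λ x → (+ q) ℤ.^ k * (w x * orderedCliques k (λ y → w y * A x y) A))
    ≡⟨ cong (+ q *_) (*-distribˡ-sum ((+ q) ℤ.^ k) (λ x → w x * orderedCliques k (λ y → w y * A x y) A)) ⟨
  + q * ((+ q) ℤ.^ k * orderedCliques (suc k) w A)
    ≡⟨ ℤ.*-assoc (+ q) ((+ q) ℤ.^ k) (orderedCliques (suc k) w A) ⟨
  (+ q) ℤ.^ suc k * orderedCliques (suc k) w A  ∎
  where
  open ≡-Reasoning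
  left-comm : ∀ a b c → a * (b * c) ≡ b * (a * c)
  left-comm = solve-∀

module CRT {m n} .{{_ : ℕ.NonZero m}} .{{_ : ℕ.NonZero n}} .{{_ : ℕ.NonZero (m ℕ.* n)}} (c : Comaximal m n) where

  open Interpolation c

  π₁ : Fin (m ℕ.* n) → Fin m
  π₁ x = red m ⟦ x ⟧

  π₂ : Fin (m ℕ.* n) → Fin n
  π₂ x = red n ⟦ x ⟧

  pair : Fin m → Fin n → Fin (m ℕ.* n)
  pair i j = red (m ℕ.* n) (interpolate ⟦ i ⟧ ⟦ j ⟧)

  telescope : ∀ x y z → -1ℤ * (x - y) + (x - z) ≡ y - z
  telescope = solve-∀

  π₁-pair : ∀ i j → π₁ (pair i j) ≡ i
  π₁-pair i j = trans (Residue.#-cong m (∣ₛ-resp (telescope (interpolate ⟦ i ⟧ ⟦ j ⟧) ⟦ pair i j ⟧ ⟦ i ⟧)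
    (∣ₛ-+ (∣ₛ-* -1ℤ (∣ₛ-trans-ℕ n (red-∣ (m ℕ.* n) (interpolate ⟦ i ⟧ ⟦ j ⟧)))) (interpolate-ˡ ⟦ i ⟧ ⟦ j ⟧)))) (Residue.#-⟦⟧ m i)

  π₂-pair : ∀ i j → π₂ (pair i j) ≡ j
  π₂-pair i j = trans (Residue.#-cong n (∣ₛ-resp (telescope (interpolate ⟦ i ⟧ ⟦ j ⟧) ⟦ pair i j ⟧ ⟦ j ⟧)
    (∣ₛ-+ (∣ₛ-* -1ℤ (∣ₛ-trans-ℕ m (subst (λ k → + k ∣ₛ interpolate ⟦ i ⟧ ⟦ j ⟧ - ⟦ pair i j ⟧) (ℕ.*-comm m n) (red-∣ (m ℕ.* n) (interpolate ⟦ i ⟧ ⟦ j ⟧))))) (interpolate-ʳ ⟦ i ⟧ ⟦ j ⟧)))) (Residue.#-⟦⟧ n j)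

  π-injective : ∀ {x y} → π₁ x ≡ π₁ y → π₂ x ≡ π₂ y → x ≡ y
  π-injective eq₁ eq₂ = ⟦⟧-injective-mod (comaximal-∣ c (Residue.#-injective m eq₁) (Residue.#-injective n eq₂))

  -- Exactly one x lies over (i, j), so the product of the deltas is the delta at `pair i j`.
  fibre : ∀ i j → sum (λ x → δ (π₁ x) i * δ (π₂ x) j) ≡ 1ℤ
  fibre i j = trans (sum-cong-≗ λ x → sym (ι-× (π₁ x Fin.≟ i) (π₂ x Fin.≟ j) (pair i j Fin.≟ x)
      (λ { refl → π₁-pair i j , π₂-pair i j })
      (λ eq₁ eq₂ → π-injective (trans (π₁-pair i j) (sym eq₁)) (trans (π₂-pair i j) (sym eq₂)))))
    (Σ-δ₁ (pair i j))

  -- Both factors are expanded by deltas and the summations exchanged until the sum over x is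
  -- innermost, where `fibre` evaluates it.
  sum-CRT : ∀ (f : Fin m → ℤ) (g : Fin n → ℤ) → sum (λ x → f (π₁ x) * g (π₂ x)) ≡ sum f * sum g
  sum-CRT f g = begin
    sum (λ x → f (π₁ x) * g (π₂ x))
      ≡⟨ sum-cong-≗ (λ x → sym (cong₂ _*_ (Σ-δ (π₁ x) f) (Σ-δ (π₂ x) g))) ⟩
    sum (λ x → sum (λ i → δ (π₁ x) i * f i) * sum (λ j → δ (π₂ x) j * g j))
      ≡⟨ sum-cong-≗ (λ x → trans (Σ-*-Σ (λ i → δ (π₁ x) i * f i) (λ j → δ (π₂ x) j * g j))
           (sum-cong-≗ λ i → sum-cong-≗ λ j → regroup (δ (π₁ x) i) (f i) (δ (π₂ x) j) (g j))) ⟩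
    sum (λ x → sum (λ i → sum (λ j → f i * g j * (δ (π₁ x) i * δ (π₂ x) j))))
      ≡⟨ ∑-comm (λ x i → sum (λ j → f i * g j * (δ (π₁ x) i * δ (π₂ x) j))) ⟩
    sum (λ i → sum (λ x → sum (λ j → f i * g j * (δ (π₁ x) i * δ (π₂ x) j))))
      ≡⟨ sum-cong-≗ (λ i → ∑-comm (λ x j → f i * g j * (δ (π₁ x) i * δ (π₂ x) j))) ⟩
    sum (λ i → sum (λ j → sum (λ x → f i * g j * (δ (π₁ x) i * δ (π₂ x) j))))
      ≡⟨ sum-cong-≗ (λ i → sum-cong-≗ λ j → trans (sym (*-distribˡ-sum (f i * g j) (λ x → δ (π₁ x) i * δ (π₂ x) j))) (trans (cong (f i * g j *_) (fibre i j)) (ℤ.*-identityʳ (f i * g j)))) ⟩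
    sum (λ i → sum (λ j → f i * g j))
      ≡⟨ Σ-*-Σ f g ⟨
    sum f * sum g  ∎
    where
    open ≡-Reasoning
    regroup : ∀ a b c d → a * b * (c * d) ≡ b * d * (a * c)
    regroup = solve-∀

  orderedCliques-CRT : ∀ k (w : Fin m → ℤ) (A : Fin m → Fin m → ℤ) (w′ : Fin n → ℤ) (A′ : Fin n → Fin n → ℤ) →
    orderedCliques k (λ x → w (π₁ x) * w′ (π₂ x)) (λ x y → A (π₁ x) (π₁ y) * A′ (π₂ x) (π₂ y)) ≡ orderedCliques k w A * orderedCliques k w′ A′
  orderedCliques-CRT zero    w A w′ A′ = refl
  orderedCliques-CRT (suc k) w A w′ A′ = trans (sum-cong-≗ term)
    (sum-CRT (λ i → w i * orderedCliques k (λ y → w y * A i y) A) (λ j → w′ j * orderedCliques k (λ y → w′ y * A′ j y) A′))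
    where
    open ≡-Reasoning
    regroup : ∀ a b c d → a * b * (c * d) ≡ a * c * (b * d)
    regroup = solve-∀
    AA′ : Fin (m ℕ.* n) → Fin (m ℕ.* n) → ℤ
    AA′ x y = A (π₁ x) (π₁ y) * A′ (π₂ x) (π₂ y)
    term : ∀ x → w (π₁ x) * w′ (π₂ x) * orderedCliques k (λ y → w (π₁ y) * w′ (π₂ y) * AA′ x y) AA′ ≡
                 w (π₁ x) * orderedCliques k (λ y → w y * A (π₁ x) y) A * (w′ (π₂ x) * orderedCliques k (λ y → w′ y * A′ (π₂ x) y) A′)
    term x = begin
      w (π₁ x) * w′ (π₂ x) * orderedCliques k (λ y → w (π₁ y) * w′ (π₂ y) * AA′ x y) AA′
        ≡⟨ cong (w (π₁ x) * w′ (π₂ x) *_) (trans (orderedCliques-cong k (λ y → regroup (w (π₁ y)) (w′ (π₂ y)) (A (π₁ x) (π₁ y)) (A′ (π₂ x) (π₂ y))) (λ _ _ → refl))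
             (orderedCliques-CRT k (λ y → w y * A (π₁ x) y) A (λ y → w′ y * A′ (π₂ x) y) A′)) ⟩
      w (π₁ x) * w′ (π₂ x) * (orderedCliques k (λ y → w y * A (π₁ x) y) A * orderedCliques k (λ y → w′ y * A′ (π₂ x) y) A′)
        ≡⟨ regroup (w (π₁ x)) (w′ (π₂ x)) (orderedCliques k (λ y → w y * A (π₁ x) y) A) (orderedCliques k (λ y → w′ y * A′ (π₂ x) y) A′) ⟩
      w (π₁ x) * orderedCliques k (λ y → w y * A (π₁ x) y) A * (w′ (π₂ x) * orderedCliques k (λ y → w′ y * A′ (π₂ x) y) A′)  ∎

ordered𝒦₄ : ℕ → ℤ
ordered𝒦₄ n = orderedCliques {n} 4 (λ _ → 1ℤ) (λ x y → sq n (⟦ x ⟧ - ⟦ y ⟧))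

sq-red : ∀ n .{{_ : ℕ.NonZero n}} x y → sq n (x - y) ≡ sq n (⟦ red n x ⟧ - ⟦ red n y ⟧)
sq-red n x y = sq-cong (x - y) (⟦ red n x ⟧ - ⟦ red n y ⟧) (∣ₛ-resp (regroup x y ⟦ red n x ⟧ ⟦ red n y ⟧) (∣ₛ-+ (red-∣ n x) (∣ₛ-* -1ℤ (red-∣ n y))))
  where
  regroup : ∀ x y a b → x - a + -1ℤ * (y - b) ≡ x - y - (a - b)
  regroup = solve-∀

ordered𝒦₄-* : ∀ {m n} .{{_ : ℕ.NonZero m}} .{{_ : ℕ.NonZero n}} → Comaximal m n → ordered𝒦₄ (m ℕ.* n) ≡ ordered𝒦₄ m * ordered𝒦₄ n
ordered𝒦₄-* {m} {n} c = trans (orderedCliques-cong {m ℕ.* n} 4 {w = λ _ → 1ℤ} {w′ = λ _ → 1ℤ} (λ _ → refl) (λ x y → trans (sq-* c (⟦ x ⟧ - ⟦ y ⟧)) (cong₂ _*_ (sq-red m ⟦ x ⟧ ⟦ y ⟧) (sq-red n ⟦ x ⟧ ⟦ y ⟧))))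
  (orderedCliques-CRT 4 (λ _ → 1ℤ) (λ i j → sq m (⟦ i ⟧ - ⟦ j ⟧)) (λ _ → 1ℤ) (λ i j → sq n (⟦ i ⟧ - ⟦ j ⟧)))
  where
  instance _ = ℕ.m*n≢0 m n
  open CRT c

ordered𝒦₄-^ : ∀ {p} .{{_ : ℕ.NonZero p}} → Odd p → ∀ k → ordered𝒦₄ (p ℕ.^ suc k) ≡ (+ (p ℕ.^ k)) ℤ.^ 4 * ordered𝒦₄ p
ordered𝒦₄-^ {p} odd k = begin
  ordered𝒦₄ (p ℕ.* p ℕ.^ k)
    ≡⟨ cong ordered𝒦₄ (ℕ.*-comm p (p ℕ.^ k)) ⟩
  ordered𝒦₄ (p ℕ.^ k ℕ.* p)
    ≡⟨ orderedCliques-cong {p ℕ.^ k ℕ.* p} 4 {w = λ _ → 1ℤ} {w′ = λ _ → 1ℤ} (λ _ → refl) (λ x y → trans (sq-^ odd k (⟦ x ⟧ - ⟦ y ⟧)) (sq-red p ⟦ x ⟧ ⟦ y ⟧)) ⟩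
  orderedCliques {p ℕ.^ k ℕ.* p} 4 (λ _ → 1ℤ) (λ x y → sq p (⟦ red p ⟦ x ⟧ ⟧ - ⟦ red p ⟦ y ⟧ ⟧))
    ≡⟨ orderedCliques-periodic 4 (p ℕ.^ k) p (λ _ → 1ℤ) (λ i j → sq p (⟦ i ⟧ - ⟦ j ⟧)) ⟩
  (+ (p ℕ.^ k)) ℤ.^ 4 * ordered𝒦₄ p  ∎
  where
  open ≡-Reasoning
  instance
    _ = ℕ.m^n≢0 p k
    _ = ℕ.m*n≢0 (p ℕ.^ k) p

-- Quadratic character sums over a field of p elements

Σ-nonNegative : ∀ {n} (f : Fin n → ℤ) → (∀ x → 0ℤ ℤ.≤ f x) → 0ℤ ℤ.≤ sum f
Σ-nonNegative {zero}  f f≥0 = ℤ.≤-refl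
Σ-nonNegative {suc n} f f≥0 = ℤ.+-mono-≤ (f≥0 Fin.zero) (Σ-nonNegative (f ∘ Fin.suc) (f≥0 ∘ Fin.suc))

i+j≡0⇒i≡0 : ∀ {i j} → 0ℤ ℤ.≤ i → 0ℤ ℤ.≤ j → i + j ≡ 0ℤ → i ≡ 0ℤ
i+j≡0⇒i≡0 {i} {j} i≥0 j≥0 i+j≡0 = ℤ.≤-antisym (ℤ.≤-trans i≤i+j (ℤ.≤-reflexive i+j≡0)) i≥0
  where
  i≤i+j : i ℤ.≤ i + j
  i≤i+j = ℤ.≤-trans (ℤ.≤-reflexive (sym (ℤ.+-identityʳ i))) (ℤ.+-monoʳ-≤ i j≥0)

Σ≡0⇒≡0 : ∀ {n} (f : Fin n → ℤ) → (∀ x → 0ℤ ℤ.≤ f x) → sum f ≡ 0ℤ → ∀ x → f x ≡ 0ℤ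
Σ≡0⇒≡0 f f≥0 Σf≡0 Fin.zero    = i+j≡0⇒i≡0 (f≥0 Fin.zero) (Σ-nonNegative (f ∘ Fin.suc) (f≥0 ∘ Fin.suc)) Σf≡0
Σ≡0⇒≡0 f f≥0 Σf≡0 (Fin.suc x) = Σ≡0⇒≡0 (f ∘ Fin.suc) (f≥0 ∘ Fin.suc)
  (i+j≡0⇒i≡0 (Σ-nonNegative (f ∘ Fin.suc) (f≥0 ∘ Fin.suc)) (f≥0 Fin.zero) (trans (ℤ.+-comm (sum (f ∘ Fin.suc)) (f Fin.zero)) Σf≡0)) x

-- The facts about ℤ/p behind the character sums; that -1 is a square makes both χ and the indicator
-- `s` even functions.
record OddField (p : ℕ) .{{_ : ℕ.NonZero p}} : Set where
  open Residue p
  field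
    𝟙≢𝟘     : 𝟙 ≢ 𝟘
    2≢𝟘     : # (+ 2) ≢ 𝟘
    inverse : ∀ x → x ≢ 𝟘 → ∃ λ y → x ⊗ y ≡ 𝟙
    √-1     : ∃ λ i → i ⊗ i ≡ ⊝ 𝟙

module Characters (p : ℕ) .{{_ : ℕ.NonZero p}} (F : OddField p) where

  open Residue p
  open OddField F
  open ≡-Reasoning

  ∑ : (Fin p → ℤ) → ℤ
  ∑ = sum {p}

  _⁻¹ : ∀ {x} → x ≢ 𝟘 → Fin p
  x≢𝟘 ⁻¹ = proj₁ (inverse _ x≢𝟘)

  zero-⊗ : ∀ x → 𝟘 ⊗ x ≡ 𝟘
  zero-⊗ = solve 1 (λ x → con 0ℤ :* x := con 0ℤ) refl
    where open Solver

  ⊗-cancelˡ : ∀ {t x y} → t ≢ 𝟘 → t ⊗ x ≡ t ⊗ y → x ≡ y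
  ⊗-cancelˡ {t} {x} {y} t≢𝟘 eq = trans (sym (back x)) (trans (cong (t⁻¹ ⊗_) eq) (back y))
    where
    t⁻¹ = t≢𝟘 ⁻¹
    back : ∀ z → t⁻¹ ⊗ (t ⊗ z) ≡ z
    back z = begin
      t⁻¹ ⊗ (t ⊗ z)   ≡⟨ solve 3 (λ s t z → s :* (t :* z) := t :* s :* z) refl t⁻¹ t z ⟩
      t ⊗ t⁻¹ ⊗ z     ≡⟨ cong (_⊗ z) (proj₂ (inverse t t≢𝟘)) ⟩
      𝟙 ⊗ z           ≡⟨ ⊗-identityˡ z ⟩
      z               ∎
      where open Solver

  ⊗-nonzero : ∀ {x y} → x ≢ 𝟘 → y ≢ 𝟘 → x ⊗ y ≢ 𝟘
  ⊗-nonzero {x} x≢𝟘 y≢𝟘 xy≡𝟘 = y≢𝟘 (⊗-cancelˡ x≢𝟘 (trans xy≡𝟘 (sym (trans (⊗-comm x 𝟘) (zero-⊗ x)))))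

  ⊖≡𝟘⇒≡ : ∀ {x y} → x ⊖ y ≡ 𝟘 → x ≡ y
  ⊖≡𝟘⇒≡ {x} {y} eq = begin
    x          ≡⟨ solve 2 (λ x y → x := x :- y :+ y) refl x y ⟩
    x ⊖ y ⊕ y  ≡⟨ cong (_⊕ y) eq ⟩
    𝟘 ⊕ y      ≡⟨ ⊕-identityˡ y ⟩
    y          ∎
    where open Solver

  ⊖-self : ∀ x → x ⊖ x ≡ 𝟘
  ⊖-self = solve 1 (λ x → x :- x := con 0ℤ) refl
    where open Solver

  ≡⇒⊖≡𝟘 : ∀ {x y} → x ≡ y → x ⊖ y ≡ 𝟘
  ≡⇒⊖≡𝟘 {x} refl = ⊖-self x

  -- If y and a differ, y - a can be cancelled from (y - a) (-a) = (y - a) y.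
  square-roots : ∀ {a y} → a ⊗ a ≡ y ⊗ y → a ≡ y ⊎ ⊝ a ≡ y
  square-roots {a} {y} eq with y ⊖ a Fin.≟ 𝟘
  ... | yes y-a≡𝟘 = inj₁ (sym (⊖≡𝟘⇒≡ y-a≡𝟘))
  ... | no  y-a≢𝟘 = inj₂ (⊗-cancelˡ y-a≢𝟘 (begin
    (y ⊖ a) ⊗ (⊝ a)          ≡⟨ solve 2 (λ a y → (y :- a) :* (:- a) := a :* a :- y :* a) refl a y ⟩
    a ⊗ a ⊖ y ⊗ a            ≡⟨ cong (_⊖ y ⊗ a) eq ⟩
    y ⊗ y ⊖ y ⊗ a            ≡⟨ solve 2 (λ a y → y :* y :- y :* a := (y :- a) :* y) refl a y ⟩
    (y ⊖ a) ⊗ y              ∎))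
    where open Solver

  2⊗ : ∀ x → x ⊕ x ≡ # (+ 2) ⊗ x
  2⊗ = solve 1 (λ x → x :+ x := con (+ 2) :* x) refl
    where open Solver

  ≢⊝ : ∀ {a} → a ≢ 𝟘 → a ≢ ⊝ a
  ≢⊝ {a} a≢𝟘 a≡-a = ⊗-nonzero 2≢𝟘 a≢𝟘 (begin
    # (+ 2) ⊗ a   ≡⟨ 2⊗ a ⟨
    a ⊕ a         ≡⟨ cong (a ⊕_) a≡-a ⟩
    a ⊖ a         ≡⟨ ⊖-self a ⟩
    𝟘             ∎)

  ⊝⊗⊝ : ∀ a → ⊝ a ⊗ ⊝ a ≡ a ⊗ a
  ⊝⊗⊝ = solve 1 (λ a → :- a :* :- a := a :* a) refl
    where open Solver

  4≢𝟘 : # (+ 4) ≢ 𝟘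
  4≢𝟘 = ⊗-nonzero 2≢𝟘 2≢𝟘 ∘ trans (solve 0 (con (+ 2) :* con (+ 2) := con (+ 4)) refl)
    where open Solver

  ⊝-nonzero : ∀ {x} → x ≢ 𝟘 → ⊝ x ≢ 𝟘
  ⊝-nonzero {x} x≢𝟘 -x≡𝟘 = x≢𝟘 (⊖≡𝟘⇒≡ (begin
    x ⊖ 𝟘        ≡⟨ solve 1 (λ x → x :- con 0ℤ := :- (:- x)) refl x ⟩
    ⊝ (⊝ x)      ≡⟨ cong ⊝_ -x≡𝟘 ⟩
    ⊝ 𝟘          ≡⟨ solve 0 (:- con 0ℤ := con 0ℤ) refl ⟩
    𝟘            ∎))
    where open Solver

  ∑-affine : ∀ {t} → t ≢ 𝟘 → ∀ c (f : Fin p → ℤ) → ∑ (λ x → f (t ⊗ x ⊕ c)) ≡ ∑ f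
  ∑-affine {t} t≢𝟘 c f = Σ-bijection f (λ x → t ⊗ x ⊕ c) (λ y → t⁻¹ ⊗ (y ⊖ c))
    (λ y → begin
      t ⊗ (t⁻¹ ⊗ (y ⊖ c)) ⊕ c   ≡⟨ solve 4 (λ t s y c → t :* (s :* (y :- c)) :+ c := t :* s :* (y :- c) :+ c) refl t t⁻¹ y c ⟩
      t ⊗ t⁻¹ ⊗ (y ⊖ c) ⊕ c     ≡⟨ cong (λ u → u ⊗ (y ⊖ c) ⊕ c) tt⁻¹≡𝟙 ⟩
      𝟙 ⊗ (y ⊖ c) ⊕ c           ≡⟨ solve 2 (λ y c → con 1ℤ :* (y :- c) :+ c := y) refl y c ⟩
      y                         ∎)
    (λ x → begin
      t⁻¹ ⊗ (t ⊗ x ⊕ c ⊖ c)     ≡⟨ solve 4 (λ t s x c → s :* (t :* x :+ c :- c) := t :* s :* x) refl t t⁻¹ x c ⟩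
      t ⊗ t⁻¹ ⊗ x               ≡⟨ cong (_⊗ x) tt⁻¹≡𝟙 ⟩
      𝟙 ⊗ x                     ≡⟨ ⊗-identityˡ x ⟩
      x                         ∎)
    where
    open Solver
    t⁻¹ = t≢𝟘 ⁻¹
    tt⁻¹≡𝟙 = proj₂ (inverse t t≢𝟘)

  ∑-scale : ∀ {t} → t ≢ 𝟘 → (f : Fin p → ℤ) → ∑ (λ x → f (t ⊗ x)) ≡ ∑ f
  ∑-scale {t} t≢𝟘 f = trans (sum-cong-≗ λ x → cong f (solve 2 (λ t x → t :* x := t :* x :+ con 0ℤ) refl t x)) (∑-affine t≢𝟘 𝟘 f)
    where open Solver

  ∑-shift : ∀ c (f : Fin p → ℤ) → ∑ (λ x → f (x ⊕ c)) ≡ ∑ f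
  ∑-shift c f = trans (sum-cong-≗ λ x → cong (λ z → f (z ⊕ c)) (sym (⊗-identityˡ x))) (∑-affine 𝟙≢𝟘 c f)

  ∑-reflect : ∀ c (f : Fin p → ℤ) → ∑ (λ x → f (c ⊖ x)) ≡ ∑ f
  ∑-reflect c f = trans (sum-cong-≗ λ x → cong f (solve 2 (λ c x → c :- x := :- con 1ℤ :* x :+ c) refl c x)) (∑-affine (⊝-nonzero 𝟙≢𝟘) c f)
    where open Solver

  -- The Legendre symbol. Defining it by counting square roots makes sums over squares, and with
  -- them ∑χ = 0, a matter of exchanging summations.
  χ : Fin p → ℤ
  χ x = ∑ (λ y → δ x (y ⊗ y)) - 1ℤ

  data Quadratic : Fin p → Set where
    isZero    : Quadratic 𝟘
    square    : ∀ {a} → a ≢ 𝟘 → Quadratic (a ⊗ a)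
    nonSquare : ∀ {x} → (∀ y → x ≢ y ⊗ y) → Quadratic x

  quadratic : ∀ x → Quadratic x
  quadratic x with Fin.any? (λ y → x Fin.≟ y ⊗ y)
  ... | no  ¬sq       = nonSquare (λ y eq → ¬sq (y , eq))
  ... | yes (a , refl) with a Fin.≟ 𝟘
  ...   | yes refl = subst Quadratic (sym (zero-⊗ 𝟘)) isZero
  ...   | no a≢𝟘   = square a≢𝟘

  δ-square : ∀ {a} → a ≢ 𝟘 → ∀ y → δ (a ⊗ a) (y ⊗ y) ≡ δ a y + δ (⊝ a) y
  δ-square {a} a≢𝟘 y with a Fin.≟ y | ⊝ a Fin.≟ y
  ... | yes refl | yes -a≡a = contradiction (sym -a≡a) (≢⊝ a≢𝟘)
  ... | yes refl | no  _    = δ-refl (a ⊗ a)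
  ... | no  _    | yes refl = trans (cong (δ (a ⊗ a)) (⊝⊗⊝ a)) (δ-refl (a ⊗ a))
  ... | no a≢y   | no -a≢y  = δ-≢ (λ eq → case (square-roots eq))
    where
    case : ¬ (a ≡ y ⊎ ⊝ a ≡ y)
    case (inj₁ a≡y)  = a≢y a≡y
    case (inj₂ -a≡y) = -a≢y -a≡y

  χ-𝟘 : χ 𝟘 ≡ 0ℤ
  χ-𝟘 = cong (_- 1ℤ) (trans (sum-cong-≗ λ y → ι-cong (𝟘 Fin.≟ y ⊗ y) (𝟘 Fin.≟ y) (only y) (λ { refl → sym (zero-⊗ 𝟘) })) (Σ-δ₁ 𝟘))
    where
    only : ∀ y → 𝟘 ≡ y ⊗ y → 𝟘 ≡ y
    only y 𝟘≡yy with y Fin.≟ 𝟘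
    ... | yes y≡𝟘 = sym y≡𝟘
    ... | no  y≢𝟘 = contradiction (sym 𝟘≡yy) (⊗-nonzero y≢𝟘 y≢𝟘)

  χ-square : ∀ {a} → a ≢ 𝟘 → χ (a ⊗ a) ≡ 1ℤ
  χ-square {a} a≢𝟘 = cong (_- 1ℤ) (begin
    ∑ (λ y → δ (a ⊗ a) (y ⊗ y))    ≡⟨ sum-cong-≗ (δ-square a≢𝟘) ⟩
    ∑ (λ y → δ a y + δ (⊝ a) y)    ≡⟨ ∑-distrib-+ (δ a) (δ (⊝ a)) ⟩
    ∑ (δ a) + ∑ (δ (⊝ a))          ≡⟨ cong₂ _+_ (Σ-δ₁ a) (Σ-δ₁ (⊝ a)) ⟩
    1ℤ + 1ℤ                        ∎)

  χ-nonSquare : ∀ {x} → (∀ y → x ≢ y ⊗ y) → χ x ≡ -1ℤ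
  χ-nonSquare x≢yy = cong (_- 1ℤ) (trans (sum-cong-≗ λ y → δ-≢ (x≢yy y)) (Σ-zero p))

  -- Squaring hits each u exactly 1 + χ u times.
  ∑-squares : ∀ (g : Fin p → ℤ) → ∑ (λ x → g (x ⊗ x)) ≡ ∑ (λ u → g u) + ∑ (λ u → χ u * g u)
  ∑-squares g = begin
    ∑ (λ x → g (x ⊗ x))
      ≡⟨ sum-cong-≗ (λ x → Σ-δ (x ⊗ x) g) ⟨
    ∑ (λ x → ∑ (λ u → δ (x ⊗ x) u * g u))
      ≡⟨ ∑-comm (λ x u → δ (x ⊗ x) u * g u) ⟩
    ∑ (λ u → ∑ (λ x → δ (x ⊗ x) u * g u))
      ≡⟨ sum-cong-≗ (λ u → trans (sum-cong-≗ λ x → cong (_* g u) (δ-sym (x ⊗ x) u)) (sym (*-distribʳ-sum (g u) (λ x → δ u (x ⊗ x))))) ⟩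
    ∑ (λ u → ∑ (λ x → δ u (x ⊗ x)) * g u)
      ≡⟨ sum-cong-≗ (λ u → solve 2 (λ q g → q :* g := g :+ (q :- con 1ℤ) :* g) refl (∑ (λ x → δ u (x ⊗ x))) (g u)) ⟩
    ∑ (λ u → g u + χ u * g u)
      ≡⟨ ∑-distrib-+ g (λ u → χ u * g u) ⟩
    ∑ (λ u → g u) + ∑ (λ u → χ u * g u)  ∎
    where open ℤSolver

  opaque
    ∑χ : ∑ χ ≡ 0ℤ
    ∑χ = ℤ+.∙-cancelˡ (∑ (λ _ → 1ℤ)) _ _ (begin
      ∑ (λ _ → 1ℤ) + ∑ χ                ≡⟨ cong (_+_ (∑ (λ _ → 1ℤ))) (sum-cong-≗ λ u → sym (ℤ.*-identityʳ (χ u))) ⟩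
      ∑ (λ _ → 1ℤ) + ∑ (λ u → χ u * 1ℤ) ≡⟨ ∑-squares (λ _ → 1ℤ) ⟨
      ∑ (λ _ → 1ℤ)                      ≡⟨ ℤ.+-identityʳ (∑ (λ _ → 1ℤ)) ⟨
      ∑ (λ _ → 1ℤ) + 0ℤ                 ∎)

  χ≤1 : ∀ x → χ x ℤ.≤ 1ℤ
  χ≤1 x with quadratic x
  ... | isZero        = ℤ.≤-trans (ℤ.≤-reflexive χ-𝟘) (ℤ.+≤+ ℕ.z≤n)
  ... | square a≢𝟘    = ℤ.≤-reflexive (χ-square a≢𝟘)
  ... | nonSquare x≢□ = ℤ.≤-trans (ℤ.≤-reflexive (χ-nonSquare x≢□)) ℤ.-≤+

  χ-square-⊗ : ∀ {a} → a ≢ 𝟘 → ∀ y → χ (a ⊗ a ⊗ y) ≡ χ y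
  χ-square-⊗ {a} a≢𝟘 y with quadratic y
  ... | isZero         = cong χ (trans (⊗-comm (a ⊗ a) 𝟘) (zero-⊗ (a ⊗ a)))
  ... | square {b} b≢𝟘 = begin
    χ (a ⊗ a ⊗ (b ⊗ b))      ≡⟨ cong χ (solve 2 (λ a b → a :* a :* (b :* b) := (a :* b) :* (a :* b)) refl a b) ⟩
    χ ((a ⊗ b) ⊗ (a ⊗ b))    ≡⟨ χ-square (⊗-nonzero a≢𝟘 b≢𝟘) ⟩
    1ℤ                       ≡⟨ χ-square b≢𝟘 ⟨
    χ (b ⊗ b)                ∎
    where open Solver
  ... | nonSquare y≢□ = trans (χ-nonSquare aay≢□) (sym (χ-nonSquare y≢□))
    where
    open Solver
    a⁻¹ = a≢𝟘 ⁻¹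
    aay≢□ : ∀ z → a ⊗ a ⊗ y ≢ z ⊗ z
    aay≢□ z eq = y≢□ (a⁻¹ ⊗ z) (begin
      y                                    ≡⟨ solve 1 (λ y → y := con 1ℤ :* con 1ℤ :* y) refl y ⟩
      𝟙 ⊗ 𝟙 ⊗ y                            ≡⟨ cong (λ u → u ⊗ u ⊗ y) (proj₂ (inverse a a≢𝟘)) ⟨
      (a ⊗ a⁻¹) ⊗ (a ⊗ a⁻¹) ⊗ y            ≡⟨ solve 3 (λ a s y → (a :* s) :* (a :* s) :* y := s :* s :* (a :* a :* y)) refl a a⁻¹ y ⟩
      a⁻¹ ⊗ a⁻¹ ⊗ (a ⊗ a ⊗ y)              ≡⟨ cong (a⁻¹ ⊗ a⁻¹ ⊗_) eq ⟩
      a⁻¹ ⊗ a⁻¹ ⊗ (z ⊗ z)                  ≡⟨ solve 2 (λ s z → s :* s :* (z :* z) := (s :* z) :* (s :* z)) refl a⁻¹ z ⟩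
      (a⁻¹ ⊗ z) ⊗ (a⁻¹ ⊗ z)                ∎)

  -- For a non-square g, the terms χ y + χ (g y) are all ≤ 0 and sum to 0.
  χ-nonSquare-⊗ : ∀ {g} → (∀ y → g ≢ y ⊗ y) → ∀ y → χ (g ⊗ y) ≡ - χ y
  χ-nonSquare-⊗ {g} g≢□ y = ℤ+.∙-cancelʳ (χ y) _ _ (begin
    χ (g ⊗ y) + χ y    ≡⟨ solve 2 (λ u v → u :+ v := :- (:- (v :+ u))) refl (χ (g ⊗ y)) (χ y) ⟩
    - h y              ≡⟨ cong -_ (Σ≡0⇒≡0 h h≥0 ∑h≡0 y) ⟩
    0ℤ                 ≡⟨ ℤ.+-inverseˡ (χ y) ⟨
    - χ y + χ y        ∎)
    where
    open ℤSolver
    g≢𝟘 : g ≢ 𝟘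
    g≢𝟘 refl = g≢□ 𝟘 (sym (zero-⊗ 𝟘))
    h : Fin p → ℤ
    h z = - (χ z + χ (g ⊗ z))
    h≥0 : ∀ z → 0ℤ ℤ.≤ h z
    h≥0 z with quadratic z
    ... | isZero          = ℤ.≤-reflexive (sym (cong -_ (cong₂ _+_ χ-𝟘 (trans (cong χ (trans (⊗-comm g 𝟘) (zero-⊗ g))) χ-𝟘))))
    ... | square {a} a≢𝟘  = ℤ.≤-reflexive (sym (cong -_ (cong₂ _+_ (χ-square a≢𝟘)
                              (trans (cong χ (⊗-comm g (a ⊗ a))) (trans (χ-square-⊗ a≢𝟘 g) (χ-nonSquare g≢□))))))
    ... | nonSquare z≢□   = ℤ.neg-mono-≤ (ℤ.≤-trans (ℤ.+-mono-≤ (ℤ.≤-reflexive (χ-nonSquare z≢□)) (χ≤1 (g ⊗ z))) ℤ.≤-refl)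
    ∑h≡0 : ∑ h ≡ 0ℤ
    ∑h≡0 = begin
      ∑ h                               ≡⟨ sum-cong-≗ (λ z → solve 2 (λ a b → :- (a :+ b) := con 0ℤ :- (a :+ b)) refl (χ z) (χ (g ⊗ z))) ⟩
      ∑ (λ z → 0ℤ - (χ z + χ (g ⊗ z)))  ≡⟨ Σ-distrib-- (λ _ → 0ℤ) (λ z → χ z + χ (g ⊗ z)) ⟩
      ∑ (λ _ → 0ℤ) - ∑ (λ z → χ z + χ (g ⊗ z))  ≡⟨ cong₂ _-_ (Σ-zero p) (trans (∑-distrib-+ χ (λ z → χ (g ⊗ z))) (cong₂ _+_ ∑χ (trans (∑-scale g≢𝟘 χ) ∑χ))) ⟩
      0ℤ                                ∎

  χ-⊗ : ∀ x y → χ (x ⊗ y) ≡ χ x * χ y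
  χ-⊗ x y with quadratic x
  ... | isZero        = trans (cong χ (zero-⊗ y)) (trans χ-𝟘 (sym (trans (cong (_* χ y) χ-𝟘) (ℤ.*-zeroˡ (χ y)))))
  ... | square a≢𝟘    = trans (χ-square-⊗ a≢𝟘 y) (sym (trans (cong (_* χ y) (χ-square a≢𝟘)) (ℤ.*-identityˡ (χ y))))
  ... | nonSquare x≢□ = trans (χ-nonSquare-⊗ x≢□ y) (sym (trans (cong (_* χ y) (χ-nonSquare x≢□)) (ℤ.-1*i≡-i (χ y))))

  χ² : ∀ x → χ x * χ x ≡ 1ℤ - δ 𝟘 x
  χ² x with quadratic x
  ... | isZero           = trans (cong₂ _*_ χ-𝟘 χ-𝟘) (sym (cong (_-_ 1ℤ) (δ-refl 𝟘)))
  ... | square {a} a≢𝟘   = trans (cong₂ _*_ (χ-square a≢𝟘) (χ-square a≢𝟘)) (sym (cong (_-_ 1ℤ) (δ-≢ (⊗-nonzero a≢𝟘 a≢𝟘 ∘ sym))))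
  ... | nonSquare x≢□    = trans (cong₂ _*_ (χ-nonSquare x≢□) (χ-nonSquare x≢□)) (sym (cong (_-_ 1ℤ) (δ-≢ (λ 𝟘≡x → x≢□ 𝟘 (trans (sym 𝟘≡x) (sym (zero-⊗ 𝟘)))))))

  χ²-nonzero : ∀ {x} → x ≢ 𝟘 → χ x * χ x ≡ 1ℤ
  χ²-nonzero {x} x≢𝟘 = trans (χ² x) (cong (_-_ 1ℤ) (δ-≢ (x≢𝟘 ∘ sym)))

  χ-𝟙 : χ 𝟙 ≡ 1ℤ
  χ-𝟙 = trans (cong χ (sym (⊗-identityˡ 𝟙))) (χ-square 𝟙≢𝟘)

  i≢𝟘 : proj₁ √-1 ≢ 𝟘
  i≢𝟘 i≡𝟘 = ⊝-nonzero 𝟙≢𝟘 (trans (sym (proj₂ √-1)) (trans (cong (λ i → i ⊗ i) i≡𝟘) (zero-⊗ 𝟘)))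

  χ-⊝ : ∀ x → χ (⊝ x) ≡ χ x
  χ-⊝ x = begin
    χ (⊝ x)             ≡⟨ cong χ (solve 1 (λ x → :- x := :- con 1ℤ :* x) refl x) ⟩
    χ (⊝ 𝟙 ⊗ x)         ≡⟨ cong (λ u → χ (u ⊗ x)) (proj₂ √-1) ⟨
    χ (i ⊗ i ⊗ x)       ≡⟨ χ-square-⊗ i≢𝟘 x ⟩
    χ x                 ∎
    where
    open Solver
    i = proj₁ √-1

  χ-⊖ : ∀ x y → χ (x ⊖ y) ≡ χ (y ⊖ x)
  χ-⊖ x y = trans (cong χ (solve 2 (λ x y → x :- y := :- (y :- x)) refl x y)) (χ-⊝ (y ⊖ x))
    where open Solver


  ∑-1 : ∑ (λ _ → 1ℤ) ≡ + p
  ∑-1 = trans (Σ-const p 1ℤ) (ℤ.*-identityʳ (+ p))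

  ∑χ² : ∑ (λ x → χ x * χ x) ≡ + p - 1ℤ
  ∑χ² = begin
    ∑ (λ x → χ x * χ x)          ≡⟨ sum-cong-≗ χ² ⟩
    ∑ (λ x → 1ℤ - δ 𝟘 x)         ≡⟨ Σ-distrib-- (λ _ → 1ℤ) (δ 𝟘) ⟩
    ∑ (λ x → 1ℤ) - ∑ (δ 𝟘)       ≡⟨ cong₂ _-_ ∑-1 (Σ-δ₁ 𝟘) ⟩
    + p - 1ℤ                     ∎

  ∑χ-shift : ∀ c → ∑ (λ x → χ (x ⊕ c)) ≡ 0ℤ
  ∑χ-shift c = trans (∑-shift c χ) ∑χ

  ∑χ-reflect : ∀ c → ∑ (λ x → χ (c ⊖ x)) ≡ 0ℤ
  ∑χ-reflect c = trans (∑-reflect c χ) ∑χ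

  -- The factor χ t kills t = 0, the only t for which x ↦ t x is no bijection.
  χ*∑-scale : ∀ t (f : Fin p → ℤ) → χ t * ∑ (λ x → f (t ⊗ x)) ≡ χ t * ∑ f
  χ*∑-scale t f with t Fin.≟ 𝟘
  ... | yes refl = trans (cong (_* ∑ (λ x → f (𝟘 ⊗ x))) χ-𝟘) (trans (ℤ.*-zeroˡ (∑ (λ x → f (𝟘 ⊗ x)))) (sym (trans (cong (_* ∑ f) χ-𝟘) (ℤ.*-zeroˡ (∑ f)))))
  ... | no  t≢𝟘  = cong (χ t *_) (∑-scale t≢𝟘 f)

  autocorrelation : Fin p → ℤ
  autocorrelation c = ∑ (λ x → χ x * χ (x ⊕ c))

  autocorrelation-𝟘 : autocorrelation 𝟘 ≡ + p - 1ℤ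
  autocorrelation-𝟘 = trans (sum-cong-≗ λ x → cong (λ y → χ x * χ y) (trans (⊕-comm x 𝟘) (⊕-identityˡ x))) ∑χ²

  autocorrelation-scale : ∀ {t} → t ≢ 𝟘 → autocorrelation t ≡ autocorrelation 𝟙
  autocorrelation-scale {t} t≢𝟘 = begin
    ∑ (λ x → χ x * χ (x ⊕ t))
      ≡⟨ ∑-scale t≢𝟘 (λ x → χ x * χ (x ⊕ t)) ⟨
    ∑ (λ x → χ (t ⊗ x) * χ (t ⊗ x ⊕ t))
      ≡⟨ sum-cong-≗ (λ x → cong (λ y → χ (t ⊗ x) * χ y) (solve 2 (λ t x → t :* x :+ t := t :* (x :+ con 1ℤ)) refl t x)) ⟩
    ∑ (λ x → χ (t ⊗ x) * χ (t ⊗ (x ⊕ 𝟙)))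
      ≡⟨ sum-cong-≗ (λ x → trans (cong₂ _*_ (χ-⊗ t x) (χ-⊗ t (x ⊕ 𝟙))) (regroup (χ t) (χ x) (χ (x ⊕ 𝟙)))) ⟩
    ∑ (λ x → χ t * χ t * (χ x * χ (x ⊕ 𝟙)))
      ≡⟨ sum-cong-≗ (λ x → trans (cong (_* (χ x * χ (x ⊕ 𝟙))) (χ²-nonzero t≢𝟘)) (ℤ.*-identityˡ (χ x * χ (x ⊕ 𝟙)))) ⟩
    ∑ (λ x → χ x * χ (x ⊕ 𝟙))  ∎
    where
    open Solver
    regroup : ∀ a b c → a * b * (a * c) ≡ a * a * (b * c)
    regroup = solve-∀

  ∑∑χ-shift : ∀ (f : Fin p → ℤ) → ∑ (λ c → ∑ (λ x → f x * χ (x ⊕ c))) ≡ 0ℤ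
  ∑∑χ-shift f = begin
    ∑ (λ c → ∑ (λ x → f x * χ (x ⊕ c)))   ≡⟨ ∑-comm (λ c x → f x * χ (x ⊕ c)) ⟩
    ∑ (λ x → ∑ (λ c → f x * χ (x ⊕ c)))   ≡⟨ sum-cong-≗ (λ x → sym (*-distribˡ-sum (f x) (λ c → χ (x ⊕ c)))) ⟩
    ∑ (λ x → f x * ∑ (λ c → χ (x ⊕ c)))   ≡⟨ sum-cong-≗ (λ x → cong (f x *_) (trans (sum-cong-≗ λ c → cong χ (⊕-comm x c)) (∑χ-shift x))) ⟩
    ∑ (λ x → f x * 0ℤ)                    ≡⟨ sum-cong-≗ (λ x → ℤ.*-zeroʳ (f x)) ⟩
    ∑ (λ x → 0ℤ)                          ≡⟨ Σ-zero p ⟩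
    0ℤ                                    ∎

  p-1≢0 : + p - 1ℤ ≢ 0ℤ
  p-1≢0 p-1≡0 = 𝟙≢𝟘 (one p (ℤ.+-injective (ℤ.i-j≡0⇒i≡j (+ p) 1ℤ p-1≡0)) 𝟙 𝟘)
    where
    one : ∀ n → n ≡ 1 → (x y : Fin n) → x ≡ y
    one 1 _ Fin.zero Fin.zero = refl

  -- Autocorrelation is constant off 𝟘, and its sum over all shifts vanishes.
  autocorrelation-𝟙 : autocorrelation 𝟙 ≡ -1ℤ
  autocorrelation-𝟙 = ℤ.*-cancelˡ-≡ (+ p - 1ℤ) C -1ℤ {{ℤ.≢-nonZero p-1≢0}} (ℤ+.∙-cancelˡ (+ p - 1ℤ) _ _ (begin
    + p - 1ℤ + (+ p - 1ℤ) * C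
      ≡⟨ solve 2 (λ P C → P :- con 1ℤ :+ (P :- con 1ℤ) :* C := (P :- con 1ℤ :- C) :* con 1ℤ :+ C :* P) refl (+ p) C ⟩
    (+ p - 1ℤ - C) * 1ℤ + C * + p
      ≡⟨ cong₂ (λ a b → (+ p - 1ℤ - C) * a + C * b) (Σ-δ₁ 𝟘) ∑-1 ⟨
    (+ p - 1ℤ - C) * ∑ (δ 𝟘) + C * ∑ (λ _ → 1ℤ)
      ≡⟨ cong₂ _+_ (*-distribˡ-sum (+ p - 1ℤ - C) (δ 𝟘)) (*-distribˡ-sum {p} C (λ _ → 1ℤ)) ⟩
    ∑ (λ c → (+ p - 1ℤ - C) * δ 𝟘 c) + ∑ (λ _ → C * 1ℤ)
      ≡⟨ ∑-distrib-+ (λ c → (+ p - 1ℤ - C) * δ 𝟘 c) (λ _ → C * 1ℤ) ⟨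
    ∑ (λ c → (+ p - 1ℤ - C) * δ 𝟘 c + C * 1ℤ)
      ≡⟨ sum-cong-≗ value ⟨
    ∑ autocorrelation
      ≡⟨ ∑∑χ-shift χ ⟩
    0ℤ
      ≡⟨ solve 1 (λ P → con 0ℤ := P :- con 1ℤ :+ (P :- con 1ℤ) :* con -1ℤ) refl (+ p) ⟩
    + p - 1ℤ + (+ p - 1ℤ) * -1ℤ ∎))
    where
    open ℤSolver
    C = autocorrelation 𝟙
    value : ∀ c → autocorrelation c ≡ (+ p - 1ℤ - C) * δ 𝟘 c + C * 1ℤ
    value c with 𝟘 Fin.≟ c
    ... | yes refl = trans autocorrelation-𝟘 (solve 2 (λ P C → P :- con 1ℤ := (P :- con 1ℤ :- C) :* con 1ℤ :+ C :* con 1ℤ) refl (+ p) C)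
    ... | no  𝟘≢c  = trans (autocorrelation-scale (𝟘≢c ∘ sym)) (solve 2 (λ P C → C := (P :- con 1ℤ :- C) :* con 0ℤ :+ C :* con 1ℤ) refl (+ p) C)

  opaque
    ∑χχ-shift : ∀ c → ∑ (λ x → χ x * χ (x ⊕ c)) ≡ + p * δ 𝟘 c - 1ℤ
    ∑χχ-shift c with 𝟘 Fin.≟ c
    ... | yes refl = trans autocorrelation-𝟘 (cong (_- 1ℤ) (sym (ℤ.*-identityʳ (+ p))))
    ... | no  𝟘≢c  = trans (autocorrelation-scale (𝟘≢c ∘ sym)) (trans autocorrelation-𝟙 (cong (_- 1ℤ) (sym (ℤ.*-zeroʳ (+ p)))))

  δ-⇔ : ∀ {x y u v : Fin p} → (x ≡ y → u ≡ v) → (u ≡ v → x ≡ y) → δ x y ≡ δ u v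
  δ-⇔ {x} {y} {u} {v} = ι-cong (x Fin.≟ y) (u Fin.≟ v)

  ∑χχ : ∀ a b → ∑ (λ x → χ (a ⊖ x) * χ (b ⊖ x)) ≡ + p * δ a b - 1ℤ
  ∑χχ a b = begin
    ∑ (λ x → χ (a ⊖ x) * χ (b ⊖ x))
      ≡⟨ sum-cong-≗ (λ x → cong (λ y → χ (a ⊖ x) * χ y) (solve 3 (λ a b x → b :- x := a :- x :+ (b :- a)) refl a b x)) ⟩
    ∑ (λ x → χ (a ⊖ x) * χ (a ⊖ x ⊕ (b ⊖ a)))
      ≡⟨ ∑-reflect a (λ x → χ x * χ (x ⊕ (b ⊖ a))) ⟩
    ∑ (λ x → χ x * χ (x ⊕ (b ⊖ a)))
      ≡⟨ ∑χχ-shift (b ⊖ a) ⟩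
    + p * δ 𝟘 (b ⊖ a) - 1ℤ
      ≡⟨ cong (λ d → + p * d - 1ℤ) (δ-⇔ (λ eq → sym (⊖≡𝟘⇒≡ (sym eq))) (λ eq → sym (≡⇒⊖≡𝟘 (sym eq)))) ⟩
    + p * δ a b - 1ℤ  ∎
    where open Solver

  ∑χχ⁺ : ∀ a b → ∑ (λ x → χ (a ⊕ x) * χ (b ⊕ x)) ≡ + p * δ a b - 1ℤ
  ∑χχ⁺ a b = begin
    ∑ (λ x → χ (a ⊕ x) * χ (b ⊕ x))                ≡⟨ ∑-reflect 𝟘 (λ x → χ (a ⊕ x) * χ (b ⊕ x)) ⟨
    ∑ (λ x → χ (a ⊕ (𝟘 ⊖ x)) * χ (b ⊕ (𝟘 ⊖ x)))    ≡⟨ sum-cong-≗ (λ x → cong₂ (λ y z → χ y * χ z) (plus-minus a x) (plus-minus b x)) ⟩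
    ∑ (λ x → χ (a ⊖ x) * χ (b ⊖ x))                ≡⟨ ∑χχ a b ⟩
    + p * δ a b - 1ℤ                               ∎
    where
    open Solver
    plus-minus : ∀ a v → a ⊕ (𝟘 ⊖ v) ≡ a ⊖ v
    plus-minus = solve 2 (λ a v → a :+ (con 0ℤ :- v) := a :- v) refl

  ∑χχ₀ : ∀ b → ∑ (λ x → χ x * χ (b ⊖ x)) ≡ + p * δ 𝟘 b - 1ℤ
  ∑χχ₀ b = trans (sum-cong-≗ λ x → cong (_* χ (b ⊖ x)) (trans (sym (χ-⊝ x)) (cong χ (solve 1 (λ x → :- x := con 0ℤ :- x) refl x)))) (∑χχ 𝟘 b)
    where open Solver

  ∑χ-square-shift : ∀ c → ∑ (λ x → χ (x ⊗ x ⊕ c)) ≡ + p * δ 𝟘 c - 1ℤ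
  ∑χ-square-shift c = begin
    ∑ (λ x → χ (x ⊗ x ⊕ c))                              ≡⟨ ∑-squares (λ u → χ (u ⊕ c)) ⟩
    ∑ (λ u → χ (u ⊕ c)) + ∑ (λ u → χ u * χ (u ⊕ c))      ≡⟨ cong₂ _+_ (∑χ-shift c) (∑χχ-shift c) ⟩
    0ℤ + (+ p * δ 𝟘 c - 1ℤ)                              ≡⟨ ℤ.+-identityˡ (+ p * δ 𝟘 c - 1ℤ) ⟩
    + p * δ 𝟘 c - 1ℤ                                     ∎

  -- Jacobsthal sums and the double sum `E`

  -- The Jacobsthal sum; for r ≠ 0 it is minus the trace of Frobenius of the curve y² = x³ + r x.
  φ : Fin p → ℤ
  φ r = ∑ (λ x → χ x * χ (x ⊗ x ⊕ r))

  -- The number of x with x + 1/x = u.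
  ρ : Fin p → ℤ
  ρ u = ∑ (λ x → δ (u ⊗ x) (x ⊗ x ⊕ 𝟙))

  -- x² - u x + 1 has discriminant u² - 4.
  ρ-discriminant : ∀ u → ρ u ≡ 1ℤ + χ (u ⊗ u ⊖ # (+ 4))
  ρ-discriminant u = begin
    ∑ (λ x → δ (u ⊗ x) (x ⊗ x ⊕ 𝟙))
      ≡⟨ sum-cong-≗ (λ x → δ-⇔ (forth x) (back x)) ⟩
    ∑ (λ x → δ d ((# (+ 2) ⊗ x ⊕ ⊝ u) ⊗ (# (+ 2) ⊗ x ⊕ ⊝ u)))
      ≡⟨ ∑-affine 2≢𝟘 (⊝ u) (λ y → δ d (y ⊗ y)) ⟩
    ∑ (λ y → δ d (y ⊗ y))
      ≡⟨ one+ (∑ (λ y → δ d (y ⊗ y))) ⟩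
    1ℤ + χ d  ∎
    where
    open Solver
    d = u ⊗ u ⊖ # (+ 4)
    one+ : ∀ q → q ≡ 1ℤ + (q - 1ℤ)
    one+ = solve-∀
    forth : ∀ x → u ⊗ x ≡ x ⊗ x ⊕ 𝟙 → d ≡ (# (+ 2) ⊗ x ⊕ ⊝ u) ⊗ (# (+ 2) ⊗ x ⊕ ⊝ u)
    forth x eq = begin
      u ⊗ u ⊖ # (+ 4)
        ≡⟨ solve 2 (λ u x → u :* u :- con (+ 4) := u :* u :- con (+ 4) :* (u :* x) :+ con (+ 4) :* (u :* x :- con 1ℤ)) refl u x ⟩
      u ⊗ u ⊖ # (+ 4) ⊗ (u ⊗ x) ⊕ # (+ 4) ⊗ (u ⊗ x ⊖ 𝟙)
        ≡⟨ cong (λ z → u ⊗ u ⊖ # (+ 4) ⊗ (u ⊗ x) ⊕ # (+ 4) ⊗ (z ⊖ 𝟙)) eq ⟩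
      u ⊗ u ⊖ # (+ 4) ⊗ (u ⊗ x) ⊕ # (+ 4) ⊗ (x ⊗ x ⊕ 𝟙 ⊖ 𝟙)
        ≡⟨ solve 2 (λ u x → u :* u :- con (+ 4) :* (u :* x) :+ con (+ 4) :* (x :* x :+ con 1ℤ :- con 1ℤ)
                        := (con (+ 2) :* x :+ :- u) :* (con (+ 2) :* x :+ :- u)) refl u x ⟩
      (# (+ 2) ⊗ x ⊕ ⊝ u) ⊗ (# (+ 2) ⊗ x ⊕ ⊝ u)  ∎
    back : ∀ x → d ≡ (# (+ 2) ⊗ x ⊕ ⊝ u) ⊗ (# (+ 2) ⊗ x ⊕ ⊝ u) → u ⊗ x ≡ x ⊗ x ⊕ 𝟙
    back x eq = ⊗-cancelˡ 4≢𝟘 (begin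
      # (+ 4) ⊗ (u ⊗ x)
        ≡⟨ solve 2 (λ u x → con (+ 4) :* (u :* x) := con (+ 4) :* (u :* x) :- u :* u :+ con (+ 4) :+ (u :* u :- con (+ 4))) refl u x ⟩
      # (+ 4) ⊗ (u ⊗ x) ⊖ u ⊗ u ⊕ # (+ 4) ⊕ d
        ≡⟨ cong (# (+ 4) ⊗ (u ⊗ x) ⊖ u ⊗ u ⊕ # (+ 4) ⊕_) eq ⟩
      # (+ 4) ⊗ (u ⊗ x) ⊖ u ⊗ u ⊕ # (+ 4) ⊕ (# (+ 2) ⊗ x ⊕ ⊝ u) ⊗ (# (+ 2) ⊗ x ⊕ ⊝ u)
        ≡⟨ solve 2 (λ u x → con (+ 4) :* (u :* x) :- u :* u :+ con (+ 4) :+ (con (+ 2) :* x :+ :- u) :* (con (+ 2) :* x :+ :- u)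
                        := con (+ 4) :* (x :* x :+ con 1ℤ)) refl u x ⟩
      # (+ 4) ⊗ (x ⊗ x ⊕ 𝟙)  ∎)

  -- The substitution v = t + 1/t. For t ≠ 0 the inserted factor χ t χ t = 1 is split: one χ t
  -- enters the argument and clears the denominator, the other stays in front. No v belongs to t =
  -- 0, where the right-hand term vanishes as well because χ 0 = 0.
  ∑ρχ : ∀ x c → ∑ (λ v → ρ v * χ (x ⊗ v ⊕ c)) ≡ ∑ (λ t → χ t * χ (x ⊗ (t ⊗ t ⊕ 𝟙) ⊕ c ⊗ t))
  ∑ρχ x c = begin
    ∑ (λ v → ρ v * χ (x ⊗ v ⊕ c))
      ≡⟨ sum-cong-≗ (λ v → *-distribʳ-sum (χ (x ⊗ v ⊕ c)) (λ t → δ (v ⊗ t) (t ⊗ t ⊕ 𝟙))) ⟩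
    ∑ (λ v → ∑ (λ t → δ (v ⊗ t) (t ⊗ t ⊕ 𝟙) * χ (x ⊗ v ⊕ c)))
      ≡⟨ ∑-comm (λ v t → δ (v ⊗ t) (t ⊗ t ⊕ 𝟙) * χ (x ⊗ v ⊕ c)) ⟩
    ∑ (λ t → ∑ (λ v → δ (v ⊗ t) (t ⊗ t ⊕ 𝟙) * χ (x ⊗ v ⊕ c)))
      ≡⟨ sum-cong-≗ inner ⟩
    ∑ (λ t → χ t * χ (x ⊗ (t ⊗ t ⊕ 𝟙) ⊕ c ⊗ t))  ∎
    where
    inner : ∀ t → ∑ (λ v → δ (v ⊗ t) (t ⊗ t ⊕ 𝟙) * χ (x ⊗ v ⊕ c)) ≡ χ t * χ (x ⊗ (t ⊗ t ⊕ 𝟙) ⊕ c ⊗ t)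
    inner t with t Fin.≟ 𝟘
    ... | yes refl = trans (trans (sum-cong-≗ λ v → cong (_* χ (x ⊗ v ⊕ c)) (δ-≢ (never v))) (Σ-zero p))
                           (sym (cong (_* χ (x ⊗ (𝟘 ⊗ 𝟘 ⊕ 𝟙) ⊕ c ⊗ 𝟘)) χ-𝟘))
      where
      open Solver
      never : ∀ v → v ⊗ 𝟘 ≢ 𝟘 ⊗ 𝟘 ⊕ 𝟙
      never v eq = 𝟙≢𝟘 (trans (solve 0 (con 1ℤ := con 0ℤ :* con 0ℤ :+ con 1ℤ) refl) (trans (sym eq) (solve 1 (λ v → v :* con 0ℤ := con 0ℤ) refl v)))
    ... | no t≢𝟘 = begin
      ∑ (λ v → δ (v ⊗ t) (t ⊗ t ⊕ 𝟙) * χ (x ⊗ v ⊕ c))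
        ≡⟨ sum-cong-≗ (λ v → cong (_* χ (x ⊗ v ⊕ c)) (δ-⇔ (solution v) (λ { refl → solves }))) ⟩
      ∑ (λ v → δ w v * χ (x ⊗ v ⊕ c))
        ≡⟨ Σ-δ w (λ v → χ (x ⊗ v ⊕ c)) ⟩
      χ (x ⊗ w ⊕ c)
        ≡⟨ ℤ.*-identityˡ (χ (x ⊗ w ⊕ c)) ⟨
      1ℤ * χ (x ⊗ w ⊕ c)
        ≡⟨ cong (_* χ (x ⊗ w ⊕ c)) (χ²-nonzero t≢𝟘) ⟨
      χ t * χ t * χ (x ⊗ w ⊕ c)
        ≡⟨ ℤ.*-assoc (χ t) (χ t) (χ (x ⊗ w ⊕ c)) ⟩
      χ t * (χ t * χ (x ⊗ w ⊕ c))
        ≡⟨ cong (χ t *_) (χ-⊗ t (x ⊗ w ⊕ c)) ⟨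
      χ t * χ (t ⊗ (x ⊗ w ⊕ c))
        ≡⟨ cong (λ y → χ t * χ y) (solve 4 (λ t x w c → t :* (x :* w :+ c) := x :* (w :* t) :+ c :* t) refl t x w c) ⟩
      χ t * χ (x ⊗ (w ⊗ t) ⊕ c ⊗ t)
        ≡⟨ cong (λ y → χ t * χ (x ⊗ y ⊕ c ⊗ t)) solves ⟩
      χ t * χ (x ⊗ (t ⊗ t ⊕ 𝟙) ⊕ c ⊗ t)  ∎
      where
      open Solver
      t⁻¹ = t≢𝟘 ⁻¹
      w = t⁻¹ ⊗ (t ⊗ t ⊕ 𝟙)
      solves : w ⊗ t ≡ t ⊗ t ⊕ 𝟙
      solves = begin
        t⁻¹ ⊗ (t ⊗ t ⊕ 𝟙) ⊗ t     ≡⟨ solve 3 (λ s t y → s :* y :* t := t :* s :* y) refl t⁻¹ t (t ⊗ t ⊕ 𝟙) ⟩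
        t ⊗ t⁻¹ ⊗ (t ⊗ t ⊕ 𝟙)     ≡⟨ cong (_⊗ (t ⊗ t ⊕ 𝟙)) (proj₂ (inverse t t≢𝟘)) ⟩
        𝟙 ⊗ (t ⊗ t ⊕ 𝟙)           ≡⟨ ⊗-identityˡ (t ⊗ t ⊕ 𝟙) ⟩
        t ⊗ t ⊕ 𝟙                 ∎
      solution : ∀ v → v ⊗ t ≡ t ⊗ t ⊕ 𝟙 → w ≡ v
      solution v eq = ⊗-cancelˡ t≢𝟘 (trans (⊗-comm t w) (trans solves (trans (sym eq) (⊗-comm v t))))

  E : ℤ
  E = ∑ (λ x → ∑ (λ y → χ x * χ (𝟙 ⊖ x) * (χ y * χ (𝟙 ⊖ y)) * χ (x ⊖ y)))


  -- The meeting point of two computations: discriminants turn it into `E`, and expanding both ρ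
  -- turns it into the twisted part of the square of `φ 𝟙`.
  ρ²-sum : ℤ
  ρ²-sum = ∑ (λ u → ρ u * ∑ (λ v → ρ v * χ (u ⊕ v)))

  -- In ρ u = 1 + χ (u² - 4) the 1 contributes nothing, because χ (u + v) sums to 0 over either
  -- variable. Then u = 4 x - 2 and v = 2 - 4 y turn u² - 4 into -16 x (1 - x), v² - 4 into -16 y (1
  -- - y) and u + v into 4 (x - y), where -16 and 4 are squares.
  ρ²-sum≡E : ρ²-sum ≡ E
  ρ²-sum≡E = begin
    ∑ (λ u → ρ u * ∑ (λ v → ρ v * χ (u ⊕ v)))
      ≡⟨ sum-cong-≗ (λ u → cong₂ _*_ (ρ-discriminant u) (inner u)) ⟩
    ∑ (λ u → (1ℤ + a u) * A u)
      ≡⟨ sum-cong-≗ (λ u → distrib (a u) (A u)) ⟩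
    ∑ (λ u → A u + a u * A u)
      ≡⟨ ∑-distrib-+ A (λ u → a u * A u) ⟩
    ∑ A + ∑ (λ u → a u * A u)
      ≡⟨ cong₂ _+_ (trans (sum-cong-≗ λ u → sum-cong-≗ λ v → cong (λ z → a v * χ z) (⊕-comm u v)) (∑∑χ-shift a)) refl ⟩
    0ℤ + ∑ (λ u → a u * A u)
      ≡⟨ ℤ.+-identityˡ (∑ (λ u → a u * A u)) ⟩
    ∑ (λ u → a u * A u)
      ≡⟨ ∑-affine 4≢𝟘 (⊝ # (+ 2)) (λ u → a u * A u) ⟨
    ∑ (λ x → a (u x) * A (u x))
      ≡⟨ sum-cong-≗ (λ x → cong₂ _*_ (a-u x) (A-u x)) ⟩
    ∑ (λ x → χ x * χ (𝟙 ⊖ x) * ∑ (λ y → χ y * χ (𝟙 ⊖ y) * χ (x ⊖ y)))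
      ≡⟨ sum-cong-≗ (λ x → trans (*-distribˡ-sum (χ x * χ (𝟙 ⊖ x)) (λ y → χ y * χ (𝟙 ⊖ y) * χ (x ⊖ y)))
                                 (sum-cong-≗ λ y → sym (ℤ.*-assoc (χ x * χ (𝟙 ⊖ x)) (χ y * χ (𝟙 ⊖ y)) (χ (x ⊖ y))))) ⟩
    E ∎
    where
    open Solver
    a A : Fin p → ℤ
    a u = χ (u ⊗ u ⊖ # (+ 4))
    A u = ∑ (λ v → a v * χ (u ⊕ v))
    u v : Fin p → Fin p
    u x = # (+ 4) ⊗ x ⊕ ⊝ # (+ 2)
    v y = ⊝ # (+ 4) ⊗ y ⊕ # (+ 2)
    distrib : ∀ b c → (1ℤ + b) * c ≡ c + b * c
    distrib = solve-∀
    inner : ∀ u → ∑ (λ v → ρ v * χ (u ⊕ v)) ≡ A u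
    inner u = begin
      ∑ (λ v → ρ v * χ (u ⊕ v))                           ≡⟨ sum-cong-≗ (λ v → trans (cong (_* χ (u ⊕ v)) (ρ-discriminant v)) (distrib (a v) (χ (u ⊕ v)))) ⟩
      ∑ (λ v → χ (u ⊕ v) + a v * χ (u ⊕ v))               ≡⟨ ∑-distrib-+ (λ v → χ (u ⊕ v)) (λ v → a v * χ (u ⊕ v)) ⟩
      ∑ (λ v → χ (u ⊕ v)) + A u                           ≡⟨ cong (_+ A u) (trans (sum-cong-≗ λ v → cong χ (⊕-comm u v)) (∑χ-shift u)) ⟩
      0ℤ + A u                                            ≡⟨ ℤ.+-identityˡ (A u) ⟩
      A u                                                 ∎
    χ-4² : ∀ z → χ (# (+ 4) ⊗ # (+ 4) ⊗ z) ≡ χ z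
    χ-4² = χ-square-⊗ 4≢𝟘
    χ-4 : ∀ z → χ (# (+ 4) ⊗ z) ≡ χ z
    χ-4 z = trans (cong (λ k → χ (k ⊗ z)) (solve 0 (con (+ 4) := con (+ 2) :* con (+ 2)) refl)) (χ-square-⊗ 2≢𝟘 z)
    a-u : ∀ x → a (u x) ≡ χ x * χ (𝟙 ⊖ x)
    a-u x = begin
      a (u x)                                      ≡⟨ cong χ (solve 1 (λ x → (con (+ 4) :* x :+ :- con (+ 2)) :* (con (+ 4) :* x :+ :- con (+ 2)) :- con (+ 4)
                                                                    := :- (con (+ 4) :* con (+ 4) :* (x :* (con 1ℤ :- x)))) refl x) ⟩
      χ (⊝ (# (+ 4) ⊗ # (+ 4) ⊗ (x ⊗ (𝟙 ⊖ x))))    ≡⟨ χ-⊝ (# (+ 4) ⊗ # (+ 4) ⊗ (x ⊗ (𝟙 ⊖ x))) ⟩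
      χ (# (+ 4) ⊗ # (+ 4) ⊗ (x ⊗ (𝟙 ⊖ x)))        ≡⟨ χ-4² (x ⊗ (𝟙 ⊖ x)) ⟩
      χ (x ⊗ (𝟙 ⊖ x))                              ≡⟨ χ-⊗ x (𝟙 ⊖ x) ⟩
      χ x * χ (𝟙 ⊖ x)                              ∎
    a-v : ∀ y → a (v y) ≡ χ y * χ (𝟙 ⊖ y)
    a-v y = trans (cong χ (solve 1 (λ y → (:- con (+ 4) :* y :+ con (+ 2)) :* (:- con (+ 4) :* y :+ con (+ 2)) :- con (+ 4)
                                       := (con (+ 4) :* y :+ :- con (+ 2)) :* (con (+ 4) :* y :+ :- con (+ 2)) :- con (+ 4)) refl y)) (a-u y)
    A-u : ∀ x → A (u x) ≡ ∑ (λ y → χ y * χ (𝟙 ⊖ y) * χ (x ⊖ y))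
    A-u x = begin
      ∑ (λ v → a v * χ (u x ⊕ v))
        ≡⟨ ∑-affine (⊝-nonzero 4≢𝟘) (# (+ 2)) (λ v → a v * χ (u x ⊕ v)) ⟨
      ∑ (λ y → a (v y) * χ (u x ⊕ v y))
        ≡⟨ sum-cong-≗ (λ y → cong₂ _*_ (a-v y) (trans (cong χ (solve 2 (λ x y → con (+ 4) :* x :+ :- con (+ 2) :+ (:- con (+ 4) :* y :+ con (+ 2)) := con (+ 4) :* (x :- y)) refl x y)) (χ-4 (x ⊖ y)))) ⟩
      ∑ (λ y → χ y * χ (𝟙 ⊖ y) * χ (x ⊖ y))  ∎

  -- `∑ρχ` is applied to each variable in turn; the factorisation behind the result is x + 1/x + t +
  -- 1/t = (x + t) (t x + 1) / (t x).
  ρ²-sum≡ : ρ²-sum ≡ ∑ (λ t → χ t * ∑ (λ x → χ x * χ ((x ⊕ t) ⊗ (t ⊗ x ⊕ 𝟙))))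
  ρ²-sum≡ = begin
    ∑ (λ u → ρ u * ∑ (λ v → ρ v * χ (u ⊕ v)))
      ≡⟨ sum-cong-≗ (λ u → cong (ρ u *_) (trans (sum-cong-≗ λ v → cong (λ z → ρ v * χ z) (solve 2 (λ u v → u :+ v := con 1ℤ :* v :+ u) refl u v)) (∑ρχ 𝟙 u))) ⟩
    ∑ (λ u → ρ u * ∑ (λ t → χ t * χ (𝟙 ⊗ (t ⊗ t ⊕ 𝟙) ⊕ u ⊗ t)))
      ≡⟨ sum-cong-≗ (λ u → *-distribˡ-sum (ρ u) (λ t → χ t * χ (𝟙 ⊗ (t ⊗ t ⊕ 𝟙) ⊕ u ⊗ t))) ⟩
    ∑ (λ u → ∑ (λ t → ρ u * (χ t * χ (𝟙 ⊗ (t ⊗ t ⊕ 𝟙) ⊕ u ⊗ t))))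
      ≡⟨ ∑-comm (λ u t → ρ u * (χ t * χ (𝟙 ⊗ (t ⊗ t ⊕ 𝟙) ⊕ u ⊗ t))) ⟩
    ∑ (λ t → ∑ (λ u → ρ u * (χ t * χ (𝟙 ⊗ (t ⊗ t ⊕ 𝟙) ⊕ u ⊗ t))))
      ≡⟨ sum-cong-≗ (λ t → trans (sum-cong-≗ λ u → trans (left-comm (ρ u) (χ t) (χ (𝟙 ⊗ (t ⊗ t ⊕ 𝟙) ⊕ u ⊗ t)))
             (cong (λ z → χ t * (ρ u * χ z)) (solve 2 (λ t u → con 1ℤ :* (t :* t :+ con 1ℤ) :+ u :* t := t :* u :+ (t :* t :+ con 1ℤ)) refl t u)))
             (sym (*-distribˡ-sum (χ t) (λ u → ρ u * χ (t ⊗ u ⊕ (t ⊗ t ⊕ 𝟙)))))) ⟩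
    ∑ (λ t → χ t * ∑ (λ u → ρ u * χ (t ⊗ u ⊕ (t ⊗ t ⊕ 𝟙))))
      ≡⟨ sum-cong-≗ (λ t → cong (χ t *_) (∑ρχ t (t ⊗ t ⊕ 𝟙))) ⟩
    ∑ (λ t → χ t * ∑ (λ x → χ x * χ (t ⊗ (x ⊗ x ⊕ 𝟙) ⊕ (t ⊗ t ⊕ 𝟙) ⊗ x)))
      ≡⟨ sum-cong-≗ (λ t → cong (χ t *_) (sum-cong-≗ λ x → cong (λ z → χ x * χ z)
           (solve 2 (λ t x → t :* (x :* x :+ con 1ℤ) :+ (t :* t :+ con 1ℤ) :* x := (x :+ t) :* (t :* x :+ con 1ℤ)) refl t x))) ⟩
    ∑ (λ t → χ t * ∑ (λ x → χ x * χ ((x ⊕ t) ⊗ (t ⊗ x ⊕ 𝟙))))  ∎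
    where
    open Solver
    left-comm : ∀ a b c → a * (b * c) ≡ b * (a * c)
    left-comm = solve-∀

  χ³ : ∀ x → χ x * χ x * χ x ≡ χ x
  χ³ x with x Fin.≟ 𝟘
  ... | yes refl = trans (cong (λ c → c * c * c) χ-𝟘) (sym χ-𝟘)
  ... | no  x≢𝟘  = trans (cong (_* χ x) (χ²-nonzero x≢𝟘)) (ℤ.*-identityˡ (χ x))

  -- The roots of 1 are 1 and -1, and χ is 1 at both since -1 is a square. The unreduced `𝟙 ⊗ 𝟙`
  -- matches `δ-square`.
  ∑χδ-roots-of-1 : ∑ (λ t → χ t * δ (𝟙 ⊗ 𝟙) (t ⊗ t)) ≡ + 2
  ∑χδ-roots-of-1 = begin
    ∑ (λ t → χ t * δ (𝟙 ⊗ 𝟙) (t ⊗ t))            ≡⟨ sum-cong-≗ (λ t → trans (cong (χ t *_) (δ-square 𝟙≢𝟘 t)) (distrib (χ t) (δ 𝟙 t) (δ (⊝ 𝟙) t))) ⟩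
    ∑ (λ t → δ 𝟙 t * χ t + δ (⊝ 𝟙) t * χ t)      ≡⟨ ∑-distrib-+ (λ t → δ 𝟙 t * χ t) (λ t → δ (⊝ 𝟙) t * χ t) ⟩
    ∑ (λ t → δ 𝟙 t * χ t) + ∑ (λ t → δ (⊝ 𝟙) t * χ t)  ≡⟨ cong₂ _+_ (Σ-δ 𝟙 χ) (Σ-δ (⊝ 𝟙) χ) ⟩
    χ 𝟙 + χ (⊝ 𝟙)                                ≡⟨ cong₂ _+_ χ-𝟙 (trans (χ-⊝ 𝟙) χ-𝟙) ⟩
    + 2                                          ∎
    where
    distrib : ∀ a b c → a * (b + c) ≡ b * a + c * a
    distrib = solve-∀

  module _ where
    private
      -- At u = x² this is χ (x² + 1) χ ((t x)² + 1), the part of the terms of φ at x and t x that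
      -- is not monomial.
      g : Fin p → Fin p → ℤ
      g t u = χ (u ⊕ 𝟙) * χ (t ⊗ t ⊗ u ⊕ 𝟙)

    -- For t ≠ 0, v = t² u turns `g t u` into χ (t² + v) χ (1 + v), a correlation of χ with itself
    -- whose two shifts agree only if t² = 1.
    χ*∑g : ∀ t → χ t * ∑ (g t) ≡ χ t * (+ p * δ (𝟙 ⊗ 𝟙) (t ⊗ t) - 1ℤ)
    χ*∑g t with t Fin.≟ 𝟘
    ... | yes refl = trans (trans (cong (_* ∑ (g 𝟘)) χ-𝟘) (ℤ.*-zeroˡ (∑ (g 𝟘))))
                           (sym (trans (cong (_* (+ p * δ (𝟙 ⊗ 𝟙) (𝟘 ⊗ 𝟘) - 1ℤ)) χ-𝟘) (ℤ.*-zeroˡ (+ p * δ (𝟙 ⊗ 𝟙) (𝟘 ⊗ 𝟘) - 1ℤ))))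
    ... | no  t≢𝟘  = cong (χ t *_) (begin
      ∑ (g t)
        ≡⟨ sum-cong-≗ (λ u → cong (_* χ (t ⊗ t ⊗ u ⊕ 𝟙)) (sym (χ-square-⊗ t≢𝟘 (u ⊕ 𝟙)))) ⟩
      ∑ (λ u → χ (t ⊗ t ⊗ (u ⊕ 𝟙)) * χ (t ⊗ t ⊗ u ⊕ 𝟙))
        ≡⟨ sum-cong-≗ (λ u → cong₂ (λ y z → χ y * χ z) (solve 2 (λ k u → k :* (u :+ con 1ℤ) := k :+ k :* u) refl (t ⊗ t) u) (⊕-comm (t ⊗ t ⊗ u) 𝟙)) ⟩
      ∑ (λ u → χ (t ⊗ t ⊕ t ⊗ t ⊗ u) * χ (𝟙 ⊕ t ⊗ t ⊗ u))
        ≡⟨ ∑-scale (⊗-nonzero t≢𝟘 t≢𝟘) (λ v → χ (t ⊗ t ⊕ v) * χ (𝟙 ⊕ v)) ⟩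
      ∑ (λ v → χ (t ⊗ t ⊕ v) * χ (𝟙 ⊕ v))
        ≡⟨ ∑χχ⁺ (t ⊗ t) 𝟙 ⟩
      + p * δ (t ⊗ t) 𝟙 - 1ℤ
        ≡⟨ cong (λ d → + p * d - 1ℤ) (trans (δ-sym (t ⊗ t) 𝟙) (cong (λ o → δ o (t ⊗ t)) (sym (⊗-identityˡ 𝟙)))) ⟩
      + p * δ (𝟙 ⊗ 𝟙) (t ⊗ t) - 1ℤ  ∎)
      where
      open Solver

    -- The origin of 2 p: t = 1 and t = -1 give p each, and the constant -1 disappears with ∑χ = 0.
    ∑χ*∑g : ∑ (λ t → χ t * ∑ (g t)) ≡ + 2 * + p
    ∑χ*∑g = begin
      ∑ (λ t → χ t * ∑ (g t))
        ≡⟨ sum-cong-≗ (λ t → trans (χ*∑g t) (distrib (χ t) (+ p) (δ (𝟙 ⊗ 𝟙) (t ⊗ t)))) ⟩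
      ∑ (λ t → + p * (χ t * δ (𝟙 ⊗ 𝟙) (t ⊗ t)) - χ t)
        ≡⟨ Σ-distrib-- (λ t → + p * (χ t * δ (𝟙 ⊗ 𝟙) (t ⊗ t))) χ ⟩
      ∑ (λ t → + p * (χ t * δ (𝟙 ⊗ 𝟙) (t ⊗ t))) - ∑ χ
        ≡⟨ cong₂ _-_ (trans (sym (*-distribˡ-sum (+ p) (λ t → χ t * δ (𝟙 ⊗ 𝟙) (t ⊗ t)))) (cong (+ p *_) ∑χδ-roots-of-1)) ∑χ ⟩
      + p * + 2 - 0ℤ
        ≡⟨ flip (+ p) ⟩
      + 2 * + p  ∎
      where
      distrib : ∀ a b c → a * (b * c - 1ℤ) ≡ b * (a * c) - a
      distrib = solve-∀
      flip : ∀ a → a * + 2 - 0ℤ ≡ + 2 * a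
      flip = solve-∀

    -- Put y = t x, then u = x².
    φ²-expansion : φ 𝟙 * φ 𝟙 ≡ ∑ (λ t → χ t * (∑ (λ u → χ u * g t u) + (∑ (g t) - 1ℤ)))
    φ²-expansion = begin
      φ 𝟙 * φ 𝟙
        ≡⟨ *-distribʳ-sum (φ 𝟙) (λ x → χ x * χ (x ⊗ x ⊕ 𝟙)) ⟩
      ∑ (λ x → χ x * χ (x ⊗ x ⊕ 𝟙) * φ 𝟙)
        ≡⟨ sum-cong-≗ (λ x → trans (swap₂₃ (χ x) (χ (x ⊗ x ⊕ 𝟙)) (φ 𝟙)) (cong (_* χ (x ⊗ x ⊕ 𝟙)) (sym (χ*∑-scale x (λ y → χ y * χ (y ⊗ y ⊕ 𝟙)))))) ⟩
      ∑ (λ x → χ x * ∑ (λ t → χ (x ⊗ t) * χ (x ⊗ t ⊗ (x ⊗ t) ⊕ 𝟙)) * χ (x ⊗ x ⊕ 𝟙))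
        ≡⟨ sum-cong-≗ (λ x → trans (swap₂₃ (χ x) _ (χ (x ⊗ x ⊕ 𝟙))) (*-distribˡ-sum (χ x * χ (x ⊗ x ⊕ 𝟙)) (λ t → χ (x ⊗ t) * χ (x ⊗ t ⊗ (x ⊗ t) ⊕ 𝟙)))) ⟩
      ∑ (λ x → ∑ (λ t → χ x * χ (x ⊗ x ⊕ 𝟙) * (χ (x ⊗ t) * χ (x ⊗ t ⊗ (x ⊗ t) ⊕ 𝟙))))
        ≡⟨ ∑-comm (λ x t → χ x * χ (x ⊗ x ⊕ 𝟙) * (χ (x ⊗ t) * χ (x ⊗ t ⊗ (x ⊗ t) ⊕ 𝟙))) ⟩
      ∑ (λ t → ∑ (λ x → χ x * χ (x ⊗ x ⊕ 𝟙) * (χ (x ⊗ t) * χ (x ⊗ t ⊗ (x ⊗ t) ⊕ 𝟙))))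
        ≡⟨ sum-cong-≗ (λ t → trans (sum-cong-≗ (term t)) (sym (*-distribˡ-sum (χ t) (λ x → χ (x ⊗ x) * g t (x ⊗ x))))) ⟩
      ∑ (λ t → χ t * ∑ (λ x → χ (x ⊗ x) * g t (x ⊗ x)))
        -- Of the two sums from `∑-squares` the second carries χ u twice. That square is 1 except at
        -- u = 0, where the term `g t 𝟘`, equal to 1, is lost.
        ≡⟨ sum-cong-≗ (λ t → cong (χ t *_) (trans (∑-squares (λ u → χ u * g t u)) (cong (_+_ (∑ (λ u → χ u * g t u))) (drop-𝟘 t)))) ⟩
      ∑ (λ t → χ t * (∑ (λ u → χ u * g t u) + (∑ (g t) - 1ℤ)))  ∎
      where
      open Solver
      swap₂₃ : ∀ a b c → a * b * c ≡ a * c * b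
      swap₂₃ = solve-∀
      regroup : ∀ a b c d → a * b * (a * c * d) ≡ c * (a * a * (b * d))
      regroup = solve-∀
      term : ∀ t x → χ x * χ (x ⊗ x ⊕ 𝟙) * (χ (x ⊗ t) * χ (x ⊗ t ⊗ (x ⊗ t) ⊕ 𝟙)) ≡ χ t * (χ (x ⊗ x) * g t (x ⊗ x))
      term t x = begin
        χ x * χ (x ⊗ x ⊕ 𝟙) * (χ (x ⊗ t) * χ (x ⊗ t ⊗ (x ⊗ t) ⊕ 𝟙))
          ≡⟨ cong₂ (λ a z → χ x * χ (x ⊗ x ⊕ 𝟙) * (a * χ z)) (χ-⊗ x t) (solve 2 (λ x t → x :* t :* (x :* t) :+ con 1ℤ := t :* t :* (x :* x) :+ con 1ℤ) refl x t) ⟩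
        χ x * χ (x ⊗ x ⊕ 𝟙) * (χ x * χ t * χ (t ⊗ t ⊗ (x ⊗ x) ⊕ 𝟙))
          ≡⟨ regroup (χ x) (χ (x ⊗ x ⊕ 𝟙)) (χ t) (χ (t ⊗ t ⊗ (x ⊗ x) ⊕ 𝟙)) ⟩
        χ t * (χ x * χ x * g t (x ⊗ x))
          ≡⟨ cong (λ a → χ t * (a * g t (x ⊗ x))) (χ-⊗ x x) ⟨
        χ t * (χ (x ⊗ x) * g t (x ⊗ x)) ∎
      g-𝟘 : ∀ t → g t 𝟘 ≡ 1ℤ
      g-𝟘 t = cong₂ _*_ (trans (cong χ (⊕-identityˡ 𝟙)) χ-𝟙) (trans (cong χ (solve 1 (λ t → t :* t :* con 0ℤ :+ con 1ℤ := con 1ℤ) refl t)) χ-𝟙)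
      distrib : ∀ d b → (1ℤ - d) * b ≡ b - d * b
      distrib = solve-∀
      drop-𝟘 : ∀ t → ∑ (λ u → χ u * (χ u * g t u)) ≡ ∑ (g t) - 1ℤ
      drop-𝟘 t = begin
        ∑ (λ u → χ u * (χ u * g t u))
          ≡⟨ sum-cong-≗ (λ u → trans (sym (ℤ.*-assoc (χ u) (χ u) (g t u))) (trans (cong (_* g t u) (χ² u)) (distrib (δ 𝟘 u) (g t u)))) ⟩
        ∑ (λ u → g t u - δ 𝟘 u * g t u)
          ≡⟨ Σ-distrib-- (g t) (λ u → δ 𝟘 u * g t u) ⟩
        ∑ (g t) - ∑ (λ u → δ 𝟘 u * g t u)
          ≡⟨ cong (_-_ (∑ (g t))) (trans (Σ-δ 𝟘 (g t)) (g-𝟘 t)) ⟩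
        ∑ (g t) - 1ℤ  ∎

    -- With x = t u, (x + t) (t x + 1) becomes t (u + 1) (t² u + 1), and the three factors χ t
    -- collapse to one by `χ³`.
    ∑χ*∑χg : ∑ (λ t → χ t * ∑ (λ u → χ u * g t u)) ≡ ρ²-sum
    ∑χ*∑χg = trans (sum-cong-≗ term) (sym ρ²-sum≡)
      where
      open Solver
      regroup : ∀ a b c d → a * (a * b * (a * c * d)) ≡ a * a * a * (b * (c * d))
      regroup = solve-∀
      h : Fin p → Fin p → ℤ
      h t x = χ x * χ ((x ⊕ t) ⊗ (t ⊗ x ⊕ 𝟙))
      substituted : ∀ t u → χ t * h t (t ⊗ u) ≡ χ t * (χ u * g t u)
      substituted t u = begin
        χ t * (χ (t ⊗ u) * χ ((t ⊗ u ⊕ t) ⊗ (t ⊗ (t ⊗ u) ⊕ 𝟙)))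
          ≡⟨ cong (λ z → χ t * (χ (t ⊗ u) * χ z)) (solve 2 (λ t u → (t :* u :+ t) :* (t :* (t :* u) :+ con 1ℤ) := t :* (u :+ con 1ℤ) :* (t :* t :* u :+ con 1ℤ)) refl t u) ⟩
        χ t * (χ (t ⊗ u) * χ (t ⊗ (u ⊕ 𝟙) ⊗ (t ⊗ t ⊗ u ⊕ 𝟙)))
          ≡⟨ cong₂ (λ a b → χ t * (a * b)) (χ-⊗ t u) (trans (χ-⊗ (t ⊗ (u ⊕ 𝟙)) (t ⊗ t ⊗ u ⊕ 𝟙)) (cong (_* χ (t ⊗ t ⊗ u ⊕ 𝟙)) (χ-⊗ t (u ⊕ 𝟙)))) ⟩
        χ t * (χ t * χ u * (χ t * χ (u ⊕ 𝟙) * χ (t ⊗ t ⊗ u ⊕ 𝟙)))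
          ≡⟨ regroup (χ t) (χ u) (χ (u ⊕ 𝟙)) (χ (t ⊗ t ⊗ u ⊕ 𝟙)) ⟩
        χ t * χ t * χ t * (χ u * g t u)
          ≡⟨ cong (_* (χ u * g t u)) (χ³ t) ⟩
        χ t * (χ u * g t u) ∎
      term : ∀ t → χ t * ∑ (λ u → χ u * g t u) ≡ χ t * ∑ (h t)
      term t = begin
        χ t * ∑ (λ u → χ u * g t u)        ≡⟨ *-distribˡ-sum (χ t) (λ u → χ u * g t u) ⟩
        ∑ (λ u → χ t * (χ u * g t u))      ≡⟨ sum-cong-≗ (substituted t) ⟨
        ∑ (λ u → χ t * h t (t ⊗ u))        ≡⟨ *-distribˡ-sum (χ t) (λ u → h t (t ⊗ u)) ⟨
        χ t * ∑ (λ u → h t (t ⊗ u))        ≡⟨ χ*∑-scale t (h t) ⟩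
        χ t * ∑ (h t)                      ∎

    φ² : φ 𝟙 * φ 𝟙 ≡ E + + 2 * + p
    φ² = begin
      φ 𝟙 * φ 𝟙
        ≡⟨ φ²-expansion ⟩
      ∑ (λ t → χ t * (∑ (λ u → χ u * g t u) + (∑ (g t) - 1ℤ)))
        ≡⟨ sum-cong-≗ (λ t → distrib (χ t) (∑ (λ u → χ u * g t u)) (∑ (g t))) ⟩
      ∑ (λ t → χ t * ∑ (λ u → χ u * g t u) + χ t * ∑ (g t) - χ t)
        ≡⟨ Σ-distrib-- (λ t → χ t * ∑ (λ u → χ u * g t u) + χ t * ∑ (g t)) χ ⟩
      ∑ (λ t → χ t * ∑ (λ u → χ u * g t u) + χ t * ∑ (g t)) - ∑ χ
        ≡⟨ cong₂ _-_ (∑-distrib-+ (λ t → χ t * ∑ (λ u → χ u * g t u)) (λ t → χ t * ∑ (g t))) ∑χ ⟩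
      ∑ (λ t → χ t * ∑ (λ u → χ u * g t u)) + ∑ (λ t → χ t * ∑ (g t)) - 0ℤ
        ≡⟨ ℤ.+-identityʳ (∑ (λ t → χ t * ∑ (λ u → χ u * g t u)) + ∑ (λ t → χ t * ∑ (g t))) ⟩
      ∑ (λ t → χ t * ∑ (λ u → χ u * g t u)) + ∑ (λ t → χ t * ∑ (g t))
        ≡⟨ cong₂ _+_ (trans ∑χ*∑χg ρ²-sum≡E) ∑χ*∑g ⟩
      E + + 2 * + p  ∎
      where
      distrib : ∀ a b c → a * (b + (c - 1ℤ)) ≡ a * b + a * c - a
      distrib = solve-∀


  -- The indicator of the non-zero squares and the parity of φ / 2

  UnitSquare : Fin p → Set
  UnitSquare x = ∃ λ a → a ≢ 𝟘 × x ≡ a ⊗ a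

  unitSquare? : ∀ x → Dec (UnitSquare x)
  unitSquare? x = Fin.any? λ a → ¬? (a Fin.≟ 𝟘) ×-dec (x Fin.≟ a ⊗ a)

  s : Fin p → ℤ
  s x = ι (unitSquare? x)

  2*s : ∀ x → + 2 * s x ≡ 1ℤ - δ 𝟘 x + χ x
  2*s x with quadratic x
  ... | isZero          = trans (cong (+ 2 *_) (ι-no (unitSquare? 𝟘) λ { (a , a≢𝟘 , eq) → ⊗-nonzero a≢𝟘 a≢𝟘 (sym eq) }))
                                (sym (cong₂ (λ d c → 1ℤ - d + c) (δ-refl 𝟘) χ-𝟘))
  ... | square {a} a≢𝟘  = trans (cong (+ 2 *_) (ι-yes (unitSquare? (a ⊗ a)) (a , a≢𝟘 , refl)))
                                (sym (cong₂ (λ d c → 1ℤ - d + c) (δ-≢ (⊗-nonzero a≢𝟘 a≢𝟘 ∘ sym)) (χ-square a≢𝟘)))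
  ... | nonSquare x≢□   = trans (cong (+ 2 *_) (ι-no (unitSquare? x) λ { (a , _ , eq) → x≢□ a eq }))
                                (sym (cong₂ (λ d c → 1ℤ - d + c) (δ-≢ (λ 𝟘≡x → x≢□ 𝟘 (trans (sym 𝟘≡x) (sym (zero-⊗ 𝟘))))) (χ-nonSquare x≢□)))

  2*∑s∘ : ∀ (d : Fin p → Fin p) → + 2 * ∑ (s ∘ d) ≡ + p - ∑ (λ u → δ 𝟘 (d u)) + ∑ (χ ∘ d)
  2*∑s∘ d = begin
    + 2 * ∑ (s ∘ d)                                       ≡⟨ *-distribˡ-sum (+ 2) (s ∘ d) ⟩
    ∑ (λ u → + 2 * s (d u))                               ≡⟨ sum-cong-≗ (λ u → 2*s (d u)) ⟩
    ∑ (λ u → 1ℤ - δ 𝟘 (d u) + χ (d u))                    ≡⟨ ∑-distrib-+ (λ u → 1ℤ - δ 𝟘 (d u)) (χ ∘ d) ⟩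
    ∑ (λ u → 1ℤ - δ 𝟘 (d u)) + ∑ (χ ∘ d)                  ≡⟨ cong (_+ ∑ (χ ∘ d)) (Σ-distrib-- (λ _ → 1ℤ) (λ u → δ 𝟘 (d u))) ⟩
    ∑ (λ _ → 1ℤ) - ∑ (λ u → δ 𝟘 (d u)) + ∑ (χ ∘ d)        ≡⟨ cong (λ n → n - ∑ (λ u → δ 𝟘 (d u)) + ∑ (χ ∘ d)) ∑-1 ⟩
    + p - ∑ (λ u → δ 𝟘 (d u)) + ∑ (χ ∘ d)                 ∎

  2*∑s : + 2 * ∑ s ≡ + p - 1ℤ
  2*∑s = begin
    + 2 * ∑ s                     ≡⟨ 2*∑s∘ (λ u → u) ⟩
    + p - ∑ (δ 𝟘) + ∑ χ           ≡⟨ cong₂ (λ a b → + p - a + b) (Σ-δ₁ 𝟘) ∑χ ⟩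
    + p - 1ℤ + 0ℤ                 ≡⟨ ℤ.+-identityʳ (+ p - 1ℤ) ⟩
    + p - 1ℤ                      ∎

  module _ where
    private
      disc : Fin p → Fin p
      disc u = u ⊗ u ⊖ # (+ 4)

    δ𝟘-disc : ∀ u → δ 𝟘 (disc u) ≡ δ (# (+ 2)) u + δ (⊝ # (+ 2)) u
    δ𝟘-disc u = trans (δ-⇔ (λ eq → trans 2²≡4 (sym (⊖≡𝟘⇒≡ (sym eq)))) (λ eq → sym (≡⇒⊖≡𝟘 (trans (sym eq) 2²≡4)))) (δ-square 2≢𝟘 u)
      where
      open Solver
      2²≡4 : # (+ 2) ⊗ # (+ 2) ≡ # (+ 4)
      2²≡4 = solve 0 (con (+ 2) :* con (+ 2) := con (+ 4)) refl

    ∑δ𝟘-disc : ∀ (f : Fin p → ℤ) → ∑ (λ u → δ 𝟘 (disc u) * f u) ≡ f (# (+ 2)) + f (⊝ # (+ 2))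
    ∑δ𝟘-disc f = begin
      ∑ (λ u → δ 𝟘 (disc u) * f u)
        ≡⟨ sum-cong-≗ (λ u → trans (cong (_* f u) (δ𝟘-disc u)) (ℤ.*-distribʳ-+ (f u) (δ (# (+ 2)) u) (δ (⊝ # (+ 2)) u))) ⟩
      ∑ (λ u → δ (# (+ 2)) u * f u + δ (⊝ # (+ 2)) u * f u)
        ≡⟨ ∑-distrib-+ (λ u → δ (# (+ 2)) u * f u) (λ u → δ (⊝ # (+ 2)) u * f u) ⟩
      ∑ (λ u → δ (# (+ 2)) u * f u) + ∑ (λ u → δ (⊝ # (+ 2)) u * f u)
        ≡⟨ cong₂ _+_ (Σ-δ (# (+ 2)) f) (Σ-δ (⊝ # (+ 2)) f) ⟩
      f (# (+ 2)) + f (⊝ # (+ 2))  ∎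

    -- For x ≠ 0, χ (x (x² + 1)) = χ (x + 1/x), so φ can be collected by the values of x + 1/x.
    ∑ρχ≡φ : ∑ (λ u → ρ u * χ u) ≡ φ 𝟙
    ∑ρχ≡φ = begin
      ∑ (λ u → ρ u * χ u)
        ≡⟨ sum-cong-≗ (λ u → cong (λ z → ρ u * χ z) (solve 1 (λ u → u := con 1ℤ :* u :+ con 0ℤ) refl u)) ⟩
      ∑ (λ u → ρ u * χ (𝟙 ⊗ u ⊕ 𝟘))
        ≡⟨ ∑ρχ 𝟙 𝟘 ⟩
      ∑ (λ t → χ t * χ (𝟙 ⊗ (t ⊗ t ⊕ 𝟙) ⊕ 𝟘 ⊗ t))
        ≡⟨ sum-cong-≗ (λ t → cong (λ z → χ t * χ z) (solve 1 (λ t → con 1ℤ :* (t :* t :+ con 1ℤ) :+ con 0ℤ :* t := t :* t :+ con 1ℤ) refl t)) ⟩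
      φ 𝟙 ∎
      where open Solver

    -- ρ u is 2 where u² - 4 is a non-zero square, 1 at u = 2 and u = -2, and 0 elsewhere; the two
    -- single values contribute the same χ 2.
    φ-halved : φ 𝟙 ≡ + 2 * (χ (# (+ 2)) + ∑ (λ u → s (disc u) * χ u))
    φ-halved = begin
      φ 𝟙
        ≡⟨ ∑ρχ≡φ ⟨
      ∑ (λ u → ρ u * χ u)
        ≡⟨ sum-cong-≗ term ⟩
      ∑ (λ u → δ 𝟘 (disc u) * χ u + + 2 * (s (disc u) * χ u))
        ≡⟨ ∑-distrib-+ (λ u → δ 𝟘 (disc u) * χ u) (λ u → + 2 * (s (disc u) * χ u)) ⟩
      ∑ (λ u → δ 𝟘 (disc u) * χ u) + ∑ (λ u → + 2 * (s (disc u) * χ u))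
        ≡⟨ cong₂ _+_ (trans (∑δ𝟘-disc χ) (cong (_+_ (χ (# (+ 2)))) (χ-⊝ (# (+ 2))))) (sym (*-distribˡ-sum (+ 2) (λ u → s (disc u) * χ u))) ⟩
      χ (# (+ 2)) + χ (# (+ 2)) + + 2 * ∑ (λ u → s (disc u) * χ u)
        ≡⟨ collect (χ (# (+ 2))) (∑ (λ u → s (disc u) * χ u)) ⟩
      + 2 * (χ (# (+ 2)) + ∑ (λ u → s (disc u) * χ u))  ∎
      where
      collect : ∀ a b → a + a + + 2 * b ≡ + 2 * (a + b)
      collect = solve-∀
      insert : ∀ d c → 1ℤ + c ≡ d + (1ℤ - d + c)
      insert = solve-∀
      distrib : ∀ d s c → (d + + 2 * s) * c ≡ d * c + + 2 * (s * c)
      distrib = solve-∀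
      term : ∀ u → ρ u * χ u ≡ δ 𝟘 (disc u) * χ u + + 2 * (s (disc u) * χ u)
      term u = begin
        ρ u * χ u
          ≡⟨ cong (_* χ u) (trans (ρ-discriminant u) (trans (insert (δ 𝟘 (disc u)) (χ (disc u))) (cong (_+_ (δ 𝟘 (disc u))) (sym (2*s (disc u)))))) ⟩
        (δ 𝟘 (disc u) + + 2 * s (disc u)) * χ u
          ≡⟨ distrib (δ 𝟘 (disc u)) (s (disc u)) (χ u) ⟩
        δ 𝟘 (disc u) * χ u + + 2 * (s (disc u) * χ u)  ∎

    -- The loss of 3 comes from the two zeros of u² - 4 and from ∑ χ (u² - 4) = -1.
    2*∑s∘disc : + 2 * ∑ (s ∘ disc) ≡ + p - + 3
    2*∑s∘disc = begin
      + 2 * ∑ (s ∘ disc)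
        ≡⟨ 2*∑s∘ disc ⟩
      + p - ∑ (λ u → δ 𝟘 (disc u)) + ∑ (χ ∘ disc)
        ≡⟨ cong₂ (λ a b → + p - a + b) (trans (sum-cong-≗ λ u → sym (ℤ.*-identityʳ (δ 𝟘 (disc u)))) (∑δ𝟘-disc (λ _ → 1ℤ)))
             (trans (∑χ-square-shift (⊝ # (+ 4))) (cong (λ d → + p * d - 1ℤ) (δ-≢ (⊝-nonzero 4≢𝟘 ∘ sym)))) ⟩
      + p - (1ℤ + 1ℤ) + (+ p * 0ℤ - 1ℤ)
        ≡⟨ simplify (+ p) ⟩
      + p - + 3  ∎
      where
      simplify : ∀ a → a - (1ℤ + 1ℤ) + (a * 0ℤ - 1ℤ) ≡ a - + 3
      simplify = solve-∀

    s-disc-𝟘 : s (disc 𝟘) ≡ 1ℤ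
    s-disc-𝟘 = ι-yes (unitSquare? (disc 𝟘)) (# (+ 2) ⊗ i , ⊗-nonzero 2≢𝟘 i≢𝟘 , (begin
      𝟘 ⊗ 𝟘 ⊖ # (+ 4)                  ≡⟨ solve 0 (con 0ℤ :* con 0ℤ :- con (+ 4) := con (+ 4) :* :- con 1ℤ) refl ⟩
      # (+ 4) ⊗ ⊝ 𝟙                    ≡⟨ cong (# (+ 4) ⊗_) (proj₂ √-1) ⟨
      # (+ 4) ⊗ (i ⊗ i)                ≡⟨ solve 1 (λ i → con (+ 4) :* (i :* i) := con (+ 2) :* i :* (con (+ 2) :* i)) refl i ⟩
      # (+ 2) ⊗ i ⊗ (# (+ 2) ⊗ i)      ∎))
      where
      open Solver
      i = proj₁ √-1

    -- Modulo 2, χ u may be replaced by 1 for u ≢ 𝟘.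
    φ-half-odd : ∀ m → + p ≡ 1ℤ + + 4 * m → ∃ λ k → φ 𝟙 ≡ + 2 * (+ 2 * k + 1ℤ)
    φ-half-odd m p≡1+4m = s₂ + m - + 2 - M , trans φ-halved (cong (+ 2 *_) (begin
      χ (# (+ 2)) + ∑ (λ u → s (disc u) * χ u)
        ≡⟨ cong₂ _+_ χ2 (begin
           ∑ (λ u → s (disc u) * χ u)                                       ≡⟨ sum-cong-≗ term ⟩
           ∑ (λ u → s (disc u) - δ 𝟘 u * s (disc u) - + 2 * (s (disc u) * n u))   ≡⟨ Σ-distrib-- (λ u → s (disc u) - δ 𝟘 u * s (disc u)) (λ u → + 2 * (s (disc u) * n u)) ⟩
           ∑ (λ u → s (disc u) - δ 𝟘 u * s (disc u)) - ∑ (λ u → + 2 * (s (disc u) * n u))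
             ≡⟨ cong₂ _-_ (Σ-distrib-- (s ∘ disc) (λ u → δ 𝟘 u * s (disc u))) (sym (*-distribˡ-sum (+ 2) (λ u → s (disc u) * n u))) ⟩
           ∑ (s ∘ disc) - ∑ (λ u → δ 𝟘 u * s (disc u)) - + 2 * M
             -- u² - 4 is a non-zero square for 2 m - 1 values of u. One of them is u = 0, so an
             -- even number of signs remains, and χ 2 makes the total odd.
             ≡⟨ cong₂ (λ a b → a - b - + 2 * M) ∑s∘disc (trans (Σ-δ 𝟘 (s ∘ disc)) s-disc-𝟘) ⟩
           (+ 2 * m - 1ℤ) - 1ℤ - + 2 * M ∎) ⟩
      + 2 * s₂ - 1ℤ + ((+ 2 * m - 1ℤ) - 1ℤ - + 2 * M)
        ≡⟨ arrange s₂ m M ⟩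
      + 2 * (s₂ + m - + 2 - M) + 1ℤ  ∎))
      where
      s₂ = s (# (+ 2))
      -- The indicator of the non-squares, so that χ u = 1 - δ 𝟘 u - 2 n u.
      n : Fin p → ℤ
      n u = 1ℤ - δ 𝟘 u - s u
      M = ∑ (λ u → s (disc u) * n u)
      arrange : ∀ a m M → + 2 * a - 1ℤ + ((+ 2 * m - 1ℤ) - 1ℤ - + 2 * M) ≡ + 2 * (a + m - + 2 - M) + 1ℤ
      arrange = solve-∀
      isolate : ∀ d c → c ≡ 1ℤ - d + c - 1ℤ + d
      isolate = solve-∀
      expand : ∀ t d s → t * (+ 2 * s - 1ℤ + d) ≡ t - d * t - + 2 * (t * (1ℤ - d - s))
      expand = solve-∀
      χ-s : ∀ u → χ u ≡ + 2 * s u - 1ℤ + δ 𝟘 u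
      χ-s u = trans (isolate (δ 𝟘 u) (χ u)) (cong (λ z → z - 1ℤ + δ 𝟘 u) (sym (2*s u)))
      term : ∀ u → s (disc u) * χ u ≡ s (disc u) - δ 𝟘 u * s (disc u) - + 2 * (s (disc u) * n u)
      term u = trans (cong (s (disc u) *_) (χ-s u)) (expand (s (disc u)) (δ 𝟘 u) (s u))
      χ2 : χ (# (+ 2)) ≡ + 2 * s₂ - 1ℤ
      χ2 = trans (χ-s (# (+ 2))) (trans (cong (_+_ (+ 2 * s₂ - 1ℤ)) (δ-≢ (2≢𝟘 ∘ sym))) (ℤ.+-identityʳ (+ 2 * s₂ - 1ℤ)))
      p-3 : ∀ m → 1ℤ + + 4 * m - + 3 ≡ + 2 * (+ 2 * m - 1ℤ)
      p-3 = solve-∀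
      ∑s∘disc : ∑ (s ∘ disc) ≡ + 2 * m - 1ℤ
      ∑s∘disc = ℤ.*-cancelˡ-≡ (+ 2) (∑ (s ∘ disc)) (+ 2 * m - 1ℤ) (trans 2*∑s∘disc (trans (cong (_- + 3) p≡1+4m) (p-3 m)))

  -- Jacobsthal's theorem

  -- Replace x by t x. Consequently φ² takes at most one value on the non-zero squares and one on
  -- the non-squares. At t = 0 the left side is ∑χ³ = ∑χ = 0.
  φ-scale : ∀ t r → φ (t ⊗ t ⊗ r) ≡ χ t * φ r
  φ-scale t r with t Fin.≟ 𝟘
  ... | yes refl = begin
    ∑ (λ x → χ x * χ (x ⊗ x ⊕ 𝟘 ⊗ 𝟘 ⊗ r))
      ≡⟨ sum-cong-≗ (λ x → cong (χ x *_) (trans (cong χ (solve 2 (λ x r → x :* x :+ con 0ℤ :* con 0ℤ :* r := x :* x) refl x r)) (χ-⊗ x x))) ⟩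
    ∑ (λ x → χ x * (χ x * χ x))
      ≡⟨ sum-cong-≗ (λ x → trans (sym (ℤ.*-assoc (χ x) (χ x) (χ x))) (χ³ x)) ⟩
    ∑ χ
      ≡⟨ ∑χ ⟩
    0ℤ
      ≡⟨ trans (cong (_* φ r) χ-𝟘) (ℤ.*-zeroˡ (φ r)) ⟨
    χ 𝟘 * φ r ∎
    where open Solver
  ... | no t≢𝟘 = begin
    ∑ (λ x → χ x * χ (x ⊗ x ⊕ t ⊗ t ⊗ r))
      ≡⟨ ∑-scale t≢𝟘 (λ x → χ x * χ (x ⊗ x ⊕ t ⊗ t ⊗ r)) ⟨
    ∑ (λ x → χ (t ⊗ x) * χ (t ⊗ x ⊗ (t ⊗ x) ⊕ t ⊗ t ⊗ r))
      ≡⟨ sum-cong-≗ (λ x → cong₂ _*_ (χ-⊗ t x) (trans (cong χ (solve 3 (λ t x r → t :* x :* (t :* x) :+ t :* t :* r := t :* t :* (x :* x :+ r)) refl t x r)) (χ-square-⊗ t≢𝟘 (x ⊗ x ⊕ r)))) ⟩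
    ∑ (λ x → χ t * χ x * χ (x ⊗ x ⊕ r))
      ≡⟨ sum-cong-≗ (λ x → ℤ.*-assoc (χ t) (χ x) (χ (x ⊗ x ⊕ r))) ⟩
    ∑ (λ x → χ t * (χ x * χ (x ⊗ x ⊕ r)))
      ≡⟨ *-distribˡ-sum (χ t) (λ x → χ x * χ (x ⊗ x ⊕ r)) ⟨
    χ t * φ r  ∎
    where open Solver

  -- Summing over r first leaves p - 1 if x² = y² and -1 otherwise. The constant -1 disappears with
  -- ∑χ = 0, and for each x ≠ 0 the two roots y = x and y = -x give 2 p.
  ∑φ² : ∑ (λ r → φ r * φ r) ≡ + 2 * + p * (+ p - 1ℤ)
  ∑φ² = begin
    ∑ (λ r → φ r * φ r)
      ≡⟨ sum-cong-≗ (λ r → trans (Σ-*-Σ (λ x → χ x * χ (x ⊗ x ⊕ r)) (λ y → χ y * χ (y ⊗ y ⊕ r)))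
           (sum-cong-≗ λ x → sum-cong-≗ λ y → regroup (χ x) (χ (x ⊗ x ⊕ r)) (χ y) (χ (y ⊗ y ⊕ r)))) ⟩
    ∑ (λ r → ∑ (λ x → ∑ (λ y → χ x * χ y * (χ (x ⊗ x ⊕ r) * χ (y ⊗ y ⊕ r)))))
      ≡⟨ ∑-comm (λ r x → ∑ (λ y → χ x * χ y * (χ (x ⊗ x ⊕ r) * χ (y ⊗ y ⊕ r)))) ⟩
    ∑ (λ x → ∑ (λ r → ∑ (λ y → χ x * χ y * (χ (x ⊗ x ⊕ r) * χ (y ⊗ y ⊕ r)))))
      ≡⟨ sum-cong-≗ (λ x → ∑-comm (λ r y → χ x * χ y * (χ (x ⊗ x ⊕ r) * χ (y ⊗ y ⊕ r)))) ⟩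
    ∑ (λ x → ∑ (λ y → ∑ (λ r → χ x * χ y * (χ (x ⊗ x ⊕ r) * χ (y ⊗ y ⊕ r)))))
      ≡⟨ sum-cong-≗ (λ x → sum-cong-≗ λ y → trans (sym (*-distribˡ-sum (χ x * χ y) (λ r → χ (x ⊗ x ⊕ r) * χ (y ⊗ y ⊕ r)))) (cong (χ x * χ y *_) (∑χχ⁺ (x ⊗ x) (y ⊗ y)))) ⟩
    ∑ (λ x → ∑ (λ y → χ x * χ y * (+ p * δ (x ⊗ x) (y ⊗ y) - 1ℤ)))
      ≡⟨ sum-cong-≗ (λ x → begin
           ∑ (λ y → χ x * χ y * (+ p * δ (x ⊗ x) (y ⊗ y) - 1ℤ))
             ≡⟨ sum-cong-≗ (λ y → distrib (χ x) (χ y) (+ p) (δ (x ⊗ x) (y ⊗ y))) ⟩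
           ∑ (λ y → + p * (χ x * (δ (x ⊗ x) (y ⊗ y) * χ y)) - χ x * χ y)
             ≡⟨ Σ-distrib-- (λ y → + p * (χ x * (δ (x ⊗ x) (y ⊗ y) * χ y))) (λ y → χ x * χ y) ⟩
           ∑ (λ y → + p * (χ x * (δ (x ⊗ x) (y ⊗ y) * χ y))) - ∑ (λ y → χ x * χ y)
             ≡⟨ cong₂ _-_ (trans (sym (*-distribˡ-sum (+ p) (λ y → χ x * (δ (x ⊗ x) (y ⊗ y) * χ y)))) (cong (+ p *_) (trans (sym (*-distribˡ-sum (χ x) (λ y → δ (x ⊗ x) (y ⊗ y) * χ y))) (roots x))))
                          (trans (sym (*-distribˡ-sum (χ x) χ)) (trans (cong (χ x *_) ∑χ) (ℤ.*-zeroʳ (χ x)))) ⟩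
           + p * (+ 2 * (χ x * χ x)) - 0ℤ
             ≡⟨ tidy (+ p) (χ x * χ x) ⟩
           + 2 * + p * (χ x * χ x) ∎) ⟩
    ∑ (λ x → + 2 * + p * (χ x * χ x))
      ≡⟨ *-distribˡ-sum (+ 2 * + p) (λ x → χ x * χ x) ⟨
    + 2 * + p * ∑ (λ x → χ x * χ x)
      ≡⟨ cong (+ 2 * + p *_) ∑χ² ⟩
    + 2 * + p * (+ p - 1ℤ)  ∎
    where
    regroup : ∀ a b c d → a * b * (c * d) ≡ a * c * (b * d)
    regroup = solve-∀
    distrib : ∀ a b c d → a * b * (c * d - 1ℤ) ≡ c * (a * (d * b)) - a * b
    distrib = solve-∀
    tidy : ∀ a b → a * (+ 2 * b) - 0ℤ ≡ + 2 * a * b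
    tidy = solve-∀
    double : ∀ a → a * (a + a) ≡ + 2 * (a * a)
    double = solve-∀
    roots : ∀ x → χ x * ∑ (λ y → δ (x ⊗ x) (y ⊗ y) * χ y) ≡ + 2 * (χ x * χ x)
    roots x with x Fin.≟ 𝟘
    ... | yes refl = trans (trans (cong (_* ∑ (λ y → δ (𝟘 ⊗ 𝟘) (y ⊗ y) * χ y)) χ-𝟘) (ℤ.*-zeroˡ (∑ (λ y → δ (𝟘 ⊗ 𝟘) (y ⊗ y) * χ y))))
                           (sym (cong (λ c → + 2 * (c * c)) χ-𝟘))
    ... | no x≢𝟘 = begin
      χ x * ∑ (λ y → δ (x ⊗ x) (y ⊗ y) * χ y)
        ≡⟨ cong (χ x *_) (sum-cong-≗ λ y → trans (cong (_* χ y) (δ-square x≢𝟘 y)) (ℤ.*-distribʳ-+ (χ y) (δ x y) (δ (⊝ x) y))) ⟩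
      χ x * ∑ (λ y → δ x y * χ y + δ (⊝ x) y * χ y)
        ≡⟨ cong (χ x *_) (∑-distrib-+ (λ y → δ x y * χ y) (λ y → δ (⊝ x) y * χ y)) ⟩
      χ x * (∑ (λ y → δ x y * χ y) + ∑ (λ y → δ (⊝ x) y * χ y))
        ≡⟨ cong (χ x *_) (cong₂ _+_ (Σ-δ x χ) (trans (Σ-δ (⊝ x) χ) (χ-⊝ x))) ⟩
      χ x * (χ x + χ x)
        ≡⟨ double (χ x) ⟩
      + 2 * (χ x * χ x) ∎

  -- By `φ-scale` the square of φ at g t² is that at g for every t ≠ 0, and 0 for t = 0. Summing
  -- over t meets each r = g u exactly 1 + χ u times, where χ u = χ g χ r.
  φ²-coset : ∀ {g} → g ≢ 𝟘 → (+ p - 1ℤ) * (φ g * φ g) ≡ ∑ (λ r → φ r * φ r) + χ g * ∑ (λ r → χ r * (φ r * φ r))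
  φ²-coset {g} g≢𝟘 = begin
    (+ p - 1ℤ) * (φ g * φ g)
      ≡⟨ cong (_* (φ g * φ g)) ∑χ² ⟨
    ∑ (λ t → χ t * χ t) * (φ g * φ g)
      ≡⟨ *-distribʳ-sum (φ g * φ g) (λ t → χ t * χ t) ⟩
    ∑ (λ t → χ t * χ t * (φ g * φ g))
      ≡⟨ sum-cong-≗ (λ t → trans (regroup (χ t) (φ g)) (sym (cong (λ z → z * z) (trans (cong φ (⊗-comm g (t ⊗ t))) (φ-scale t g))))) ⟩
    ∑ (λ t → φ (g ⊗ (t ⊗ t)) * φ (g ⊗ (t ⊗ t)))
      ≡⟨ ∑-squares (λ u → φ (g ⊗ u) * φ (g ⊗ u)) ⟩
    ∑ (λ u → φ (g ⊗ u) * φ (g ⊗ u)) + ∑ (λ u → χ u * (φ (g ⊗ u) * φ (g ⊗ u)))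
      ≡⟨ cong₂ _+_ (∑-scale g≢𝟘 (λ r → φ r * φ r)) (begin
           ∑ (λ u → χ u * (φ (g ⊗ u) * φ (g ⊗ u)))
             ≡⟨ sum-cong-≗ (λ u → cong (_* (φ (g ⊗ u) * φ (g ⊗ u))) (χ-unscale u)) ⟩
           ∑ (λ u → χ g * χ (g ⊗ u) * (φ (g ⊗ u) * φ (g ⊗ u)))
             ≡⟨ ∑-scale g≢𝟘 (λ r → χ g * χ r * (φ r * φ r)) ⟩
           ∑ (λ r → χ g * χ r * (φ r * φ r))
             ≡⟨ sum-cong-≗ (λ r → ℤ.*-assoc (χ g) (χ r) (φ r * φ r)) ⟩
           ∑ (λ r → χ g * (χ r * (φ r * φ r)))
             ≡⟨ *-distribˡ-sum (χ g) (λ r → χ r * (φ r * φ r)) ⟨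
           χ g * ∑ (λ r → χ r * (φ r * φ r)) ∎) ⟩
    ∑ (λ r → φ r * φ r) + χ g * ∑ (λ r → χ r * (φ r * φ r))  ∎
    where
    regroup : ∀ a b → a * a * (b * b) ≡ a * b * (a * b)
    regroup = solve-∀
    χ-unscale : ∀ u → χ u ≡ χ g * χ (g ⊗ u)
    χ-unscale u = begin
      χ u                   ≡⟨ ℤ.*-identityˡ (χ u) ⟨
      1ℤ * χ u              ≡⟨ cong (_* χ u) (χ²-nonzero g≢𝟘) ⟨
      χ g * χ g * χ u       ≡⟨ ℤ.*-assoc (χ g) (χ g) (χ u) ⟩
      χ g * (χ g * χ u)     ≡⟨ cong (χ g *_) (χ-⊗ g u) ⟨
      χ g * χ (g ⊗ u)       ∎

  -- Otherwise χ² = χ everywhere, and p - 1 = ∑χ² = ∑χ = 0.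
  ∃-nonSquare : ∃ λ g → χ g ≡ -1ℤ
  ∃-nonSquare with Fin.any? (λ g → χ g ℤ.≟ -1ℤ)
  ... | yes g = g
  ... | no ¬g = contradiction (trans (sym ∑χ²) (trans (sum-cong-≗ same) ∑χ)) p-1≢0
    where
    same : ∀ x → χ x * χ x ≡ χ x
    same x with quadratic x
    ... | isZero        = trans (cong (λ c → c * c) χ-𝟘) (sym χ-𝟘)
    ... | square a≢𝟘    = trans (cong (λ c → c * c) (χ-square a≢𝟘)) (sym (χ-square a≢𝟘))
    ... | nonSquare x≢□ = contradiction (x , χ-nonSquare x≢□) ¬g

  -- Adding `φ²-coset` at 1 and at a non-square g cancels the twisted sums and leaves twice the sum
  -- of all φ². The witness ψ is φ at g.
  jacobsthal : ∃ λ ψ → φ 𝟙 * φ 𝟙 + ψ * ψ ≡ + 4 * + p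
  jacobsthal with ∃-nonSquare
  ... | g , χg≡-1 = φ g , ℤ.*-cancelˡ-≡ (+ p - 1ℤ) _ _ {{ℤ.≢-nonZero p-1≢0}} (begin
    (+ p - 1ℤ) * (φ 𝟙 * φ 𝟙 + φ g * φ g)
      ≡⟨ ℤ.*-distribˡ-+ (+ p - 1ℤ) (φ 𝟙 * φ 𝟙) (φ g * φ g) ⟩
    (+ p - 1ℤ) * (φ 𝟙 * φ 𝟙) + (+ p - 1ℤ) * (φ g * φ g)
      ≡⟨ cong₂ _+_ (φ²-coset 𝟙≢𝟘) (φ²-coset g≢𝟘) ⟩
    S + χ 𝟙 * U + (S + χ g * U)
      ≡⟨ cong₂ (λ a b → S + a * U + (S + b * U)) χ-𝟙 χg≡-1 ⟩
    S + 1ℤ * U + (S + -1ℤ * U)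
      ≡⟨ cancel S U ⟩
    + 2 * S
      ≡⟨ cong (+ 2 *_) ∑φ² ⟩
    + 2 * (+ 2 * + p * (+ p - 1ℤ))
      ≡⟨ arrange (+ p) ⟩
    (+ p - 1ℤ) * (+ 4 * + p)  ∎)
    where
    S = ∑ (λ r → φ r * φ r)
    U = ∑ (λ r → χ r * (φ r * φ r))
    g≢𝟘 : g ≢ 𝟘
    g≢𝟘 refl = contradiction (trans (sym χ-𝟘) χg≡-1) (λ ())
    cancel : ∀ s x → s + 1ℤ * x + (s + -1ℤ * x) ≡ + 2 * s
    cancel = solve-∀
    arrange : ∀ a → + 2 * (+ 2 * a * (a - 1ℤ)) ≡ (a - 1ℤ) * (+ 4 * a)
    arrange = solve-∀


  -- Edges among the common neighbours of 0 and 1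

  -- Agrees with 4 N away from 0 and 1, where it is 2 while `N` is 0. Without deltas it expands into
  -- four character sums.
  B : Fin p → ℤ
  B x = (1ℤ + χ x) * (1ℤ + χ (𝟙 ⊖ x))

  ∑B : ∀ (g : Fin p → ℤ) → ∑ (λ x → B x * g x) ≡ ∑ g + ∑ (λ x → χ x * g x) + ∑ (λ x → χ (𝟙 ⊖ x) * g x) + ∑ (λ x → χ x * χ (𝟙 ⊖ x) * g x)
  ∑B g = begin
    ∑ (λ x → B x * g x)
      ≡⟨ sum-cong-≗ (λ x → expand (χ x) (χ (𝟙 ⊖ x)) (g x)) ⟩
    ∑ (λ x → g x + χ x * g x + χ (𝟙 ⊖ x) * g x + χ x * χ (𝟙 ⊖ x) * g x)
      ≡⟨ ∑-distrib-+ (λ x → g x + χ x * g x + χ (𝟙 ⊖ x) * g x) (λ x → χ x * χ (𝟙 ⊖ x) * g x) ⟩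
    ∑ (λ x → g x + χ x * g x + χ (𝟙 ⊖ x) * g x) + ∑ (λ x → χ x * χ (𝟙 ⊖ x) * g x)
      ≡⟨ cong (_+ ∑ (λ x → χ x * χ (𝟙 ⊖ x) * g x)) (∑-distrib-+ (λ x → g x + χ x * g x) (λ x → χ (𝟙 ⊖ x) * g x)) ⟩
    ∑ (λ x → g x + χ x * g x) + ∑ (λ x → χ (𝟙 ⊖ x) * g x) + ∑ (λ x → χ x * χ (𝟙 ⊖ x) * g x)
      ≡⟨ cong (λ z → z + ∑ (λ x → χ (𝟙 ⊖ x) * g x) + ∑ (λ x → χ x * χ (𝟙 ⊖ x) * g x)) (∑-distrib-+ g (λ x → χ x * g x)) ⟩
    ∑ g + ∑ (λ x → χ x * g x) + ∑ (λ x → χ (𝟙 ⊖ x) * g x) + ∑ (λ x → χ x * χ (𝟙 ⊖ x) * g x)  ∎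
    where
    expand : ∀ a b c → (1ℤ + a) * (1ℤ + b) * c ≡ c + a * c + b * c + a * b * c
    expand = solve-∀

  B-reflect : ∀ x → B (𝟙 ⊖ x) ≡ B x
  B-reflect x = trans (cong (λ z → (1ℤ + χ (𝟙 ⊖ x)) * (1ℤ + χ z)) (solve 1 (λ x → con 1ℤ :- (con 1ℤ :- x) := x) refl x)) (ℤ.*-comm (1ℤ + χ (𝟙 ⊖ x)) (1ℤ + χ x))
    where open Solver

  χ-𝟙⊖𝟘 : χ (𝟙 ⊖ 𝟘) ≡ 1ℤ
  χ-𝟙⊖𝟘 = trans (cong χ (solve 0 (con 1ℤ :- con 0ℤ := con 1ℤ) refl)) χ-𝟙
    where open Solver

  χ-𝟙⊖𝟙 : χ (𝟙 ⊖ 𝟙) ≡ 0ℤ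
  χ-𝟙⊖𝟙 = trans (cong χ (⊖-self 𝟙)) χ-𝟘

  B-𝟘 : B 𝟘 ≡ + 2
  B-𝟘 = cong₂ (λ a b → (1ℤ + a) * (1ℤ + b)) χ-𝟘 χ-𝟙⊖𝟘

  B-𝟙 : B 𝟙 ≡ + 2
  B-𝟙 = cong₂ (λ a b → (1ℤ + a) * (1ℤ + b)) χ-𝟙 χ-𝟙⊖𝟙

  ∑χχ𝟙 : ∑ (λ x → χ x * χ (𝟙 ⊖ x)) ≡ -1ℤ
  ∑χχ𝟙 = trans (∑χχ₀ 𝟙) (trans (cong (λ d → + p * d - 1ℤ) (δ-≢ (𝟙≢𝟘 ∘ sym))) (cong (_- 1ℤ) (ℤ.*-zeroʳ (+ p))))

  ∑B·1 : ∑ B ≡ + p - 1ℤ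
  ∑B·1 = begin
    ∑ B
      ≡⟨ sum-cong-≗ (λ x → sym (ℤ.*-identityʳ (B x))) ⟩
    ∑ (λ x → B x * 1ℤ)
      ≡⟨ ∑B (λ _ → 1ℤ) ⟩
    ∑ (λ _ → 1ℤ) + ∑ (λ x → χ x * 1ℤ) + ∑ (λ x → χ (𝟙 ⊖ x) * 1ℤ) + ∑ (λ x → χ x * χ (𝟙 ⊖ x) * 1ℤ)
      ≡⟨ cong₂ _+_ (cong₂ _+_ (cong₂ _+_ ∑-1 (trans (*1 χ) ∑χ)) (trans (*1 (λ x → χ (𝟙 ⊖ x))) (∑χ-reflect 𝟙))) (trans (*1 (λ x → χ x * χ (𝟙 ⊖ x))) ∑χχ𝟙) ⟩
    + p + 0ℤ + 0ℤ + -1ℤ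
      ≡⟨ tidy (+ p) ⟩
    + p - 1ℤ  ∎
    where
    *1 : ∀ f → ∑ (λ x → f x * 1ℤ) ≡ ∑ f
    *1 f = sum-cong-≗ (λ x → ℤ.*-identityʳ (f x))
    tidy : ∀ a → a + 0ℤ + 0ℤ + -1ℤ ≡ a - 1ℤ
    tidy = solve-∀

  ∑B·χ : ∑ (λ x → B x * χ x) ≡ + p - + 3
  ∑B·χ = begin
    ∑ (λ x → B x * χ x)
      ≡⟨ ∑B χ ⟩
    ∑ χ + ∑ (λ x → χ x * χ x) + ∑ (λ x → χ (𝟙 ⊖ x) * χ x) + ∑ (λ x → χ x * χ (𝟙 ⊖ x) * χ x)
      ≡⟨ cong₂ _+_ (cong₂ _+_ (cong₂ _+_ ∑χ ∑χ²) (trans (sum-cong-≗ λ x → ℤ.*-comm (χ (𝟙 ⊖ x)) (χ x)) ∑χχ𝟙)) ∑χχχ ⟩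
    0ℤ + (+ p - 1ℤ) + -1ℤ + -1ℤ
      ≡⟨ tidy (+ p) ⟩
    + p - + 3  ∎
    where
    tidy : ∀ a → 0ℤ + (a - 1ℤ) + -1ℤ + -1ℤ ≡ a - + 3
    tidy = solve-∀
    regroup : ∀ a b → a * b * a ≡ a * a * b
    regroup = solve-∀
    distrib : ∀ d b → (1ℤ - d) * b ≡ b - d * b
    distrib = solve-∀
    ∑χχχ : ∑ (λ x → χ x * χ (𝟙 ⊖ x) * χ x) ≡ -1ℤ
    ∑χχχ = begin
      ∑ (λ x → χ x * χ (𝟙 ⊖ x) * χ x)
        ≡⟨ sum-cong-≗ (λ x → trans (regroup (χ x) (χ (𝟙 ⊖ x))) (trans (cong (_* χ (𝟙 ⊖ x)) (χ² x)) (distrib (δ 𝟘 x) (χ (𝟙 ⊖ x))))) ⟩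
      ∑ (λ x → χ (𝟙 ⊖ x) - δ 𝟘 x * χ (𝟙 ⊖ x))
        ≡⟨ Σ-distrib-- (λ x → χ (𝟙 ⊖ x)) (λ x → δ 𝟘 x * χ (𝟙 ⊖ x)) ⟩
      ∑ (λ x → χ (𝟙 ⊖ x)) - ∑ (λ x → δ 𝟘 x * χ (𝟙 ⊖ x))
        ≡⟨ cong₂ _-_ (∑χ-reflect 𝟙) (trans (Σ-δ 𝟘 (λ x → χ (𝟙 ⊖ x))) χ-𝟙⊖𝟘) ⟩
      -1ℤ ∎

  ∑B·χ𝟙⊖ : ∑ (λ x → B x * χ (𝟙 ⊖ x)) ≡ + p - + 3
  ∑B·χ𝟙⊖ = begin
    ∑ (λ x → B x * χ (𝟙 ⊖ x))         ≡⟨ sum-cong-≗ (λ x → cong (_* χ (𝟙 ⊖ x)) (B-reflect x)) ⟨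
    ∑ (λ x → B (𝟙 ⊖ x) * χ (𝟙 ⊖ x))   ≡⟨ ∑-reflect 𝟙 (λ x → B x * χ x) ⟩
    ∑ (λ x → B x * χ x)               ≡⟨ ∑B·χ ⟩
    + p - + 3                         ∎

  -- `D` is the non-elementary part of `G`: up to sign the trace of Frobenius in the Legendre family
  -- y² = x (x - 1) (x - z), for z other than 0 and 1. Only its weighted sums over z are evaluated.
  D G : Fin p → ℤ
  D z = ∑ (λ y → χ y * χ (𝟙 ⊖ y) * χ (z ⊖ y))
  G z = ∑ (λ y → B y * χ (z ⊖ y))

  G≡ : ∀ z → G z ≡ δ 𝟘 z * + p + δ 𝟙 z * + p - + 2 + D z
  G≡ z = begin
    G z
      ≡⟨ ∑B (λ y → χ (z ⊖ y)) ⟩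
    ∑ (λ y → χ (z ⊖ y)) + ∑ (λ y → χ y * χ (z ⊖ y)) + ∑ (λ y → χ (𝟙 ⊖ y) * χ (z ⊖ y)) + D z
      ≡⟨ cong (_+ D z) (cong₂ _+_ (cong₂ _+_ (∑χ-reflect z) (∑χχ₀ z)) (∑χχ 𝟙 z)) ⟩
    0ℤ + (+ p * δ 𝟘 z - 1ℤ) + (+ p * δ 𝟙 z - 1ℤ) + D z
      ≡⟨ tidy (+ p) (δ 𝟘 z) (δ 𝟙 z) (D z) ⟩
    δ 𝟘 z * + p + δ 𝟙 z * + p - + 2 + D z  ∎
    where
    tidy : ∀ p a b d → 0ℤ + (p * a - 1ℤ) + (p * b - 1ℤ) + d ≡ a * p + b * p - + 2 + d
    tidy = solve-∀

  -- After the exchange the inner sum pairs h with a single χ, so for h = 1, χ z and χ (1 - z) it is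
  -- elementary.
  ∑h·D : ∀ (h : Fin p → ℤ) → ∑ (λ z → h z * D z) ≡ ∑ (λ y → χ y * χ (𝟙 ⊖ y) * ∑ (λ z → h z * χ (y ⊖ z)))
  ∑h·D h = begin
    ∑ (λ z → h z * D z)
      ≡⟨ sum-cong-≗ (λ z → trans (*-distribˡ-sum (h z) (λ y → χ y * χ (𝟙 ⊖ y) * χ (z ⊖ y)))
           (sum-cong-≗ λ y → trans (regroup (h z) (χ y * χ (𝟙 ⊖ y)) (χ (z ⊖ y))) (cong (λ c → χ y * χ (𝟙 ⊖ y) * (h z * c)) (χ-⊖ z y)))) ⟩
    ∑ (λ z → ∑ (λ y → χ y * χ (𝟙 ⊖ y) * (h z * χ (y ⊖ z))))
      ≡⟨ ∑-comm (λ z y → χ y * χ (𝟙 ⊖ y) * (h z * χ (y ⊖ z))) ⟩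
    ∑ (λ y → ∑ (λ z → χ y * χ (𝟙 ⊖ y) * (h z * χ (y ⊖ z))))
      ≡⟨ sum-cong-≗ (λ y → sym (*-distribˡ-sum (χ y * χ (𝟙 ⊖ y)) (λ z → h z * χ (y ⊖ z)))) ⟩
    ∑ (λ y → χ y * χ (𝟙 ⊖ y) * ∑ (λ z → h z * χ (y ⊖ z)))  ∎
    where
    regroup : ∀ a b c → a * (b * c) ≡ b * (a * c)
    regroup = solve-∀

  ∑χχ·δ : ∀ a → χ a * χ (𝟙 ⊖ a) ≡ 0ℤ → ∑ (λ y → χ y * χ (𝟙 ⊖ y) * (+ p * δ a y - 1ℤ)) ≡ 1ℤ
  ∑χχ·δ a vanish = begin
    ∑ (λ y → χ y * χ (𝟙 ⊖ y) * (+ p * δ a y - 1ℤ))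
      ≡⟨ sum-cong-≗ (λ y → distrib (χ y * χ (𝟙 ⊖ y)) (+ p) (δ a y)) ⟩
    ∑ (λ y → δ a y * (+ p * (χ y * χ (𝟙 ⊖ y))) - χ y * χ (𝟙 ⊖ y))
      ≡⟨ Σ-distrib-- (λ y → δ a y * (+ p * (χ y * χ (𝟙 ⊖ y)))) (λ y → χ y * χ (𝟙 ⊖ y)) ⟩
    ∑ (λ y → δ a y * (+ p * (χ y * χ (𝟙 ⊖ y)))) - ∑ (λ y → χ y * χ (𝟙 ⊖ y))
      ≡⟨ cong₂ _-_ (trans (Σ-δ a (λ y → + p * (χ y * χ (𝟙 ⊖ y)))) (trans (cong (+ p *_) vanish) (ℤ.*-zeroʳ (+ p)))) ∑χχ𝟙 ⟩
    1ℤ  ∎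
    where
    distrib : ∀ c p d → c * (p * d - 1ℤ) ≡ d * (p * c) - c
    distrib = solve-∀

  -- Of the four terms of `B`, 1 gives 0, χ z and χ (1 - z) give 1 each, and only their product
  -- leaves `E`.
  ∑B·D : ∑ (λ z → B z * D z) ≡ + 2 + E
  ∑B·D = begin
    ∑ (λ z → B z * D z)
      ≡⟨ ∑B D ⟩
    ∑ D + ∑ (λ z → χ z * D z) + ∑ (λ z → χ (𝟙 ⊖ z) * D z) + ∑ (λ z → χ z * χ (𝟙 ⊖ z) * D z)
      ≡⟨ cong₂ _+_ (cong₂ _+_ (cong₂ _+_ ∑D
           (trans (∑h·D χ) (trans (sum-cong-≗ λ y → cong (χ y * χ (𝟙 ⊖ y) *_) (∑χχ₀ y)) (∑χχ·δ 𝟘 (cong (_* χ (𝟙 ⊖ 𝟘)) χ-𝟘)))))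
           (trans (∑h·D (λ z → χ (𝟙 ⊖ z))) (trans (sum-cong-≗ λ y → cong (χ y * χ (𝟙 ⊖ y) *_) (∑χχ 𝟙 y)) (∑χχ·δ 𝟙 (trans (cong (χ 𝟙 *_) χ-𝟙⊖𝟙) (ℤ.*-zeroʳ (χ 𝟙)))))))
           (sum-cong-≗ λ x → trans (*-distribˡ-sum (χ x * χ (𝟙 ⊖ x)) (λ y → χ y * χ (𝟙 ⊖ y) * χ (x ⊖ y))) (sum-cong-≗ λ y → sym (ℤ.*-assoc (χ x * χ (𝟙 ⊖ x)) (χ y * χ (𝟙 ⊖ y)) (χ (x ⊖ y))))) ⟩
    0ℤ + 1ℤ + 1ℤ + E
      ≡⟨⟩
    + 2 + E  ∎
    where
    ∑D : ∑ D ≡ 0ℤ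
    ∑D = begin
      ∑ D                                       ≡⟨ sum-cong-≗ (λ z → sym (ℤ.*-identityˡ (D z))) ⟩
      ∑ (λ z → 1ℤ * D z)                        ≡⟨ ∑h·D (λ _ → 1ℤ) ⟩
      ∑ (λ y → χ y * χ (𝟙 ⊖ y) * ∑ (λ z → 1ℤ * χ (y ⊖ z)))
        ≡⟨ sum-cong-≗ (λ y → trans (cong (χ y * χ (𝟙 ⊖ y) *_) (trans (sum-cong-≗ λ z → ℤ.*-identityˡ (χ (y ⊖ z))) (∑χ-reflect y))) (ℤ.*-zeroʳ (χ y * χ (𝟙 ⊖ y)))) ⟩
      ∑ (λ y → 0ℤ)                              ≡⟨ Σ-zero p ⟩
      0ℤ                                        ∎

  -- The deltas in `G≡` sample `B` at 0 and 1, where it is 2; this gives 4 p, from which 2 (p - 1)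
  -- is subtracted.
  ∑B·G : ∑ (λ z → B z * G z) ≡ + 2 * + p + + 4 + E
  ∑B·G = begin
    ∑ (λ z → B z * G z)
      ≡⟨ sum-cong-≗ (λ z → trans (cong (B z *_) (G≡ z)) (distrib (B z) (δ 𝟘 z) (δ 𝟙 z) (+ p) (D z))) ⟩
    ∑ (λ z → δ 𝟘 z * (+ p * B z) + δ 𝟙 z * (+ p * B z) - + 2 * B z + B z * D z)
      ≡⟨ ∑-distrib-+ (λ z → δ 𝟘 z * (+ p * B z) + δ 𝟙 z * (+ p * B z) - + 2 * B z) (λ z → B z * D z) ⟩
    ∑ (λ z → δ 𝟘 z * (+ p * B z) + δ 𝟙 z * (+ p * B z) - + 2 * B z) + ∑ (λ z → B z * D z)
      ≡⟨ cong₂ _+_ (trans (Σ-distrib-- (λ z → δ 𝟘 z * (+ p * B z) + δ 𝟙 z * (+ p * B z)) (λ z → + 2 * B z))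
           (cong₂ _-_ (trans (∑-distrib-+ (λ z → δ 𝟘 z * (+ p * B z)) (λ z → δ 𝟙 z * (+ p * B z)))
                             (cong₂ _+_ (trans (Σ-δ 𝟘 (λ z → + p * B z)) (cong (+ p *_) B-𝟘)) (trans (Σ-δ 𝟙 (λ z → + p * B z)) (cong (+ p *_) B-𝟙))))
                      (trans (sym (*-distribˡ-sum (+ 2) B)) (cong (+ 2 *_) ∑B·1))))
           ∑B·D ⟩
    + p * + 2 + + p * + 2 - + 2 * (+ p - 1ℤ) + (+ 2 + E)
      ≡⟨ tidy (+ p) E ⟩
    + 2 * + p + + 4 + E  ∎
    where
    distrib : ∀ b x y p d → b * (x * p + y * p - + 2 + d) ≡ x * (p * b) + y * (p * b) - + 2 * b + b * d
    distrib = solve-∀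
    tidy : ∀ p e → p * + 2 + p * + 2 - + 2 * (p - 1ℤ) + (+ 2 + e) ≡ + 2 * p + + 4 + e
    tidy = solve-∀

  -- The indicator of the common neighbours of 0 and 1.
  N : Fin p → ℤ
  N x = s x * s (𝟙 ⊖ x)

  δ-𝟙⊖ : ∀ x → δ 𝟘 (𝟙 ⊖ x) ≡ δ 𝟙 x
  δ-𝟙⊖ x = δ-⇔ (λ eq → ⊖≡𝟘⇒≡ (sym eq)) (λ eq → sym (≡⇒⊖≡𝟘 eq))

  4*N : ∀ x → + 4 * N x ≡ B x - + 2 * δ 𝟘 x - + 2 * δ 𝟙 x
  4*N x = begin
    + 4 * N x
      ≡⟨ split (s x) (s (𝟙 ⊖ x)) ⟩
    (+ 2 * s x) * (+ 2 * s (𝟙 ⊖ x))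
      ≡⟨ cong₂ _*_ (2*s x) (trans (2*s (𝟙 ⊖ x)) (cong (λ d → 1ℤ - d + χ (𝟙 ⊖ x)) (δ-𝟙⊖ x))) ⟩
    (1ℤ - δ 𝟘 x + χ x) * (1ℤ - δ 𝟙 x + χ (𝟙 ⊖ x))
      ≡⟨ expand (δ 𝟘 x) (δ 𝟙 x) (χ x) (χ (𝟙 ⊖ x)) ⟩
    B x - (δ 𝟘 x + δ 𝟘 x * χ (𝟙 ⊖ x)) - (δ 𝟙 x + δ 𝟙 x * χ x) + δ 𝟘 x * δ 𝟙 x
      -- On the support of each delta the accompanying character has the value 1, and the two deltas
      -- never meet.
      ≡⟨ cong₂ _+_ (cong₂ (λ a b → B x - (δ 𝟘 x + a) - (δ 𝟙 x + b))
           (trans (δ-subst 𝟘 x {λ x → χ (𝟙 ⊖ x)}) (cong (δ 𝟘 x *_) χ-𝟙⊖𝟘))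
           (trans (δ-subst 𝟙 x {χ}) (cong (δ 𝟙 x *_) χ-𝟙)))
           (trans (δ-subst 𝟘 x {δ 𝟙}) (cong (δ 𝟘 x *_) (δ-≢ 𝟙≢𝟘))) ⟩
    B x - (δ 𝟘 x + δ 𝟘 x * 1ℤ) - (δ 𝟙 x + δ 𝟙 x * 1ℤ) + δ 𝟘 x * 0ℤ
      ≡⟨ tidy (B x) (δ 𝟘 x) (δ 𝟙 x) ⟩
    B x - + 2 * δ 𝟘 x - + 2 * δ 𝟙 x  ∎
    where
    split : ∀ a b → + 4 * (a * b) ≡ (+ 2 * a) * (+ 2 * b)
    split = solve-∀
    expand : ∀ d e a b → (1ℤ - d + a) * (1ℤ - e + b) ≡ (1ℤ + a) * (1ℤ + b) - (d + d * b) - (e + e * a) + d * e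
    expand = solve-∀
    tidy : ∀ b d e → b - (d + d * 1ℤ) - (e + e * 1ℤ) + d * 0ℤ ≡ b - + 2 * d - + 2 * e
    tidy = solve-∀

  ∑4N : ∀ (g : Fin p → ℤ) → ∑ (λ x → + 4 * N x * g x) ≡ ∑ (λ x → B x * g x) - + 2 * g 𝟘 - + 2 * g 𝟙
  ∑4N g = begin
    ∑ (λ x → + 4 * N x * g x)
      ≡⟨ sum-cong-≗ (λ x → trans (cong (_* g x) (4*N x)) (distrib (B x) (δ 𝟘 x) (δ 𝟙 x) (g x))) ⟩
    ∑ (λ x → B x * g x - δ 𝟘 x * (+ 2 * g x) - δ 𝟙 x * (+ 2 * g x))
      ≡⟨ Σ-distrib-- (λ x → B x * g x - δ 𝟘 x * (+ 2 * g x)) (λ x → δ 𝟙 x * (+ 2 * g x)) ⟩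
    ∑ (λ x → B x * g x - δ 𝟘 x * (+ 2 * g x)) - ∑ (λ x → δ 𝟙 x * (+ 2 * g x))
      ≡⟨ cong₂ _-_ (Σ-distrib-- (λ x → B x * g x) (λ x → δ 𝟘 x * (+ 2 * g x))) (Σ-δ 𝟙 (λ x → + 2 * g x)) ⟩
    ∑ (λ x → B x * g x) - ∑ (λ x → δ 𝟘 x * (+ 2 * g x)) - + 2 * g 𝟙
      ≡⟨ cong (λ a → ∑ (λ x → B x * g x) - a - + 2 * g 𝟙) (Σ-δ 𝟘 (λ x → + 2 * g x)) ⟩
    ∑ (λ x → B x * g x) - + 2 * g 𝟘 - + 2 * g 𝟙  ∎
    where
    distrib : ∀ b d e g → (b - + 2 * d - + 2 * e) * g ≡ b * g - d * (+ 2 * g) - e * (+ 2 * g)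
    distrib = solve-∀

  ∑4N·1 : ∑ (λ x → + 4 * N x) ≡ + p - + 5
  ∑4N·1 = begin
    ∑ (λ x → + 4 * N x)            ≡⟨ sum-cong-≗ (λ x → sym (ℤ.*-identityʳ (+ 4 * N x))) ⟩
    ∑ (λ x → + 4 * N x * 1ℤ)       ≡⟨ ∑4N (λ _ → 1ℤ) ⟩
    ∑ (λ x → B x * 1ℤ) - + 2 * 1ℤ - + 2 * 1ℤ  ≡⟨ cong (λ b → b - + 2 - + 2) (trans (sum-cong-≗ λ x → ℤ.*-identityʳ (B x)) ∑B·1) ⟩
    + p - 1ℤ - + 2 - + 2           ≡⟨ tidy (+ p) ⟩
    + p - + 5                      ∎
    where
    tidy : ∀ a → a - 1ℤ - + 2 - + 2 ≡ a - + 5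
    tidy = solve-∀

  -- The character part of 8 times the number of common neighbours of 0, 1 and z; see `inner` in
  -- `32*edges`.
  K : Fin p → ℤ
  K z = ∑ (λ w → + 4 * N w * χ (z ⊖ w))

  K≡ : ∀ z → K z ≡ G z - + 2 * χ z - + 2 * χ (𝟙 ⊖ z)
  K≡ z = trans (∑4N (λ w → χ (z ⊖ w))) (cong₂ (λ a b → G z - + 2 * a - + 2 * b) (cong χ (solve 1 (λ z → z :- con 0ℤ := z) refl z)) (χ-⊖ z 𝟙))
    where open Solver

  G-𝟘 : G 𝟘 ≡ + p - + 3
  G-𝟘 = trans (sum-cong-≗ λ y → cong (B y *_) (trans (χ-⊖ 𝟘 y) (cong χ (solve 1 (λ y → y :- con 0ℤ := y) refl y)))) ∑B·χ
    where open Solver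

  -- `∑4N` trades the weight 4 N for `B` at the price of the values `K 𝟘` and `K 𝟙`, which reduce to
  -- `∑B·χ` and `∑B·χ𝟙⊖`.
  ∑4N·K : ∑ (λ z → + 4 * N z * K z) ≡ E - + 6 * + p + + 36
  ∑4N·K = begin
    ∑ (λ z → + 4 * N z * K z)
      ≡⟨ ∑4N K ⟩
    ∑ (λ z → B z * K z) - + 2 * K 𝟘 - + 2 * K 𝟙
      ≡⟨ cong₂ _-_ (cong₂ (λ a b → a - + 2 * b) ∑B·K (trans (K≡ 𝟘) (cong₂ _-_ (cong₂ (λ a b → a - + 2 * b) G-𝟘 χ-𝟘) (cong (+ 2 *_) χ-𝟙⊖𝟘))))
                   (cong (+ 2 *_) (trans (K≡ 𝟙) (cong₂ _-_ (cong₂ (λ a b → a - + 2 * b) ∑B·χ𝟙⊖ χ-𝟙) (cong (+ 2 *_) χ-𝟙⊖𝟙)))) ⟩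
    (+ 2 * + p + + 4 + E - + 2 * (+ p - + 3) - + 2 * (+ p - + 3)) - + 2 * (+ p - + 3 - + 2 * 0ℤ - + 2 * 1ℤ) - + 2 * (+ p - + 3 - + 2 * 1ℤ - + 2 * 0ℤ)
      ≡⟨ tidy (+ p) E ⟩
    E - + 6 * + p + + 36  ∎
    where
    distrib : ∀ b g c d → b * (g - + 2 * c - + 2 * d) ≡ b * g - + 2 * (b * c) - + 2 * (b * d)
    distrib = solve-∀
    tidy : ∀ p e → (+ 2 * p + + 4 + e - + 2 * (p - + 3) - + 2 * (p - + 3)) - + 2 * (p - + 3 - + 2 * 0ℤ - + 2 * 1ℤ) - + 2 * (p - + 3 - + 2 * 1ℤ - + 2 * 0ℤ) ≡ e - + 6 * p + + 36
    tidy = solve-∀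
    ∑B·K : ∑ (λ z → B z * K z) ≡ + 2 * + p + + 4 + E - + 2 * (+ p - + 3) - + 2 * (+ p - + 3)
    ∑B·K = begin
      ∑ (λ z → B z * K z)
        ≡⟨ sum-cong-≗ (λ z → trans (cong (B z *_) (K≡ z)) (distrib (B z) (G z) (χ z) (χ (𝟙 ⊖ z)))) ⟩
      ∑ (λ z → B z * G z - + 2 * (B z * χ z) - + 2 * (B z * χ (𝟙 ⊖ z)))
        ≡⟨ Σ-distrib-- (λ z → B z * G z - + 2 * (B z * χ z)) (λ z → + 2 * (B z * χ (𝟙 ⊖ z))) ⟩
      ∑ (λ z → B z * G z - + 2 * (B z * χ z)) - ∑ (λ z → + 2 * (B z * χ (𝟙 ⊖ z)))
        ≡⟨ cong₂ _-_ (Σ-distrib-- (λ z → B z * G z) (λ z → + 2 * (B z * χ z))) (trans (sym (*-distribˡ-sum (+ 2) (λ z → B z * χ (𝟙 ⊖ z)))) (cong (+ 2 *_) ∑B·χ𝟙⊖)) ⟩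
      ∑ (λ z → B z * G z) - ∑ (λ z → + 2 * (B z * χ z)) - + 2 * (+ p - + 3)
        ≡⟨ cong₂ (λ a b → a - b - + 2 * (+ p - + 3)) ∑B·G (trans (sym (*-distribˡ-sum (+ 2) (λ z → B z * χ z))) (cong (+ 2 *_) ∑B·χ)) ⟩
      + 2 * + p + + 4 + E - + 2 * (+ p - + 3) - + 2 * (+ p - + 3) ∎

  N-idem : ∀ x → N x * N x ≡ N x
  N-idem x = trans (regroup (s x) (s (𝟙 ⊖ x))) (cong₂ _*_ (ι-idem (unitSquare? x)) (ι-idem (unitSquare? (𝟙 ⊖ x))))
    where
    regroup : ∀ a b → a * b * (a * b) ≡ a * a * (b * b)
    regroup = solve-∀

  s⊖ : Fin p → Fin p → ℤ
  s⊖ x y = s (x ⊖ y)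

  -- 32 is 4 for each of the two weights `N` and 2 for the edge. The diagonal w = z is removed by δ
  -- z w, which produces N z squared, again N z as an indicator.
  32*edges : + 32 * orderedCliques 2 N s⊖ ≡ + p * + p - + 22 * + p + + 81 + φ 𝟙 * φ 𝟙
  32*edges = begin
    + 32 * ∑ (λ z → N z * ∑ (λ w → N w * s (z ⊖ w) * 1ℤ))
      ≡⟨ *-distribˡ-sum (+ 32) (λ z → N z * ∑ (λ w → N w * s (z ⊖ w) * 1ℤ)) ⟩
    ∑ (λ z → + 32 * (N z * ∑ (λ w → N w * s (z ⊖ w) * 1ℤ)))
      ≡⟨ sum-cong-≗ (λ z → begin
           + 32 * (N z * ∑ (λ w → N w * s (z ⊖ w) * 1ℤ))
             ≡⟨ split (N z) (∑ (λ w → N w * s (z ⊖ w) * 1ℤ)) ⟩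
           + 4 * N z * (+ 8 * ∑ (λ w → N w * s (z ⊖ w) * 1ℤ))
             ≡⟨ cong (+ 4 * N z *_) (inner z) ⟩
           + 4 * N z * (+ p - + 5 - + 4 * N z + K z)
             ≡⟨ distrib (N z) (+ p - + 5) (K z) ⟩
           (+ p - + 5) * (+ 4 * N z) - + 4 * (+ 4 * (N z * N z)) + + 4 * N z * K z
             ≡⟨ cong (λ n → (+ p - + 5) * (+ 4 * N z) - + 4 * (+ 4 * n) + + 4 * N z * K z) (N-idem z) ⟩
           (+ p - + 5) * (+ 4 * N z) - + 4 * (+ 4 * N z) + + 4 * N z * K z ∎) ⟩
    ∑ (λ z → (+ p - + 5) * (+ 4 * N z) - + 4 * (+ 4 * N z) + + 4 * N z * K z)
      ≡⟨ ∑-distrib-+ (λ z → (+ p - + 5) * (+ 4 * N z) - + 4 * (+ 4 * N z)) (λ z → + 4 * N z * K z) ⟩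
    ∑ (λ z → (+ p - + 5) * (+ 4 * N z) - + 4 * (+ 4 * N z)) + ∑ (λ z → + 4 * N z * K z)
      ≡⟨ cong₂ _+_ (trans (Σ-distrib-- (λ z → (+ p - + 5) * (+ 4 * N z)) (λ z → + 4 * (+ 4 * N z)))
                          (cong₂ _-_ (trans (sym (*-distribˡ-sum (+ p - + 5) (λ z → + 4 * N z))) (cong ((+ p - + 5) *_) ∑4N·1))
                                     (trans (sym (*-distribˡ-sum (+ 4) (λ z → + 4 * N z))) (cong (+ 4 *_) ∑4N·1))))
                   ∑4N·K ⟩
    (+ p - + 5) * (+ p - + 5) - + 4 * (+ p - + 5) + (E - + 6 * + p + + 36)
      ≡⟨ tidy (+ p) E ⟩
    + p * + p - + 22 * + p + + 81 + (E + + 2 * + p)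
      ≡⟨ cong (_+_ (+ p * + p - + 22 * + p + + 81)) φ² ⟨
    + p * + p - + 22 * + p + + 81 + φ 𝟙 * φ 𝟙  ∎
    where
    split : ∀ a b → + 32 * (a * b) ≡ + 4 * a * (+ 8 * b)
    split = solve-∀
    distrib : ∀ n c k → + 4 * n * (c - + 4 * n + k) ≡ c * (+ 4 * n) - + 4 * (+ 4 * (n * n)) + + 4 * n * k
    distrib = solve-∀
    tidy : ∀ p e → (p - + 5) * (p - + 5) - + 4 * (p - + 5) + (e - + 6 * p + + 36) ≡ p * p - + 22 * p + + 81 + (e + + 2 * p)
    tidy = solve-∀
    split′ : ∀ n s → + 8 * (n * s * 1ℤ) ≡ + 4 * n * (+ 2 * s)
    split′ = solve-∀
    distrib′ : ∀ n d c → n * (1ℤ - d + c) ≡ n - d * n + n * c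
    distrib′ = solve-∀
    inner : ∀ z → + 8 * ∑ (λ w → N w * s (z ⊖ w) * 1ℤ) ≡ + p - + 5 - + 4 * N z + K z
    inner z = begin
      + 8 * ∑ (λ w → N w * s (z ⊖ w) * 1ℤ)
        ≡⟨ *-distribˡ-sum (+ 8) (λ w → N w * s (z ⊖ w) * 1ℤ) ⟩
      ∑ (λ w → + 8 * (N w * s (z ⊖ w) * 1ℤ))
        ≡⟨ sum-cong-≗ (λ w → trans (split′ (N w) (s (z ⊖ w))) (trans (cong (+ 4 * N w *_) (trans (2*s (z ⊖ w)) (cong (λ d → 1ℤ - d + χ (z ⊖ w)) (δ-⇔ (λ eq → ⊖≡𝟘⇒≡ (sym eq)) (λ eq → sym (≡⇒⊖≡𝟘 eq))))))
             (distrib′ (+ 4 * N w) (δ z w) (χ (z ⊖ w))))) ⟩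
      ∑ (λ w → + 4 * N w - δ z w * (+ 4 * N w) + + 4 * N w * χ (z ⊖ w))
        ≡⟨ ∑-distrib-+ (λ w → + 4 * N w - δ z w * (+ 4 * N w)) (λ w → + 4 * N w * χ (z ⊖ w)) ⟩
      ∑ (λ w → + 4 * N w - δ z w * (+ 4 * N w)) + K z
        ≡⟨ cong (_+ K z) (trans (Σ-distrib-- (λ w → + 4 * N w) (λ w → δ z w * (+ 4 * N w))) (cong₂ _-_ ∑4N·1 (Σ-δ z (λ w → + 4 * N w)))) ⟩
      + p - + 5 - + 4 * N z + K z  ∎

  -- Moving the first two vertices to 0 and 1

  s-⊗ : ∀ {y} → UnitSquare y → ∀ x → s (y ⊗ x) ≡ s x
  s-⊗ (a , a≢𝟘 , refl) x = ι-cong (unitSquare? (a ⊗ a ⊗ x)) (unitSquare? x) divide multiply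
    where
    open Solver
    multiply : UnitSquare x → UnitSquare (a ⊗ a ⊗ x)
    multiply (b , b≢𝟘 , refl) = a ⊗ b , ⊗-nonzero a≢𝟘 b≢𝟘 , solve 2 (λ a b → a :* a :* (b :* b) := a :* b :* (a :* b)) refl a b
    divide : UnitSquare (a ⊗ a ⊗ x) → UnitSquare x
    divide (c , c≢𝟘 , eq) = a⁻¹ ⊗ c , ⊗-nonzero a⁻¹≢𝟘 c≢𝟘 , (begin
      x                          ≡⟨ solve 1 (λ x → x := con 1ℤ :* con 1ℤ :* x) refl x ⟩
      𝟙 ⊗ 𝟙 ⊗ x                  ≡⟨ cong (λ u → u ⊗ u ⊗ x) aa⁻¹≡𝟙 ⟨
      a ⊗ a⁻¹ ⊗ (a ⊗ a⁻¹) ⊗ x    ≡⟨ solve 3 (λ a b x → a :* b :* (a :* b) :* x := b :* b :* (a :* a :* x)) refl a a⁻¹ x ⟩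
      a⁻¹ ⊗ a⁻¹ ⊗ (a ⊗ a ⊗ x)    ≡⟨ cong (a⁻¹ ⊗ a⁻¹ ⊗_) eq ⟩
      a⁻¹ ⊗ a⁻¹ ⊗ (c ⊗ c)        ≡⟨ solve 2 (λ b c → b :* b :* (c :* c) := b :* c :* (b :* c)) refl a⁻¹ c ⟩
      a⁻¹ ⊗ c ⊗ (a⁻¹ ⊗ c)        ∎)
      where
      a⁻¹ = a≢𝟘 ⁻¹
      aa⁻¹≡𝟙 = proj₂ (inverse a a≢𝟘)
      a⁻¹≢𝟘 : a⁻¹ ≢ 𝟘
      a⁻¹≢𝟘 eq = 𝟙≢𝟘 (trans (sym aa⁻¹≡𝟙) (trans (cong (a ⊗_) eq) (trans (⊗-comm a 𝟘) (zero-⊗ a))))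

  s-⊝ : ∀ x → s (⊝ x) ≡ s x
  s-⊝ x = trans (cong s (solve 1 (λ x → :- x := :- con 1ℤ :* x) refl x)) (s-⊗ (proj₁ √-1 , i≢𝟘 , sym (proj₂ √-1)) x)
    where open Solver

  -- Translate the first vertex to 𝟘 and scale the second one to 𝟙.
  orderedCliques-normalised : orderedCliques 4 (λ _ → 1ℤ) s⊖ ≡ + p * (∑ s * orderedCliques 2 N s⊖)
  orderedCliques-normalised = begin
    ∑ (λ x → 1ℤ * orderedCliques 3 (λ y → 1ℤ * s (x ⊖ y)) s⊖)
      ≡⟨ sum-cong-≗ (λ x → trans (ℤ.*-identityˡ (orderedCliques 3 (λ y → 1ℤ * s (x ⊖ y)) s⊖)) (trans (translate x) rescaled)) ⟩
    ∑ (λ x → ∑ s * orderedCliques 2 N s⊖)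
      ≡⟨ Σ-const p (∑ s * orderedCliques 2 N s⊖) ⟩
    + p * (∑ s * orderedCliques 2 N s⊖)  ∎
    where
    open Solver
    translate : ∀ x → orderedCliques 3 (λ y → 1ℤ * s (x ⊖ y)) s⊖ ≡ orderedCliques 3 s s⊖
    -- The reflection y ↦ x - y turns the weight s (x - y) into s y; the sign it leaves in the other
    -- differences is absorbed by `s-⊝`.
    translate x = trans (orderedCliques-bijection 3 (λ y → 1ℤ * s (x ⊖ y)) s⊖ (x ⊖_) (∑-reflect x))
      (orderedCliques-cong 3 (λ y → trans (ℤ.*-identityˡ (s (x ⊖ (x ⊖ y)))) (cong s (solve 2 (λ x y → x :- (x :- y) := y) refl x y)))
        (λ y z → trans (cong s (solve 3 (λ x y z → x :- y :- (x :- z) := :- (y :- z)) refl x y z)) (s-⊝ (y ⊖ z))))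
    scale : ∀ y → s y * orderedCliques 2 (λ z → s z * s (y ⊖ z)) s⊖ ≡ s y * orderedCliques 2 N s⊖
    scale y with unitSquare? y
    ... | no _ = trans (ℤ.*-zeroˡ (orderedCliques 2 (λ z → s z * s (y ⊖ z)) s⊖)) (sym (ℤ.*-zeroˡ (orderedCliques 2 N s⊖)))
    -- Scaling by the unit square y does not change s, and y - y z = y (1 - z) yields the weight
    -- `N`.
    ... | yes y□@(a , a≢𝟘 , eq) = cong (1ℤ *_) (trans (orderedCliques-bijection 2 (λ z → s z * s (y ⊖ z)) s⊖ (y ⊗_) (∑-scale y≢𝟘))
      (orderedCliques-cong 2 (λ z → cong₂ _*_ (s-⊗ y□ z) (trans (cong s (solve 2 (λ y z → y :- y :* z := y :* (con 1ℤ :- z)) refl y z)) (s-⊗ y□ (𝟙 ⊖ z))))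
        (λ z w → trans (cong s (solve 3 (λ y z w → y :* z :- y :* w := y :* (z :- w)) refl y z w)) (s-⊗ y□ (z ⊖ w)))))
      where
      y≢𝟘 : y ≢ 𝟘
      y≢𝟘 y≡𝟘 = ⊗-nonzero a≢𝟘 a≢𝟘 (trans (sym eq) y≡𝟘)
    rescaled : orderedCliques 3 s s⊖ ≡ ∑ s * orderedCliques 2 N s⊖
    rescaled = trans (sum-cong-≗ scale) (sym (*-distribʳ-sum (orderedCliques 2 N s⊖) s))

  64*cliques : + 64 * orderedCliques 4 (λ _ → 1ℤ) s⊖ ≡ + p * (+ p - 1ℤ) * (+ p * + p - + 22 * + p + + 81 + φ 𝟙 * φ 𝟙)
  64*cliques = begin
    + 64 * orderedCliques 4 (λ _ → 1ℤ) s⊖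
      ≡⟨ cong (+ 64 *_) orderedCliques-normalised ⟩
    + 64 * (+ p * (∑ s * orderedCliques 2 N s⊖))
      ≡⟨ split (+ p) (∑ s) (orderedCliques 2 N s⊖) ⟩
    + p * (+ 2 * ∑ s) * (+ 32 * orderedCliques 2 N s⊖)
      ≡⟨ cong₂ (λ a b → + p * a * b) 2*∑s 32*edges ⟩
    + p * (+ p - 1ℤ) * (+ p * + p - + 22 * + p + + 81 + φ 𝟙 * φ 𝟙)  ∎
    where
    split : ∀ p s t → + 64 * (p * (s * t)) ≡ p * (+ 2 * s) * (+ 32 * t)
    split = solve-∀

-- Representations by two squares

euclid : ∀ {p} → Prime p → ∀ x y → + p ∣ₛ x * y → + p ∣ₛ x ⊎ + p ∣ₛ y
euclid {p} p-prime x y p∣xy with euclidsLemma ℤ.∣ x ∣ ℤ.∣ y ∣ p-prime (subst (p ℕ.∣_) (ℤ.abs-* x y) (∣⇒∣ᵤ p∣xy))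
... | inj₁ p∣x = inj₁ (∣ᵤ⇒∣ p∣x)
... | inj₂ p∣y = inj₂ (∣ᵤ⇒∣ p∣y)

euclid² : ∀ {p} → Prime p → ∀ x → + p ∣ₛ x * x → + p ∣ₛ x
euclid² p-prime x p∣xx with euclid p-prime x x p∣xx
... | inj₁ p∣x = p∣x
... | inj₂ p∣x = p∣x

4*≢1 : ∀ z → + 4 * z ≢ 1ℤ
4*≢1 z eq = contradiction (ℕ.∣1⇒≡1 {4} (∣⇒∣ᵤ (divides z (trans (sym eq) (ℤ.*-comm (+ 4) z))))) λ ()

-- Since (2 k + 1)² - 4 (k² + k) = 1, equality would make 1 a multiple of 4.
4*≢odd² : ∀ z k → + 4 * z ≢ (+ 2 * k + 1ℤ) * (+ 2 * k + 1ℤ)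
4*≢odd² z k eq = 4*≢1 (z - (k * k + k)) (trans (identity z k) (trans (cong (_- + 4 * (k * k + k)) eq) (odd k)))
  where
  identity : ∀ z k → + 4 * (z - (k * k + k)) ≡ + 4 * z - + 4 * (k * k + k)
  identity = solve-∀
  odd : ∀ k → (+ 2 * k + 1ℤ) * (+ 2 * k + 1ℤ) - + 4 * (k * k + k) ≡ 1ℤ
  odd = solve-∀

parity : ∀ x → (∃ λ d → x ≡ + 2 * d) ⊎ (∃ λ d → x ≡ + 2 * d + 1ℤ)
parity x with x ℤ.%ℕ 2 | ℤ.n%ℕd<d x 2 | ℤ.a≡a%ℕn+[a/ℕn]*n x 2
... | 0           | _                  | eq = inj₁ (x ℤ./ℕ 2 , trans eq (flip (x ℤ./ℕ 2)))
  where
  flip : ∀ d → 0ℤ + d * + 2 ≡ + 2 * d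
  flip = solve-∀
... | 1           | _                  | eq = inj₂ (x ℤ./ℕ 2 , trans eq (flip (x ℤ./ℕ 2)))
  where
  flip : ∀ d → 1ℤ + d * + 2 ≡ + 2 * d + 1ℤ
  flip = solve-∀
... | suc (suc _) | ℕ.s≤s (ℕ.s≤s ()) | _

*-self-suc : ∀ x → x ≡ 0ℤ ⊎ ∃ λ n → x * x ≡ + suc n
*-self-suc (+ zero)  = inj₁ refl
*-self-suc (+ suc n) = inj₂ (_ , refl)
*-self-suc -[1+ n ]  = inj₂ (_ , refl)

squares-sum-1 : ∀ x y → x * x + y * y ≡ 1ℤ → x ≡ 0ℤ ⊎ y ≡ 0ℤ
squares-sum-1 x y eq with *-self-suc x | *-self-suc y
... | inj₁ x≡0       | _              = inj₁ x≡0
... | inj₂ _         | inj₁ y≡0       = inj₂ y≡0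
... | inj₂ (m , xx≡) | inj₂ (n , yy≡) = contradiction (ℕ.suc-injective (ℤ.+-injective (trans (cong₂ _+_ (sym xx≡) (sym yy≡)) eq))) (ℕ.1+n≢0 ∘ trans (sym (ℕ.+-suc m n)))

module TwoSquares {p} (p-prime : Prime p) where

  open ≡-Reasoning

  private instance
    p≢0 : ℕ.NonZero p
    p≢0 = prime⇒nonZero p-prime

  cancel-p : ∀ x y → + p * x ≡ + p * y → x ≡ y
  cancel-p x y = ℤ.*-cancelˡ-≡ (+ p) x y

  brahmagupta : ∀ a b c d → (a * a + b * b) * (c * c + d * d) ≡ (a * d - b * c) * (a * d - b * c) + (a * c + b * d) * (a * c + b * d)
  brahmagupta = solve-∀

  module _ (a b c d : ℤ) (p≡a²+b² : + p ≡ a * a + b * b) (p≡c²+d² : + p ≡ c * c + d * d) where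

    p² : + p * + p ≡ (a * d - b * c) * (a * d - b * c) + (a * c + b * d) * (a * c + b * d)
    p² = trans (cong₂ _*_ p≡a²+b² p≡c²+d²) (brahmagupta a b c d)

    -- By `p²`, (a c + b d)² = p² - (a d - b c)².
    p∣ac+bd : + p ∣ₛ a * d - b * c → + p ∣ₛ a * c + b * d
    p∣ac+bd p∣ad-bc = euclid² p-prime (a * c + b * d) (∣ₛ-resp eq (∣ₛ-+ (divides (+ p) refl) (∣ₛ-* (- (a * d - b * c)) p∣ad-bc)))
      where
      cancel : ∀ x y → x * x + y + - x * x ≡ y
      cancel = solve-∀
      eq : + p * + p + - (a * d - b * c) * (a * d - b * c) ≡ (a * c + b * d) * (a * c + b * d)
      eq = trans (cong (_+ - (a * d - b * c) * (a * d - b * c)) p²) (cancel (a * d - b * c) ((a * c + b * d) * (a * c + b * d)))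

    -- Brahmagupta's identity divided by p².
    quotients : ∀ q r → a * d - b * c ≡ q * + p → a * c + b * d ≡ r * + p → q * q + r * r ≡ 1ℤ
    quotients q r ad-bc≡qp ac+bd≡rp = cancel-p (q * q + r * r) 1ℤ (cancel-p (+ p * (q * q + r * r)) (+ p * 1ℤ) (begin
      + p * (+ p * (q * q + r * r))                 ≡⟨ collect (+ p) q r ⟩
      q * + p * (q * + p) + r * + p * (r * + p)     ≡⟨ cong₂ (λ x y → x * x + y * y) ad-bc≡qp ac+bd≡rp ⟨
      (a * d - b * c) * (a * d - b * c) + (a * c + b * d) * (a * c + b * d)  ≡⟨ p² ⟨
      + p * + p                                     ≡⟨ cong (+ p *_) (ℤ.*-identityʳ (+ p)) ⟨
      + p * (+ p * 1ℤ)                              ∎))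
      where
      collect : ∀ p q r → p * (p * (q * q + r * r)) ≡ q * p * (q * p) + r * p * (r * p)
      collect = solve-∀

    -- p (a² - c²) factors as (a d - b c) (a d + b c).
    ad≡bc⇒a²≡c² : a * d - b * c ≡ 0ℤ → a * a ≡ c * c
    ad≡bc⇒a²≡c² ad-bc≡0 = cancel-p (a * a) (c * c) (ℤ.i-j≡0⇒i≡j (+ p * (a * a)) (+ p * (c * c)) (begin
      + p * (a * a) - + p * (c * c)                            ≡⟨ cong₂ (λ x y → x * (a * a) - y * (c * c)) p≡c²+d² p≡a²+b² ⟩
      (c * c + d * d) * (a * a) - (a * a + b * b) * (c * c)    ≡⟨ difference a b c d ⟩
      (a * d - b * c) * (a * d + b * c)                        ≡⟨ cong (_* (a * d + b * c)) ad-bc≡0 ⟩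
      0ℤ * (a * d + b * c)                                     ≡⟨ ℤ.*-zeroˡ (a * d + b * c) ⟩
      0ℤ                                                       ∎))
      where
      difference : ∀ a b c d → (c * c + d * d) * (a * a) - (a * a + b * b) * (c * c) ≡ (a * d - b * c) * (a * d + b * c)
      difference = solve-∀

    ac≡-bd⇒c²≡b² : a * c + b * d ≡ 0ℤ → c * c ≡ b * b
    ac≡-bd⇒c²≡b² ac+bd≡0 = cancel-p (c * c) (b * b) (ℤ.i-j≡0⇒i≡j (+ p * (c * c)) (+ p * (b * b)) (begin
      + p * (c * c) - + p * (b * b)                            ≡⟨ cong₂ (λ x y → x * (c * c) - y * (b * b)) p≡a²+b² p≡c²+d² ⟩
      (a * a + b * b) * (c * c) - (c * c + d * d) * (b * b)    ≡⟨ difference a b c d ⟩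
      (a * c + b * d) * (a * c - b * d)                        ≡⟨ cong (_* (a * c - b * d)) ac+bd≡0 ⟩
      0ℤ * (a * c - b * d)                                     ≡⟨ ℤ.*-zeroˡ (a * c - b * d) ⟩
      0ℤ                                                       ∎))
      where
      difference : ∀ a b c d → (a * a + b * b) * (c * c) - (c * c + d * d) * (b * b) ≡ (a * c + b * d) * (a * c - b * d)
      difference = solve-∀

    two-squares-∣ : + p ∣ₛ a * d - b * c → + p ∣ₛ a * c + b * d → a * a ≡ c * c ⊎ c * c ≡ b * b
    two-squares-∣ (divides q ad-bc≡qp) (divides r ac+bd≡rp) = Sum.map
      (λ q≡0 → ad≡bc⇒a²≡c² (trans ad-bc≡qp (cong (_* + p) q≡0)))
      (λ r≡0 → ac≡-bd⇒c²≡b² (trans ac+bd≡rp (cong (_* + p) r≡0)))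
      (squares-sum-1 q r (quotients q r ad-bc≡qp ac+bd≡rp))

  neg-square : ∀ c → - c * - c ≡ c * c
  neg-square = solve-∀

  -- p divides (a d - b c) (a d + b c) = p (a² - c²), hence one of the factors; the second case is
  -- the first with -c for c. Then p divides both squared terms of Brahmagupta's identity, whose
  -- quotients satisfy q² + r² = 1, so that q or r is 0.
  two-squares-unique : ∀ a b c d → + p ≡ a * a + b * b → + p ≡ c * c + d * d → a * a ≡ c * c ⊎ c * c ≡ b * b
  two-squares-unique a b c d p≡a²+b² p≡c²+d² = Sum.[
      (λ p∣ad-bc → two-squares-∣ a b c d p≡a²+b² p≡c²+d² p∣ad-bc (p∣ac+bd a b c d p≡a²+b² p≡c²+d² p∣ad-bc))
    , (λ p∣ad+bc → Sum.map (λ aa≡cc → trans aa≡cc (neg-square c)) (trans (sym (neg-square c)))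
        (two-squares-∣ a b (- c) d p≡a²+b² p≡[-c]²+d² p∣ad+bc (p∣ac+bd a b (- c) d p≡a²+b² p≡[-c]²+d² p∣ad+bc)))
    ]′ (euclid p-prime (a * d - b * c) (a * d - b * - c) (divides (a * a - c * c) (begin
      (a * d - b * c) * (a * d - b * - c)                      ≡⟨ difference a b c d ⟩
      (c * c + d * d) * (a * a) - (a * a + b * b) * (c * c)    ≡⟨ cong₂ (λ x y → x * (a * a) - y * (c * c)) p≡c²+d² p≡a²+b² ⟨
      + p * (a * a) - + p * (c * c)                            ≡⟨ collect (+ p) (a * a) (c * c) ⟩
      (a * a - c * c) * + p                                    ∎)))
    where
    p≡[-c]²+d² : + p ≡ - c * - c + d * d
    p≡[-c]²+d² = trans p≡c²+d² (cong (_+ d * d) (sym (neg-square c)))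
    difference : ∀ a b c d → (a * d - b * c) * (a * d - b * - c) ≡ (c * c + d * d) * (a * a) - (a * a + b * b) * (c * c)
    difference = solve-∀
    collect : ∀ p x y → p * x - p * y ≡ (x - y) * p
    collect = solve-∀

  [2*]² : ∀ c → + 2 * c * (+ 2 * c) ≡ + 4 * (c * c)
  [2*]² = solve-∀

  [2c]²+ψ²≡4p⇒ψ-even : ∀ c ψ → + 2 * c * (+ 2 * c) + ψ * ψ ≡ + 4 * + p → ∃ λ d → ψ ≡ + 2 * d
  [2c]²+ψ²≡4p⇒ψ-even c ψ eq = Sum.[ (λ even → even) , (λ (d , ψ≡2d+1) → contradiction (begin
    + 4 * (+ p - c * c)                                ≡⟨ expand (+ p) c ⟩
    + 4 * + p - + 4 * (c * c)                          ≡⟨ cong (_- + 4 * (c * c)) eq ⟨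
    + 2 * c * (+ 2 * c) + ψ * ψ - + 4 * (c * c)        ≡⟨ isolate c ψ ⟩
    ψ * ψ                                              ≡⟨ cong (λ x → x * x) ψ≡2d+1 ⟩
    (+ 2 * d + 1ℤ) * (+ 2 * d + 1ℤ)                    ∎) (4*≢odd² (+ p - c * c) d)) ]′ (parity ψ)
    where
    expand : ∀ p c → + 4 * (p - c * c) ≡ + 4 * p - + 4 * (c * c)
    expand = solve-∀
    isolate : ∀ c ψ → + 2 * c * (+ 2 * c) + ψ * ψ - + 4 * (c * c) ≡ ψ * ψ
    isolate = solve-∀

  -- Dividing by 4 gives p = c² + d² with c = 2 k + 1. As a is even, uniqueness can match c² only
  -- with b².
  odd-square : ∀ a b k ψ → + p ≡ a * a + b * b → (∃ λ e → a ≡ + 2 * e) → (∃ λ d → ψ ≡ + 2 * d) →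
               + 2 * (+ 2 * k + 1ℤ) * (+ 2 * (+ 2 * k + 1ℤ)) + ψ * ψ ≡ + 4 * + p →
               + 2 * (+ 2 * k + 1ℤ) * (+ 2 * (+ 2 * k + 1ℤ)) ≡ + 4 * (b * b)
  odd-square a b k ψ p≡a²+b² (e , a≡2e) (d , ψ≡2d) eq = Sum.[ even≡odd , odd≡odd ]′ (two-squares-unique a b c d p≡a²+b² p≡c²+d²)
    where
    c : ℤ
    c = + 2 * k + 1ℤ
    even≡odd : a * a ≡ c * c → + 2 * c * (+ 2 * c) ≡ + 4 * (b * b)
    even≡odd aa≡cc = contradiction (begin
      + 4 * (e * e)          ≡⟨ [2*]² e ⟨
      + 2 * e * (+ 2 * e)    ≡⟨ cong (λ x → x * x) a≡2e ⟨
      a * a                  ≡⟨ aa≡cc ⟩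
      c * c                  ∎) (4*≢odd² (e * e) k)
    odd≡odd : c * c ≡ b * b → + 2 * c * (+ 2 * c) ≡ + 4 * (b * b)
    odd≡odd cc≡bb = trans ([2*]² c) (cong (+ 4 *_) cc≡bb)
    collect : ∀ c d → + 2 * c * (+ 2 * c) + + 2 * d * (+ 2 * d) ≡ + 4 * (c * c + d * d)
    collect = solve-∀
    p≡c²+d² : + p ≡ c * c + d * d
    p≡c²+d² = ℤ.*-cancelˡ-≡ (+ 4) (+ p) (c * c + d * d) (begin
      + 4 * + p                                   ≡⟨ eq ⟨
      + 2 * c * (+ 2 * c) + ψ * ψ                 ≡⟨ cong (λ x → + 2 * c * (+ 2 * c) + x * x) ψ≡2d ⟩
      + 2 * c * (+ 2 * c) + + 2 * d * (+ 2 * d)   ≡⟨ collect c d ⟩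
      + 4 * (c * c + d * d)                       ∎)

-- The ordered clique count for primes and prime powers

module PrimeCase {p} (a b : ℤ) (p-prime : Prime p) (p%4≡1 : p ℕ.% 4 ≡ 1) (p≡a²+b² : + p ≡ a * a + b * b) where

  open ≡-Reasoning

  instance
    p≢0 : ℕ.NonZero p
    p≢0 = prime⇒nonZero p-prime

  open Residue p

  m : ℕ
  m = p ℕ./ 4

  p≡1+4m : + p ≡ 1ℤ + + 4 * + m
  p≡1+4m = begin
    + p                        ≡⟨ cong +_ (ℕ.m≡m%n+[m/n]*n p 4) ⟩
    + (p ℕ.% 4 ℕ.+ m ℕ.* 4)    ≡⟨ cong (λ r → + (r ℕ.+ m ℕ.* 4)) p%4≡1 ⟩
    1ℤ + + (m ℕ.* 4)           ≡⟨ cong (_+_ 1ℤ) (trans (ℤ.pos-* m 4) (ℤ.*-comm (+ m) (+ 4))) ⟩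
    1ℤ + + 4 * + m             ∎

  p-odd : Odd p
  p-odd = + 2 * + m , trans p≡1+4m (regroup (+ m))
    where
    regroup : ∀ m → 1ℤ + + 4 * m ≡ + 2 * (+ 2 * m) + 1ℤ
    regroup = solve-∀

  p∤1 : ¬ + p ∣ₛ 1ℤ
  p∤1 p∣1 with ℕ.∣1⇒≡1 (∣⇒∣ᵤ p∣1)
  ... | refl = ¬prime[1] p-prime

  p∤2 : ¬ + p ∣ₛ + 2
  p∤2 p∣2 = p∤1 (∣ₛ-resp (trans (cong (λ q → q + - + (2 ℕ.* m) * + 2) p≡1+4m) eq) (∣ₛ-+ (divides 1ℤ (sym (ℤ.*-identityˡ (+ p)))) (∣ₛ-* (- + (2 ℕ.* m)) p∣2)))
    where
    cancel : ∀ m → 1ℤ + + 4 * m + - (+ 2 * m) * + 2 ≡ 1ℤ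
    cancel = solve-∀
    eq : 1ℤ + + 4 * + m + - + (2 ℕ.* m) * + 2 ≡ 1ℤ
    eq = trans (cong (λ z → 1ℤ + + 4 * + m + - z * + 2) (ℤ.pos-* 2 m)) (cancel (+ m))

  #≡𝟘⇒∣ : ∀ {x} → # x ≡ 𝟘 → + p ∣ₛ x
  #≡𝟘⇒∣ {x} eq = ∣ₛ-resp (ℤ.+-identityʳ x) (#-injective eq)

  reciprocal : ∀ x → x ≢ 𝟘 → ∃ λ y → x ⊗ y ≡ 𝟙
  reciprocal x x≢𝟘 = from-Bézout (coprime⇒comaximal (prime⇒coprime p-prime {{x≢0}} (Fin.toℕ<n x)))
    where
    x≢0 : ℕ.NonZero (toℕ x)
    x≢0 = ℕ.≢-nonZero λ eq → x≢𝟘 (trans (sym (#-⟦⟧ x)) (cong (# ∘ +_) eq))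
    cancel : ∀ u v p x → x * v - (u * p + v * x) ≡ - u * p
    cancel = solve-∀
    from-Bézout : Comaximal p (toℕ x) → ∃ λ y → x ⊗ y ≡ 𝟙
    from-Bézout (u , v , eq) = # v , (begin
      x ⊗ # v             ≡⟨ cong (_⊗ # v) (#-⟦⟧ x) ⟨
      # ⟦ x ⟧ ⊗ # v       ≡⟨ #-* ⟦ x ⟧ v ⟨
      # (⟦ x ⟧ * v)       ≡⟨ #-cong (divides (- u) (trans (cong (λ o → ⟦ x ⟧ * v - o) (sym eq)) (cancel u v (+ p) ⟦ x ⟧))) ⟩
      𝟙                   ∎)

  -- Otherwise p divides a² = p - b², hence a, and p² divides p.
  p∤b : ¬ + p ∣ₛ b
  p∤b p∣b = not-both p∣b (euclid² p-prime a (∣ₛ-resp (trans (cong (_+ - b * b) p≡a²+b²) (cancel (a * a) b))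
                                               (∣ₛ-+ (divides 1ℤ (sym (ℤ.*-identityˡ (+ p)))) (∣ₛ-* (- b) p∣b))))
    where
    cancel : ∀ x b → x + b * b + - b * b ≡ x
    cancel = solve-∀
    collect : ∀ α β p → α * p * (α * p) + β * p * (β * p) ≡ p * ((α * α + β * β) * p)
    collect = solve-∀
    not-both : + p ∣ₛ b → ¬ + p ∣ₛ a
    not-both (divides β b≡βp) (divides α a≡αp) = p∤1 (divides (α * α + β * β) (ℤ.*-cancelˡ-≡ (+ p) 1ℤ ((α * α + β * β) * + p) (begin
      + p * 1ℤ                                      ≡⟨ ℤ.*-identityʳ (+ p) ⟩
      + p                                           ≡⟨ p≡a²+b² ⟩
      a * a + b * b                                 ≡⟨ cong₂ (λ x y → x * x + y * y) a≡αp b≡βp ⟩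
      α * + p * (α * + p) + β * + p * (β * + p)     ≡⟨ collect α β (+ p) ⟩
      + p * ((α * α + β * β) * + p)                 ∎)))

  #a²+#b²≡𝟘 : # a ⊗ # a ⊕ # b ⊗ # b ≡ 𝟘
  #a²+#b²≡𝟘 = begin
    # a ⊗ # a ⊕ # b ⊗ # b    ≡⟨ cong₂ _⊕_ (#-* a a) (#-* b b) ⟨
    # (a * a) ⊕ # (b * b)    ≡⟨ #-+ (a * a) (b * b) ⟨
    # (a * a + b * b)        ≡⟨ cong # p≡a²+b² ⟨
    # (+ p)                  ≡⟨ #-cong (divides 1ℤ (trans (ℤ.+-identityʳ (+ p)) (sym (ℤ.*-identityˡ (+ p))))) ⟩
    𝟘                        ∎

  -- (a / b)² = -1.
  √-1 : ∃ λ i → i ⊗ i ≡ ⊝ 𝟙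
  √-1 = quotient (# a) (# b) #a²+#b²≡𝟘 (reciprocal (# b) (p∤b ∘ #≡𝟘⇒∣))
    where
    open Solver
    quotient : ∀ x z → x ⊗ x ⊕ z ⊗ z ≡ 𝟘 → (∃ λ y → z ⊗ y ≡ 𝟙) → ∃ λ i → i ⊗ i ≡ ⊝ 𝟙
    quotient x z x²+z²≡𝟘 (y , zy≡𝟙) = x ⊗ y , (begin
      x ⊗ y ⊗ (x ⊗ y)
        ≡⟨ solve 3 (λ x z y → x :* y :* (x :* y) := (x :* x :+ z :* z) :* (y :* y) :- z :* y :* (z :* y)) refl x z y ⟩
      (x ⊗ x ⊕ z ⊗ z) ⊗ (y ⊗ y) ⊖ z ⊗ y ⊗ (z ⊗ y)
        ≡⟨ cong₂ (λ u v → u ⊗ (y ⊗ y) ⊖ v ⊗ v) x²+z²≡𝟘 zy≡𝟙 ⟩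
      𝟘 ⊗ (y ⊗ y) ⊖ 𝟙 ⊗ 𝟙
        ≡⟨ solve 1 (λ y → con 0ℤ :* (y :* y) :- con 1ℤ :* con 1ℤ := :- con 1ℤ) refl y ⟩
      ⊝ 𝟙  ∎)

  oddField : OddField p
  oddField = record
    { 𝟙≢𝟘     = p∤1 ∘ #≡𝟘⇒∣
    ; 2≢𝟘     = p∤2 ∘ #≡𝟘⇒∣
    ; inverse = reciprocal
    ; √-1     = √-1
    }

  open Characters p oddField using (zero-⊗; φ; UnitSquare; unitSquare?; jacobsthal; φ-half-odd; s⊖; 64*cliques)

  sq≡s : ∀ i j → sq p (⟦ i ⟧ - ⟦ j ⟧) ≡ s⊖ i j
  sq≡s i j = ι-cong (isUnitSquare? p z) (unitSquare? (i ⊖ j)) (to ∘ toℤ z) (fromℤ z ∘ from)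
    where
    z = ⟦ i ⟧ - ⟦ j ⟧
    #z : # z ≡ i ⊖ j
    #z = trans (#-∸ ⟦ i ⟧ ⟦ j ⟧) (cong₂ _⊖_ (#-⟦⟧ i) (#-⟦⟧ j))
    to : IsUnitSquareℤ p z → UnitSquare (i ⊖ j)
    to (unitSquare a u unit square) = # a , nonzero , trans (sym #z) (trans (#-cong square) (#-* a a))
      where
      nonzero : # a ≢ 𝟘
      nonzero #a≡𝟘 = p∤1 (#≡𝟘⇒∣ (begin
        # 1ℤ         ≡⟨ #-cong unit ⟨
        # (a * u)    ≡⟨ #-* a u ⟩
        # a ⊗ # u    ≡⟨ cong (_⊗ # u) #a≡𝟘 ⟩
        𝟘 ⊗ # u      ≡⟨ zero-⊗ (# u) ⟩
        𝟘            ∎))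
    from : UnitSquare (i ⊖ j) → IsUnitSquareℤ p z
    from (c , c≢𝟘 , i⊖j≡cc) = unitSquare ⟦ c ⟧ ⟦ y ⟧
      (#-injective (trans (#-* ⟦ c ⟧ ⟦ y ⟧) (trans (cong₂ _⊗_ (#-⟦⟧ c) (#-⟦⟧ y)) (proj₂ (reciprocal c c≢𝟘)))))
      (#-injective (trans #z (trans i⊖j≡cc (sym (trans (#-* ⟦ c ⟧ ⟦ c ⟧) (cong₂ _⊗_ (#-⟦⟧ c) (#-⟦⟧ c)))))))
      where y = proj₁ (reciprocal c c≢𝟘)

  φ² : (∃ λ e → a ≡ + 2 * e) → φ 𝟙 * φ 𝟙 ≡ + 4 * (b * b)
  φ² a-even = from-parts (φ 𝟙) (φ-half-odd (+ m) p≡1+4m) jacobsthal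
    where
    open TwoSquares p-prime
    -- `φ 𝟙` is generalised to f so that its value 2 (2 k + 1) can be matched by `refl`.
    from-parts : ∀ f → (∃ λ k → f ≡ + 2 * (+ 2 * k + 1ℤ)) → (∃ λ ψ → f * f + ψ * ψ ≡ + 4 * + p) → f * f ≡ + 4 * (b * b)
    from-parts f (k , refl) (ψ , eq) = odd-square a b k ψ p≡a²+b² a-even ([2c]²+ψ²≡4p⇒ψ-even (+ 2 * k + 1ℤ) ψ eq) eq

  64*ordered𝒦₄-prime : (∃ λ e → a ≡ + 2 * e) → + 64 * ordered𝒦₄ p ≡ + p * (+ p - 1ℤ) * ((+ p - + 9) * (+ p - + 9) - + 4 * (a * a))
  64*ordered𝒦₄-prime a-even = begin
    + 64 * ordered𝒦₄ p
      ≡⟨ cong (+ 64 *_) (orderedCliques-cong {p} 4 {w = λ _ → 1ℤ} {w′ = λ _ → 1ℤ} (λ _ → refl) sq≡s) ⟩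
    + 64 * orderedCliques 4 (λ _ → 1ℤ) s⊖
      ≡⟨ 64*cliques ⟩
    + p * (+ p - 1ℤ) * (+ p * + p - + 22 * + p + + 81 + φ 𝟙 * φ 𝟙)
      ≡⟨ cong (+ p * (+ p - 1ℤ) *_) (begin
           + p * + p - + 22 * + p + + 81 + φ 𝟙 * φ 𝟙                       ≡⟨ cong (_+_ (+ p * + p - + 22 * + p + + 81)) (φ² a-even) ⟩
           -- p² - 22 p + 81 = (p - 9)² - 4 p, and 4 p = 4 a² + 4 b² cancels 4 b².
           + p * + p - + 22 * + p + + 81 + + 4 * (b * b)                   ≡⟨ complete (+ p) (a * a) (b * b) ⟩
           (+ p - + 9) * (+ p - + 9) - + 4 * (+ p) + + 4 * (b * b)         ≡⟨ cong (λ q → (+ p - + 9) * (+ p - + 9) - + 4 * q + + 4 * (b * b)) p≡a²+b² ⟩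
           (+ p - + 9) * (+ p - + 9) - + 4 * (a * a + b * b) + + 4 * (b * b) ≡⟨ cancel (+ p) (a * a) (b * b) ⟩
           (+ p - + 9) * (+ p - + 9) - + 4 * (a * a)                       ∎) ⟩
    + p * (+ p - 1ℤ) * ((+ p - + 9) * (+ p - + 9) - + 4 * (a * a))  ∎
    where
    complete : ∀ p x y → p * p - + 22 * p + + 81 + + 4 * y ≡ (p - + 9) * (p - + 9) - + 4 * p + + 4 * y
    complete = solve-∀
    cancel : ∀ p x y → (p - + 9) * (p - + 9) - + 4 * (x + y) + + 4 * y ≡ (p - + 9) * (p - + 9) - + 4 * x
    cancel = solve-∀

  64*ordered𝒦₄-^ : (∃ λ e → a ≡ + 2 * e) → ∀ k → + 64 * ordered𝒦₄ (p ℕ.^ suc k) ≡ + (p ℕ.^ suc (4 ℕ.* k)) * (+ p - 1ℤ) * ((+ p - + 9) * (+ p - + 9) - + 4 * (a * a))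
  64*ordered𝒦₄-^ a-even k = begin
    + 64 * ordered𝒦₄ (p ℕ.^ suc k)
      ≡⟨ cong (+ 64 *_) (ordered𝒦₄-^ p-odd k) ⟩
    + 64 * ((+ (p ℕ.^ k)) ℤ.^ 4 * ordered𝒦₄ p)
      ≡⟨ left-comm (+ 64) ((+ (p ℕ.^ k)) ℤ.^ 4) (ordered𝒦₄ p) ⟩
    (+ (p ℕ.^ k)) ℤ.^ 4 * (+ 64 * ordered𝒦₄ p)
      ≡⟨ cong ((+ (p ℕ.^ k)) ℤ.^ 4 *_) (64*ordered𝒦₄-prime a-even) ⟩
    (+ (p ℕ.^ k)) ℤ.^ 4 * (+ p * (+ p - 1ℤ) * Y)
      ≡⟨ regroup ((+ (p ℕ.^ k)) ℤ.^ 4) (+ p) (+ p - 1ℤ) Y ⟩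
    (+ p * (+ (p ℕ.^ k)) ℤ.^ 4) * (+ p - 1ℤ) * Y
      ≡⟨ cong (λ z → z * (+ p - 1ℤ) * Y) (sym power) ⟩
    + (p ℕ.^ suc (4 ℕ.* k)) * (+ p - 1ℤ) * Y  ∎
    where
    Y = (+ p - + 9) * (+ p - + 9) - + 4 * (a * a)
    left-comm : ∀ a b c → a * (b * c) ≡ b * (a * c)
    left-comm = solve-∀
    regroup : ∀ q p r y → q * (p * r * y) ≡ p * q * r * y
    regroup = solve-∀
    pos-^ : ∀ x n → + (x ℕ.^ n) ≡ (+ x) ℤ.^ n
    pos-^ x zero    = refl
    pos-^ x (suc n) = trans (ℤ.pos-* x (x ℕ.^ n)) (cong (+ x *_) (pos-^ x n))
    power : + (p ℕ.^ suc (4 ℕ.* k)) ≡ + p * (+ (p ℕ.^ k)) ℤ.^ 4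
    power = trans (ℤ.pos-* p (p ℕ.^ (4 ℕ.* k))) (cong (+ p *_) (trans (cong +_ (trans (cong (p ℕ.^_) (ℕ.*-comm 4 k)) (sym (ℕ.^-*-assoc p k 4)))) (pos-^ (p ℕ.^ k) 4)))

-- From ordered tuples to cliques, and from prime powers to n

IsUnitSquareℤ-⊗ : ∀ {n y z} → IsUnitSquareℤ n y → IsUnitSquareℤ n z → IsUnitSquareℤ n (y * z)
IsUnitSquareℤ-⊗ {n} {y} {z} (unitSquare a u unit-a square-a) (unitSquare b v unit-b square-b) = unitSquare (a * b) (u * v)
  (∣ₛ-resp (units a b u v) (∣ₛ-+ (∣ₛ-* (b * v) unit-a) unit-b))
  (∣ₛ-resp (squares a b y z) (∣ₛ-+ (∣ₛ-* z square-a) (∣ₛ-* (a * a) square-b)))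
  where
  units : ∀ a b u v → b * v * (a * u - 1ℤ) + (b * v - 1ℤ) ≡ a * b * (u * v) - 1ℤ
  units = solve-∀
  squares : ∀ a b y z → z * (y - a * a) + a * a * (z - b * b) ≡ y * z - a * b * (a * b)
  squares = solve-∀

-- Modulo n, a u = 1 and a² = 0 give 1 = (a u)² = 0. This does happen for n = 1, hence a
-- divisibility in place of a negation.
¬IsUnitSquareℤ-0 : ∀ {n} → IsUnitSquareℤ n 0ℤ → + n ∣ₛ 1ℤ
¬IsUnitSquareℤ-0 (unitSquare a u unit square) = ∣ₛ-resp (identity a u) (∣ₛ-+ (∣ₛ-* (- (a * u + 1ℤ)) unit) (∣ₛ-* (- (u * u)) square))
  where
  identity : ∀ a u → - (a * u + 1ℤ) * (a * u - 1ℤ) + - (u * u) * (0ℤ - a * a) ≡ 1ℤ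
  identity = solve-∀

-- That -1 is a unit square makes adjacency symmetric, and n ≢ 1 makes it irreflexive, as
-- `!*count-cliques` requires; 24 is 4!.
24*𝒦₄≡ordered𝒦₄ : ∀ n .{{_ : ℕ.NonZero n}} → n ≢ 1 → IsUnitSquareℤ n -1ℤ → + 24 * + 𝒦 4 (paleyGraph n) ≡ ordered𝒦₄ n
24*𝒦₄≡ordered𝒦₄ n n≢1 -1□ = !*count-cliques n 4 {R = Adj} adj? Adj-sym Adj-irrefl {W = λ _ → ⊤} (λ _ → yes tt)
  (λ S → (∣ S ∣ ℕ.≟ 4) ×-dec isClique? (paleyGraph n) S)
  (λ S (∣S∣≡4 , clique) → ∣S∣≡4 , clique , λ _ _ → tt)
  (λ S (∣S∣≡4 , clique , _) → ∣S∣≡4 , clique)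
  where
  open Graph (paleyGraph n)
  negate : ∀ x y → -1ℤ * (x - y) ≡ y - x
  negate = solve-∀
  Adj-sym : ∀ x y → Adj x y → Adj y x
  Adj-sym x y xy = fromℤ (⟦ y ⟧ - ⟦ x ⟧) (subst (IsUnitSquareℤ n) (negate ⟦ x ⟧ ⟦ y ⟧) (IsUnitSquareℤ-⊗ -1□ (toℤ (⟦ x ⟧ - ⟦ y ⟧) xy)))
  Adj-irrefl : ∀ x → ¬ Adj x x
  Adj-irrefl x xx = n≢1 (ℤ∣1⇒≡1 (¬IsUnitSquareℤ-0 (subst (IsUnitSquareℤ n) (ℤ.+-inverseʳ ⟦ x ⟧) (toℤ (⟦ x ⟧ - ⟦ x ⟧) xx))))
    where
    ℤ∣1⇒≡1 : + n ∣ₛ 1ℤ → n ≡ 1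
    ℤ∣1⇒≡1 n∣1 = ℕ.∣1⇒≡1 (∣⇒∣ᵤ n∣1)

primes-comaximal : ∀ {p q} → Prime p → Prime q → p ≢ q → Comaximal p q
primes-comaximal {p} {q} p-prime q-prime p≢q with ℕ.<-cmp p q
... | tri< p<q _ _ = comaximal-sym (coprime⇒comaximal (prime⇒coprime q-prime {{prime⇒nonZero p-prime}} p<q))
... | tri≈ _ p≡q _ = contradiction p≡q p≢q
... | tri> _ _ q<p = coprime⇒comaximal (prime⇒coprime p-prime {{prime⇒nonZero q-prime}} q<p)

comaximal-∏ : ∀ {m k} (f : Fin k → ℕ) → (∀ i → Comaximal m (f i)) → Comaximal m (∏ℕ f)
comaximal-∏ {m} {zero}  f c = comaximal-1 m
comaximal-∏ {m} {suc k} f c = comaximal-* (c Fin.zero) (comaximal-∏ (f ∘ Fin.suc) (c ∘ Fin.suc))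

∏≢0 : ∀ {k} (f : Fin k → ℕ) → (∀ i → ℕ.NonZero (f i)) → ℕ.NonZero (∏ℕ f)
∏≢0 {zero}  f f≢0 = _
∏≢0 {suc k} f f≢0 = ℕ.m*n≢0 (f Fin.zero) (∏ℕ (f ∘ Fin.suc)) {{f≢0 Fin.zero}} {{∏≢0 (f ∘ Fin.suc) (f≢0 ∘ Fin.suc)}}

factor : ℕ → ℕ → ℤ → ℤ
factor p α a = + (p ℕ.^ (4 ℕ.* α ∸ 3)) ℤ.* (+ p ℤ.- + 1) ℤ.* ((+ p ℤ.- + 9) ℤ.^ 2 ℤ.- + 4 ℤ.* a ℤ.^ 2)

^2 : ∀ x → x ℤ.^ 2 ≡ x * x
^2 x = cong (x *_) (ℤ.*-identityʳ x)

module _ {p} (a b : ℤ) (p-prime : Prime p) (p%4≡1 : p % 4 ≡ 1) (p≡a²+b² : + p ≡ a ℤ.^ 2 ℤ.+ b ℤ.^ 2) where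

  open PrimeCase a b p-prime p%4≡1 (trans p≡a²+b² (cong₂ _+_ (^2 a) (^2 b)))

  64*ordered𝒦₄-prime-power : ∀ {α} → α ≥ 1 → + 2 ℤ.∣ a → + 64 * ordered𝒦₄ (p ℕ.^ α) ≡ factor p α a
  64*ordered𝒦₄-prime-power {suc k} _ 2∣a = trans (64*ordered𝒦₄-^ (even (∣ᵤ⇒∣ 2∣a)) k)
    -- The truncated subtraction loses nothing: with α = k + 1, 4 α ∸ 3 is 4 k + 1.
    (cong₂ (λ n y → + (p ℕ.^ n) * (+ p - + 1) * y) (sym (cong (_∸ 3) (ℕ.*-suc 4 k))) (cong₂ (λ x y → x - + 4 * y) (sym (^2 (+ p - + 9))) (sym (^2 a))))
    where
    even : + 2 ∣ₛ a → ∃ λ e → a ≡ + 2 * e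
    even (divides e a≡e2) = e , trans a≡e2 (ℤ.*-comm e (+ 2))

  -- A root i of -1 modulo p has inverse -i, and `IsUnitSquareℤ-^` lifts it to p ^ α.
  -1-unitSquare : ∀ {α} → α ≥ 1 → IsUnitSquareℤ (p ℕ.^ α) -1ℤ
  -1-unitSquare {suc k} _ = IsUnitSquareℤ-^ p-odd k (root √-1)
    where
    open Residue p
    open ≡-Reasoning
    root : (∃ λ i → i ⊗ i ≡ ⊝ 𝟙) → IsUnitSquareℤ p -1ℤ
    root (i , ii≡-1) = unitSquare ⟦ i ⟧ (- ⟦ i ⟧)
      (#-injective (begin
        # (⟦ i ⟧ * - ⟦ i ⟧)     ≡⟨ cong # (sym (ℤ.neg-distribʳ-* ⟦ i ⟧ ⟦ i ⟧)) ⟩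
        # (- (⟦ i ⟧ * ⟦ i ⟧))   ≡⟨ #-neg (⟦ i ⟧ * ⟦ i ⟧) ⟩
        ⊝ # (⟦ i ⟧ * ⟦ i ⟧)     ≡⟨ cong ⊝_ #ii≡-1 ⟩
        ⊝ # -1ℤ                 ≡⟨ #-neg -1ℤ ⟨
        # 1ℤ                    ∎))
      (#-injective (sym #ii≡-1))
      where
      #ii≡-1 : # (⟦ i ⟧ * ⟦ i ⟧) ≡ # -1ℤ
      #ii≡-1 = begin
        # (⟦ i ⟧ * ⟦ i ⟧)    ≡⟨ #-* ⟦ i ⟧ ⟦ i ⟧ ⟩
        # ⟦ i ⟧ ⊗ # ⟦ i ⟧    ≡⟨ cong₂ _⊗_ (#-⟦⟧ i) (#-⟦⟧ i) ⟩
        i ⊗ i                ≡⟨ ii≡-1 ⟩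
        ⊝ 𝟙                  ≡⟨ #-neg 1ℤ ⟨
        # -1ℤ                ∎

ordered𝒦₄-∏ : ∀ {k} (q : Fin k → ℕ) → (∀ i → ℕ.NonZero (q i)) → (∀ {i j} → i ≢ j → Comaximal (q i) (q j)) →
      ordered𝒦₄ (∏ℕ q) ≡ ∏ℤ (ordered𝒦₄ ∘ q)
ordered𝒦₄-∏ {zero}  q q≢0 c = refl
ordered𝒦₄-∏ {suc k} q q≢0 c = trans
  (ordered𝒦₄-* {{q≢0 Fin.zero}} {{∏≢0 (q ∘ Fin.suc) (q≢0 ∘ Fin.suc)}} (comaximal-∏ (q ∘ Fin.suc) λ i → c λ ()))
  (cong (ordered𝒦₄ (q Fin.zero) *_) (ordered𝒦₄-∏ (q ∘ Fin.suc) (q≢0 ∘ Fin.suc) (λ i≢j → c (i≢j ∘ Fin.suc-injective))))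

IsUnitSquareℤ-∏ : ∀ {k} (q : Fin k → ℕ) z → (∀ {i j} → i ≢ j → Comaximal (q i) (q j)) →
                  (∀ i → IsUnitSquareℤ (q i) z) → IsUnitSquareℤ (∏ℕ q) z
-- Modulo the empty product 1 any witnesses will do.
IsUnitSquareℤ-∏ {zero}  q z c z□ = unitSquare 0ℤ 0ℤ (divides -1ℤ refl) (divides (z - 0ℤ) (sym (ℤ.*-identityʳ (z - 0ℤ))))
IsUnitSquareℤ-∏ {suc k} q z c z□ = IsUnitSquareℤ-* (comaximal-∏ (q ∘ Fin.suc) λ i → c λ ()) (z□ Fin.zero)
  (IsUnitSquareℤ-∏ (q ∘ Fin.suc) z (λ i≢j → c (i≢j ∘ Fin.suc-injective)) (z□ ∘ Fin.suc))

∏-scale : ∀ {k} c (f : Fin k → ℤ) → + (c ℕ.^ k) * ∏ℤ f ≡ ∏ℤ (λ i → + c * f i)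
∏-scale {zero}  c f = refl
∏-scale {suc k} c f = begin
  + (c ℕ.* c ℕ.^ k) * (f Fin.zero * ∏ℤ (f ∘ Fin.suc))       ≡⟨ cong (_* (f Fin.zero * ∏ℤ (f ∘ Fin.suc))) (ℤ.pos-* c (c ℕ.^ k)) ⟩
  + c * + (c ℕ.^ k) * (f Fin.zero * ∏ℤ (f ∘ Fin.suc))       ≡⟨ regroup (+ c) (+ (c ℕ.^ k)) (f Fin.zero) (∏ℤ (f ∘ Fin.suc)) ⟩
  + c * f Fin.zero * (+ (c ℕ.^ k) * ∏ℤ (f ∘ Fin.suc))       ≡⟨ cong (+ c * f Fin.zero *_) (∏-scale c (f ∘ Fin.suc)) ⟩
  + c * f Fin.zero * ∏ℤ (λ i → + c * f (Fin.suc i))         ∎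
  where
  open ≡-Reasoning
  regroup : ∀ a b c d → a * b * (c * d) ≡ a * c * (b * d)
  regroup = solve-∀

/-≡ : ∀ x y d .{{_ : ℕ.NonZero d}} → x * + d ≡ y → x / 1 ≡ y / d
/-≡ x y (suc d) eq = ℚ.fromℚᵘ-cong {mkℚᵘ x 0} {mkℚᵘ y d} (*≡* (trans eq (sym (ℤ.*-identityʳ y))))

-- Splits the denominator into 4! for the orderings of a clique and 64 = 8² for each prime.
3*8^≡24*64^ : ∀ k → 3 ℕ.* 8 ℕ.^ (2 ℕ.* k ℕ.+ 1) ≡ 24 ℕ.* 64 ℕ.^ k
3*8^≡24*64^ k = begin
  3 ℕ.* 8 ℕ.^ (2 ℕ.* k ℕ.+ 1)    ≡⟨ cong (λ n → 3 ℕ.* 8 ℕ.^ n) (ℕ.+-comm (2 ℕ.* k) 1) ⟩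
  3 ℕ.* (8 ℕ.* 8 ℕ.^ (2 ℕ.* k))  ≡⟨ ℕ.*-assoc 3 8 (8 ℕ.^ (2 ℕ.* k)) ⟨
  24 ℕ.* 8 ℕ.^ (2 ℕ.* k)         ≡⟨ cong (24 ℕ.*_) (ℕ.^-*-assoc 8 2 k) ⟨
  24 ℕ.* 64 ℕ.^ k                ∎
  where open ≡-Reasoning

theorem1p3 : ∀ (n k : ℕ) (p α : Fin k → ℕ) (a b : Fin k → ℤ) →
    k ≥ 1 →
    (∀ i → α i ≥ 1) →
    (∀ i → Prime (p i)) →
    Injective _≡_ _≡_ p →
    (∀ i → p i % 4 ≡ 1) →
    n ≡ ∏ℕ (λ i → p i ℕ.^ α i) →
    (∀ i → + p i ≡ a i ℤ.^ 2 ℤ.+ b i ℤ.^ 2) →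
    (∀ i → + 2 ℤ.∣ a i) →
    + 𝒦 4 (paleyGraph n) / 1
    ≡ _/_ (∏ℤ (λ i → + (p i ℕ.^ (4 ℕ.* α i ∸ 3)) ℤ.* (+ p i ℤ.- + 1)
    ℤ.* ((+ p i ℤ.- + 9) ℤ.^ 2 ℤ.- + 4 ℤ.* a i ℤ.^ 2)))
    (3 ℕ.* 8 ℕ.^ (2 ℕ.* k ℕ.+ 1)) {{3*8^n≢0 (2 ℕ.* k ℕ.+ 1)}}
theorem1p3 n k@(suc _) p α a b _ α≥1 p-prime p-inj p%4≡1 refl p≡a²+b² 2∣a =
  /-≡ K _ (3 ℕ.* 8 ℕ.^ (2 ℕ.* k ℕ.+ 1)) {{3*8^n≢0 (2 ℕ.* k ℕ.+ 1)}} (begin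
    K * + (3 ℕ.* 8 ℕ.^ (2 ℕ.* k ℕ.+ 1))   ≡⟨ cong (λ d → K * + d) (3*8^≡24*64^ k) ⟩
    K * + (24 ℕ.* 64 ℕ.^ k)               ≡⟨ cong (K *_) (ℤ.pos-* 24 (64 ℕ.^ k)) ⟩
    K * (+ 24 * + (64 ℕ.^ k))             ≡⟨ regroup K (+ 24) (+ (64 ℕ.^ k)) ⟩
    + (64 ℕ.^ k) * (+ 24 * K)             ≡⟨ cong (+ (64 ℕ.^ k) *_) (24*𝒦₄≡ordered𝒦₄ n {{∏≢0 q q≢0}} n≢1 -1□) ⟩
    + (64 ℕ.^ k) * ordered𝒦₄ n                    ≡⟨ cong (+ (64 ℕ.^ k) *_) (ordered𝒦₄-∏ q q≢0 comaximal) ⟩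
    + (64 ℕ.^ k) * ∏ℤ (ordered𝒦₄ ∘ q)             ≡⟨ ∏-scale 64 (ordered𝒦₄ ∘ q) ⟩
    ∏ℤ (λ i → + 64 * ordered𝒦₄ (q i))             ≡⟨ ∏ℤ-cong (λ i → 64*ordered𝒦₄-prime-power (a i) (b i) (p-prime i) (p%4≡1 i) (p≡a²+b² i) (α≥1 i) (2∣a i)) ⟩
    ∏ℤ (λ i → factor (p i) (α i) (a i))   ∎)
  where
  open ≡-Reasoning
  K = + 𝒦 4 (paleyGraph n)
  q : Fin k → ℕ
  q i = p i ℕ.^ α i
  q≢0 : ∀ i → ℕ.NonZero (q i)
  q≢0 i = ℕ.m^n≢0 (p i) (α i) {{prime⇒nonZero (p-prime i)}}
  comaximal : ∀ {i j} → i ≢ j → Comaximal (q i) (q j)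
  comaximal {i} {j} i≢j = comaximal-^ (comaximal-sym (comaximal-^ (comaximal-sym (primes-comaximal (p-prime i) (p-prime j) (i≢j ∘ p-inj))) (α i))) (α j)
  -1□ : IsUnitSquareℤ n -1ℤ
  -1□ = IsUnitSquareℤ-∏ q -1ℤ comaximal λ i → -1-unitSquare (a i) (b i) (p-prime i) (p%4≡1 i) (p≡a²+b² i) (α≥1 i)
  regroup : ∀ a b c → a * (b * c) ≡ c * (b * a)
  regroup = solve-∀
  -- If the product were 1, so would be its first factor p ^ α and, as α ≥ 1, the prime p itself; k
  -- ≥ 1 supplies this factor.
  n≢1 : n ≢ 1
  n≢1 n≡1 with α Fin.zero | α≥1 Fin.zero | ℕ.m*n≡1⇒m≡1 (q Fin.zero) (∏ℕ (q ∘ Fin.suc)) n≡1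
  ... | suc α₀ | _ | eq = ¬prime[1] (subst Prime (ℕ.m*n≡1⇒m≡1 (p Fin.zero) (p Fin.zero ℕ.^ α₀) eq) (p-prime Fin.zero))
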